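{- Let $\mathcal N,\mathcal N'$ be two one-counter nets. The largest weak simulation relation $\sqsubseteq$ with respect to $\mathcal N,\mathcal N'$ is a semilinear set and a representation of it is effectively computable.
   Context: OCN $(Q,\mathrm{Act},\delta)$ with $\delta\subseteq Q\times\mathrm{Act}\times\{ -1,0,1\}\times Q$ induces the LTS on $Q\times\mathbb N$ with $pm\xrightarrow{a}qn$ iff $(p,a,d,q)\in\delta$, $n=m+d\ge0$. With silent action $\tau$, weak steps: $\overset{\tau}{\Longrightarrow}=(\xrightarrow{\tau})^*$, $\overset{a}{\Longrightarrow}=(\xrightarrow{\tau})^*\xrightarrow{a}(\xrightarrow{\tau})^*$ for $a\ne\tau$. The largest weak simulation $\sqsubseteq\subseteq Q\times\mathbb N\times Q'\times\mathbb N$ is the largest $R$ such that $(c,c')\in R$, $c\xrightarrow{a}d$ imply some $c'\overset{a}{\Longrightarrow}d'$ with $(d,d')\in R$. Semilinear: for each pair of control states the corresponding subset of $\mathbb N^2$ is a finite union of linear sets. -}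

module Defs where

open import Level using (Level; _⊔_) renaming (suc to lsuc; zero to lzero)
open import Data.Nat using (ℕ; zero; suc; _+_)
open import Data.Fin using (Fin)
open import Data.Maybe using (Maybe; just; nothing)
open import Data.Product using (Σ; ∃; _×_; _,_)
open import Data.List using (List)
open import Data.List.Membership.Propositional using (_∈_)
open import Data.List.Relation.Unary.Any using (Any)
open import Relation.Binary.PropositionalEquality using (_≡_)

data Dir : Set where
  dec stay inc : Dir

-- n = m + d  (with n ≥ 0 automatic since n : ℕ)
Eff : Dir → ℕ → ℕ → Set
Eff dec  m n = m ≡ suc n
Eff stay m n = n ≡ m
Eff inc  m n = n ≡ suc m

Act : ℕ → Set
Act k = Maybe (Fin k)

τ : {k : ℕ} → Act k
τ = nothing

record OCN (k : ℕ) : Set where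
  field
    nQ : ℕ
    δ  : List (Fin nQ × Act k × Dir × Fin nQ)

open OCN public

Conf : {k : ℕ} → OCN k → Set
Conf N = Fin (nQ N) × ℕ

data Step {k : ℕ} (N : OCN k) : Conf N → Act k → Conf N → Set where
  step : ∀ {p a d q m n} → (p , a , d , q) ∈ δ N → Eff d m n →
         Step N (p , m) a (q , n)

data TauStar {k : ℕ} (N : OCN k) : Conf N → Conf N → Set where
  τ-refl : ∀ {c} → TauStar N c c
  τ-step : ∀ {c d e} → Step N c τ d → TauStar N d e → TauStar N c e

WeakStep : {k : ℕ} (N : OCN k) → Conf N → Act k → Conf N → Set
WeakStep N c nothing  d = TauStar N c d
WeakStep N c (just a) d =
  Σ (Conf N) λ c₁ → Σ (Conf N) λ d₁ →
    TauStar N c c₁ × Step N c₁ (just a) d₁ × TauStar N d₁ d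

IsWeakSim : {k : ℕ} (N N' : OCN k) → (Conf N → Conf N' → Set) → Set
IsWeakSim N N' R =
  ∀ c c' a d → R c c' → Step N c a d →
    Σ (Conf N') λ d' → WeakStep N' c' a d' × R d d'

LargestWeakSim : {k : ℕ} (N N' : OCN k) → Conf N → Conf N' → Set₁
LargestWeakSim N N' c c' =
  Σ (Conf N → Conf N' → Set) λ R → IsWeakSim N N' R × R c c'

record Linear : Set where
  constructor linear
  field
    base    : ℕ × ℕ
    periods : List (ℕ × ℕ)

open Linear public

data InSpan (ps : List (ℕ × ℕ)) : ℕ → ℕ → Set where
  span-zero : InSpan ps 0 0
  span-add  : ∀ {px py x y} → (px , py) ∈ ps → InSpan ps x y →
              InSpan ps (px + x) (py + y)

InLinear : Linear → ℕ → ℕ → Set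
InLinear (linear (b₁ , b₂) ps) m n =
  Σ ℕ λ x → Σ ℕ λ y → InSpan ps x y × m ≡ b₁ + x × n ≡ b₂ + y

Semilinear : Set
Semilinear = List Linear

InSemilinear : Semilinear → ℕ → ℕ → Set
InSemilinear S m n = Any (λ L → InLinear L m n) S

{-# OPTIONS --safe #-}

-- Both nets are played as a game on pairs of control states with Spoiler's counter m and Duplicator's counter n;
-- the winning region of Duplicator lies above a monotone frontier n = f(m) for every pair of control states.
--
-- A weak step either changes n by a bounded amount, once n exceeds a threshold, or it contains a cycle that can be
-- pumped, and then n may be chosen arbitrarily (an ω-move). An ω-move to a pair wins as long as m is below the first
-- column where the frontier of that pair is infinite. These columns are approximated from above: starting with ∞,
-- solve the game with the current guesses and lower them, until they are stable.
--
-- In a game without ω-moves the frontier stays within a constant distance of a line of rational slope, or is infinite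
-- from some column on: for the finitely many slopes j / D, play until a control pair recurs and ask which side of the
-- line the cycle lies on. If Duplicator can enforce cycles that do not descend below the line, or reach a pair that she
-- wins for a flatter line, she wins far above it. If Spoiler can enforce cycles strictly below the line for j / D, these
-- are not above the line for (j + 1) / D, because D is a common multiple of their widths; so starting far below the
-- latter he gets far below the former, and wins by induction on j.
--
-- Belts of different slopes are disjoint far out, and inside a belt only the height over its line matters. By the
-- pigeonhole principle two columns look alike, so the frontier is periodic from a column and with a period that are
-- known in advance; its values before that are bounded as well. Hence the winning region is one of finitely many
-- explicit candidates. Whether a candidate is a simulation is decidable, and the winning region is the union of those
-- that are; that it is among them only has to be shown up to double negation, so that this part may argue classically.

module Submission where

open import Defs
open import Data.Nat as ℕ using (ℕ; zero; suc; z≤n; s≤s)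
import Data.Nat.Properties as ℕP
open import Data.Fin using (Fin; zero; suc; toℕ; fromℕ<; funToFin; finToFun; combine; remQuot)
import Data.Fin.Properties as FP
open import Data.Maybe using (Maybe; just; nothing)
import Data.Maybe.Properties as MaybeP
open import Data.Product using (Σ; ∃; _×_; _,_; proj₁; proj₂)
open import Data.Sum using (_⊎_; inj₁; inj₂)
open import Data.Empty using (⊥; ⊥-elim)
open import Data.Unit using (⊤; tt)
open import Data.List using (List; []; _∷_; _++_; length; map; concatMap; lookup; upTo; allFin)
open import Data.List.Properties using (length-map)
open import Data.List.Membership.Propositional using (_∈_; find; lose)
open import Data.List.Membership.Propositional.Properties using (∈-lookup; ∈-allFin; ∈-map⁺; ∈-map⁻; ∈-++⁺ˡ; ∈-++⁺ʳ; ∈-++⁻; ∈-upTo⁺)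
open import Data.List.Relation.Unary.Any using (Any; here; there; any?)
import Data.List.Relation.Unary.Any.Properties as AnyP
open import Data.List.Relation.Unary.All using (all?)
import Data.List.Relation.Unary.All as All
import Data.List.Relation.Unary.All.Properties as AllP
import Data.List.Relation.Unary.AllPairs as AP
open import Data.List.Relation.Unary.Unique.Propositional using (Unique)
open import Function using (_∘_)
open import Function.Bundles using (_⇔_; mk⇔)
open import Relation.Binary.Definitions using (tri<; tri≈; tri>)
open import Relation.Binary.PropositionalEquality using (_≡_; refl; sym; trans; cong; cong₂; subst; subst₂)
open import Relation.Nullary using (¬_; Dec; yes; no; contradiction)
open import Relation.Nullary.Decidable using (map′; _×-dec_; _⊎-dec_; _→-dec_; decidable-stable; ¬¬-excluded-middle)

-- Decidability and classical reasoning over finite domains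

∃∈? : ∀ {A : Set} {P : A → Set} → (∀ x → Dec (P x)) → (xs : List A) → Dec (Σ A λ x → x ∈ xs × P x)
∃∈? P? xs = map′ find (λ (_ , x∈ , px) → lose x∈ px) (any? P? xs)

∀∈? : ∀ {A : Set} {P : A → Set} → (∀ x → Dec (P x)) → (xs : List A) → Dec (∀ x → x ∈ xs → P x)
∀∈? P? xs = map′ (λ ps x x∈ → All.lookup ps x∈) (λ f → All.tabulate λ {x} → f x) (all? P? xs)

¬¬-∀Fin : ∀ {n} {P : Fin n → Set} → (∀ i → ¬ ¬ P i) → ¬ ¬ (∀ i → P i)
¬¬-∀Fin {zero}  f ¬all = ¬all λ ()
¬¬-∀Fin {suc n} f ¬all =
  f zero λ p₀ → ¬¬-∀Fin (f ∘ suc) λ ps → ¬all λ { zero → p₀ ; (suc i) → ps i }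

-- A compactness argument: if the head of the list fails at some `k₀`, antitonicity makes it fail at
-- all later stages, so from there on the witnesses lie in the tail. It turns responses that survive
-- each number of rounds into one that survives all.
¬¬-∃∈-∀ : ∀ {A : Set} {Q : ℕ → A → Set} → (∀ k x → Dec (Q k x)) →
  (∀ {k l x} → k ℕ.≤ l → Q l x → Q k x) → (xs : List A) →
  (∀ k → Σ A λ x → x ∈ xs × Q k x) → ¬ ¬ (Σ A λ x → x ∈ xs × (∀ k → Q k x))
¬¬-∃∈-∀ Q? anti [] f ¬g with f 0
... | _ , () , _
¬¬-∃∈-∀ {Q = Q} Q? anti (x ∷ xs) f ¬g = ¬∃ λ (k₀ , ¬q) →
    ¬¬-∃∈-∀ Q? anti xs (tail k₀ ¬q) λ (y , y∈ , qs) → ¬g (y , there y∈ , qs)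
  where
  ¬∃ : ¬ ¬ ∃ λ k → ¬ Q k x
  ¬∃ none = ¬g (x , here refl , λ k → decidable-stable (Q? k x) λ ¬q → none (k , ¬q))
  tail : ∀ k₀ → ¬ Q k₀ x → ∀ k → Σ _ λ y → y ∈ xs × Q k y
  tail k₀ ¬q k with f (k ℕ.⊔ k₀)
  ... | _ , here refl , q = contradiction (anti (ℕP.m≤n⊔m k k₀) q) ¬q
  ... | y , there y∈ , q = y , y∈ , anti (ℕP.m≤m⊔n k k₀) q

dec→Fin : ∀ {P : Set} → Dec P → Fin 2
dec→Fin (yes _) = zero
dec→Fin (no _)  = suc zero

dec→Fin-≡ : ∀ {P Q : Set} (p : Dec P) (q : Dec Q) → dec→Fin p ≡ dec→Fin q → P → Q
dec→Fin-≡ _       (yes q) _  _ = q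
dec→Fin-≡ (no ¬p) (no _)  _  p = contradiction p ¬p
dec→Fin-≡ (yes _) (no _)  () _

-- Only finitely many cells are inspected, so under the double negation all of them may be assumed
-- decided. Each of the first `2 ^ N + 1` rows is then a word of `N` bits, and the pigeonhole
-- principle applies.
¬¬-repeated-row : ∀ N (P : ℕ → Fin N → Set) →
  ¬ ¬ (∃ λ i → ∃ λ j → i ℕ.< j × j ℕ.≤ 2 ℕ.^ N × (∀ b → P i b → P j b) × (∀ b → P j b → P i b))
¬¬-repeated-row N P ¬g =
  ¬¬-∀Fin {suc (2 ℕ.^ N)} {λ i → ∀ b → Dec (P (toℕ i) b)} (λ i → ¬¬-∀Fin λ b → ¬¬-excluded-middle) go
  where
  go : ¬ ((i : Fin (suc (2 ℕ.^ N))) → ∀ b → Dec (P (toℕ i) b))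
  go P? with FP.pigeonhole (ℕP.n<1+n (2 ℕ.^ N)) (λ i → funToFin λ b → dec→Fin (P? i b))
  ... | i , j , i<j , eq = ¬g (toℕ i , toℕ j , i<j , ℕP.≤-pred (FP.toℕ<n j) ,
          (λ b → dec→Fin-≡ (P? i b) (P? j b) (same b)) ,
          (λ b → dec→Fin-≡ (P? j b) (P? i b) (sym (same b))))
    where
    same : ∀ b → dec→Fin (P? i b) ≡ dec→Fin (P? j b)
    same b = trans (sym (FP.finToFun-funToFin (λ b → dec→Fin (P? i b)) b))
            (trans (cong (λ c → finToFun {2} {N} c b) eq)
                   (FP.finToFun-funToFin (λ b → dec→Fin (P? j b)) b))

-- Games with finitely many rounds and their limit

record Resp (K : ℕ) : Set where
  constructor resp
  field
    need gain : ℕ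
    tgt       : Fin K

open Resp public

-- A bonus `(t , x)` models an ω-move to a pair whose guessed column is `x`: it requires `t` of
-- Duplicator's counter and wins at once if Spoiler's counter is below `x`.
record Move (K : ℕ) : Set where
  constructor move
  field
    dir   : Dir
    resps : List (Resp K)
    bonus : List (ℕ × ℕ)

open Move public

Game : ℕ → Set
Game K = Fin K → List (Move K)

after : ∀ {K} → Resp K → ℕ → ℕ
after r n = n ℕ.∸ need r ℕ.+ gain r

Answer : ∀ {K} → (Fin K → ℕ → ℕ → Set) → ℕ → Move K → ℕ → Set
Answer R n mv m' =
  (∃ λ r → r ∈ resps mv × (need r ℕ.≤ n × R (tgt r) m' (after r n))) ⊎
  (∃ λ b → b ∈ bonus mv × (proj₁ b ℕ.≤ n × m' ℕ.< proj₂ b))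

∀Eff? : ∀ {P : ℕ → Set} → (∀ m' → Dec (P m')) → ∀ d m → Dec (∀ m' → Eff d m m' → P m')
∀Eff? P? dec zero    = yes λ _ ()
∀Eff? P? dec (suc m) = map′ (λ { p _ refl → p }) (λ f → f m refl) (P? m)
∀Eff? P? stay m      = map′ (λ { p _ refl → p }) (λ f → f m refl) (P? m)
∀Eff? P? inc  m      = map′ (λ { p _ refl → p }) (λ f → f (suc m) refl) (P? (suc m))

module Basics {K : ℕ} (G : Game K) where

  IsSim : (Fin K → ℕ → ℕ → Set) → Set
  IsSim R = ∀ v m n → R v m n → ∀ mv → mv ∈ G v → ∀ m' → Eff (dir mv) m m' → Answer R n mv m'

  -- The winning region is approached by the number of rounds because each `Win k` is decidable,
  -- whereas nothing decides the limit at this stage.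
  Win : ℕ → Fin K → ℕ → ℕ → Set
  Win zero    v m n = ⊤
  Win (suc k) v m n = ∀ mv → mv ∈ G v → ∀ m' → Eff (dir mv) m m' → Answer (Win k) n mv m'

  S∞ : Fin K → ℕ → ℕ → Set
  S∞ v m n = ∀ k → Win k v m n

  Win? : ∀ k v m n → Dec (Win k v m n)
  Answer? : ∀ k n mv m' → Dec (Answer (Win k) n mv m')
  Win? zero    v m n = yes tt
  Win? (suc k) v m n = ∀∈? (λ mv → ∀Eff? (Answer? k n mv) (dir mv) m) (G v)
  Answer? k n mv m' =
    ∃∈? (λ r → (need r ℕ.≤? n) ×-dec Win? k (tgt r) m' (after r n)) (resps mv) ⊎-dec
    ∃∈? (λ b → (proj₁ b ℕ.≤? n) ×-dec (m' ℕ.<? proj₂ b)) (bonus mv)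

  Win-anti : ∀ {k l v m n} → k ℕ.≤ l → Win l v m n → Win k v m n
  Win-anti z≤n _ = tt
  Win-anti (s≤s k≤l) w mv mv∈ m' e with w mv mv∈ m' e
  ... | inj₁ (r , r∈ , t≤n , w') = inj₁ (r , r∈ , t≤n , Win-anti k≤l w')
  ... | inj₂ b = inj₂ b

  Eff-≤ : ∀ d {m₁ m₂ m₁'} → m₁ ℕ.≤ m₂ → Eff d m₁ m₁' → ∃ λ m₂' → Eff d m₂ m₂' × m₁' ℕ.≤ m₂'
  Eff-≤ dec  {m₂ = suc m₂} (s≤s le) refl = m₂ , refl , le
  Eff-≤ stay le refl = _ , refl , le
  Eff-≤ inc  le refl = _ , refl , s≤s le

  -- A Spoiler move enabled at `m₁` is enabled at `m₂` as well and keeps the order of the columns,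
  -- so Duplicator can copy the answer given there; a larger `n` leaves it affordable.
  Win-mono : ∀ k {v m₁ m₂ n₁ n₂} → m₁ ℕ.≤ m₂ → n₂ ℕ.≤ n₁ → Win k v m₂ n₂ → Win k v m₁ n₁
  Win-mono zero m≤ n≤ w = tt
  Win-mono (suc k) m≤ n≤ w mv mv∈ m' e with Eff-≤ (dir mv) m≤ e
  ... | m₂' , e₂ , le with w mv mv∈ m₂' e₂
  ... | inj₁ (r , r∈ , t≤n , w') = inj₁ (r , r∈ , ℕP.≤-trans t≤n n≤ ,
          Win-mono k le (ℕP.+-monoˡ-≤ (gain r) (ℕP.∸-monoˡ-≤ (need r) n≤)) w')
  ... | inj₂ (b , b∈ , t≤n , m<) = inj₂ (b , b∈ , ℕP.≤-trans t≤n n≤ , ℕP.≤-<-trans le m<)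

  S∞-mono : ∀ {v m₁ m₂ n₁ n₂} → m₁ ℕ.≤ m₂ → n₂ ℕ.≤ n₁ → S∞ v m₂ n₂ → S∞ v m₁ n₁
  S∞-mono m≤ n≤ s k = Win-mono k m≤ n≤ (s k)

  sim⊆Win : ∀ {R} → IsSim R → ∀ k {v m n} → R v m n → Win k v m n
  sim⊆Win sim zero    r = tt
  sim⊆Win sim (suc k) r mv mv∈ m' e with sim _ _ _ r mv mv∈ m' e
  ... | inj₁ (rs , r∈ , t≤n , r') = inj₁ (rs , r∈ , t≤n , sim⊆Win sim k r')
  ... | inj₂ b = inj₂ b

  sim⊆S∞ : ∀ {R} → IsSim R → ∀ {v m n} → R v m n → S∞ v m n
  sim⊆S∞ sim r k = sim⊆Win sim k r

  -- A bonus does not depend on the number of rounds, so a bonus at any level settles the claim;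
  -- otherwise a response is available at every level, and the compactness argument applies to the
  -- finite list of responses. The double negation disappears only in `S∞-sim`, once explicit
  -- candidates are available.
  S∞-step : ∀ {v m n} → S∞ v m n → ∀ mv → mv ∈ G v → ∀ m' → Eff (dir mv) m m' →
    ¬ ¬ Answer S∞ n mv m'
  S∞-step {v} {m} {n} s mv mv∈ m' e ¬a =
    ¬¬-∃∈-∀ {Q = λ k r → need r ℕ.≤ n × Win k (tgt r) m' (after r n)}
      (λ k r → (need r ℕ.≤? n) ×-dec Win? k (tgt r) m' (after r n))
      (λ k≤l (t≤n , w) → t≤n , Win-anti k≤l w)
      (resps mv)
      answers
      λ (r , r∈ , ws) → ¬a (inj₁ (r , r∈ , proj₁ (ws 0) , λ k → proj₂ (ws k)))
    where
    answers : ∀ k → ∃ λ r → r ∈ resps mv × (need r ℕ.≤ n × Win k (tgt r) m' (after r n))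
    answers k with s (suc k) mv mv∈ m' e
    ... | inj₁ a = a
    ... | inj₂ b = contradiction (inj₂ b) ¬a

-- Frontiers of games without ω-moves

module GameSolution where
  open import Data.Integer using (ℤ; +_; -[1+_]; _+_; _*_; -_; _-_; ∣_∣; _≤_; _<_; +≤+; +<+; -≤+; _≤?_; 0ℤ; 1ℤ; Positive; positive)
  import Data.Integer.Properties as ℤP
  open import Data.Integer.Tactic.RingSolver using (solve)
  open import Data.Nat using (_!; _^_)
  open import Data.Nat.Divisibility using (_∣_; divides; ∣-trans; m∣m*n; m≤n⇒m!∣n!)

  -- Lists without repetition, integer inequalities and heights

  ¬∀∈⇒∃∈¬ : ∀ {A : Set} {P : A → Set} → (∀ x → Dec (P x)) → ∀ xs →
    ¬ (∀ x → x ∈ xs → P x) → ∃ λ x → x ∈ xs × ¬ P x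
  ¬∀∈⇒∃∈¬ P? xs ¬∀ = find (AllP.¬All⇒Any¬ P? xs λ ps → ¬∀ λ x x∈ → All.lookup ps x∈)

  Unique-lookup : ∀ {A : Set} {xs : List A} → Unique xs → ∀ i j → lookup xs i ≡ lookup xs j → i ≡ j
  Unique-lookup (_  AP.∷ _) zero    zero    _  = refl
  Unique-lookup (ne AP.∷ _) zero    (suc j) eq = contradiction eq (All.lookup ne (∈-lookup j))
  Unique-lookup (ne AP.∷ _) (suc i) zero    eq = contradiction (sym eq) (All.lookup ne (∈-lookup i))
  Unique-lookup (_  AP.∷ u) (suc i) (suc j) eq = cong suc (Unique-lookup u i j eq)

  Unique-length : ∀ {K} {xs : List (Fin K)} → Unique xs → length xs ℕ.≤ K
  Unique-length u = FP.injective⇒≤ λ {i} {j} → Unique-lookup u i j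

  -- An inequality over ℤ is proved by writing its slack as a sum of slacks of known ones, a ring identity.

  slack : ∀ {i j} → i ≤ j → 0ℤ ≤ j - i
  slack = ℤP.i≤j⇒0≤j-i

  infixl 6 _⊕_
  _⊕_ : ∀ {i j} → 0ℤ ≤ i → 0ℤ ≤ j → 0ℤ ≤ i + j
  p ⊕ q = ℤP.+-mono-≤ p q

  linear-≤ : ∀ {i j s} → 0ℤ ≤ s → j - i ≡ s → i ≤ j
  linear-≤ p eq = ℤP.0≤i-j⇒j≤i (subst (0ℤ ≤_) (sym eq) p)

  0≤+ : ∀ {n} → 0ℤ ≤ + n
  0≤+ = +≤+ z≤n

  0≤* : ∀ {i j} → 0ℤ ≤ i → 0ℤ ≤ j → 0ℤ ≤ i * j
  0≤* {+ i} {+ j} _ _ = subst (0ℤ ≤_) (ℤP.pos-* i j) 0≤+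

  i≤+∣i∣ : ∀ i → i ≤ + ∣ i ∣
  i≤+∣i∣ (+ n)    = ℤP.≤-refl
  i≤+∣i∣ -[1+ n ] = -≤+

  -i≤+∣i∣ : ∀ i → - i ≤ + ∣ i ∣
  -i≤+∣i∣ i = subst (- i ≤_) (cong +_ (ℤP.∣-i∣≡∣i∣ i)) (i≤+∣i∣ (- i))

  -- ht b a x y is the height of (x , y) above the line through 0 in direction (b , a).
  ht : ℤ → ℤ → ℤ → ℤ → ℤ
  ht b a x y = b * y - a * x

  ht-+ : ∀ b a x y x' y' → ht b a (x + x') (y + y') ≡ ht b a x y + ht b a x' y'
  ht-+ b a x y x' y' = expanded
    where
    expanded : b * (y + y') - a * (x + x') ≡ (b * y - a * x) + (b * y' - a * x')
    expanded = solve (b ∷ a ∷ x ∷ y ∷ x' ∷ y' ∷ [])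

  ht-cycle : ∀ b a x y d e x₀ y₀ → ht b a (x + d - x₀) (y + e - y₀) ≡
    ht b a x y + ht b a d e - ht b a x₀ y₀
  ht-cycle b a x y d e x₀ y₀ = expanded
    where
    expanded : b * (y + e - y₀) - a * (x + d - x₀) ≡ b * y - a * x + (b * e - a * d) - (b * y₀ - a * x₀)
    expanded = solve (b ∷ a ∷ x ∷ y ∷ d ∷ e ∷ x₀ ∷ y₀ ∷ [])

  ht-≤ : ∀ b a {x y X Y B A : ℤ} → 0ℤ ≤ b → 0ℤ ≤ a → 0ℤ ≤ X → 0ℤ ≤ Y → b ≤ B → a ≤ A →
    y ≤ Y → - x ≤ X → b * y - a * x ≤ B * Y + A * X
  ht-≤ b a {x} {y} {X} {Y} {B} {A} 0≤b 0≤a 0≤X 0≤Y b≤B a≤A y≤Y x≤X =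
    linear-≤ (0≤* 0≤b (slack y≤Y) ⊕ 0≤* 0≤a (slack x≤X) ⊕ 0≤* (slack b≤B) 0≤Y ⊕ 0≤* (slack a≤A) 0≤X)
      (solve (b ∷ a ∷ x ∷ y ∷ X ∷ Y ∷ B ∷ A ∷ []))

  shift : Dir → ℤ
  shift dec  = - 1ℤ
  shift stay = 0ℤ
  shift inc  = 1ℤ

  effect : ∀ {K} → Resp K → ℤ
  effect r = + gain r - + need r

  Eff-shift : ∀ d {m m'} → Eff d m m' → + m' ≡ + m + shift d
  Eff-shift dec  {m' = m'} refl = refl
  Eff-shift stay refl = sym (ℤP.+-identityʳ _)
  Eff-shift inc  {m} refl = cong +_ (ℕP.+-comm 1 m)

  after-effect : ∀ {K} (r : Resp K) {n} → need r ℕ.≤ n → + after r n ≡ + n + effect r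
  after-effect r {n} t≤n = trans (ℤP.pos-+ (n ℕ.∸ need r) (gain r))
    (trans (cong (_+ + gain r) (trans (sym (ℤP.⊖-≥ t≤n)) (sym (ℤP.m-n≡m⊖n n (need r)))))
      (rearrange (+ n) (+ need r) (+ gain r)))
    where
    rearrange : ∀ n t u → n - t + u ≡ n + (u - t)
    rearrange n t u = solve (n ∷ t ∷ u ∷ [])

  ∣shift∣≤1 : ∀ d → ∣ shift d ∣ ℕ.≤ 1
  ∣shift∣≤1 dec  = s≤s z≤n
  ∣shift∣≤1 stay = z≤n
  ∣shift∣≤1 inc  = s≤s z≤n

  ∣effect∣≤ : ∀ {K E} (r : Resp K) → need r ℕ.≤ E → gain r ℕ.≤ E → ∣ effect r ∣ ℕ.≤ E
  ∣effect∣≤ r t≤ u≤ = ℕP.≤-trans (ℕP.≤-reflexive (cong ∣_∣ (ℤP.m-n≡m⊖n (gain r) (need r))))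
    (ℕP.≤-trans (ℤP.∣m⊝n∣≤m⊔n (gain r) (need r)) (ℕP.⊔-lub u≤ t≤))

  Eff-enabled : ∀ d {m} → 1 ℕ.≤ m → ∃ λ m' → Eff d m m' × m ℕ.≤ suc m'
  Eff-enabled dec  {suc m} _ = m , refl , ℕP.≤-refl
  Eff-enabled stay {m} _ = m , refl , ℕP.n≤1+n m
  Eff-enabled inc  {m} _ = suc m , refl , ℕP.m≤n⇒m≤1+n (ℕP.n≤1+n m)

  -- `E` limits what a single step changes or requires of `n`; from column `L` on no bonus can be
  -- collected.
  record Bounded {K} (G : Game K) (E L : ℕ) : Set where
    field
      resp-≤  : ∀ {v mv} → mv ∈ G v → ∀ {r} → r ∈ resps mv → need r ℕ.≤ E × gain r ℕ.≤ E
      bonus-≤ : ∀ {v mv} → mv ∈ G v → ∀ {b} → b ∈ bonus mv → proj₁ b ℕ.≤ E × proj₂ b ℕ.≤ L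

  -- Cycle trees for a slope, and Duplicator's strategy

  module Slopes {K : ℕ} (G : Game K) (E L : ℕ) (bd : Bounded G E L) where
    open Basics G
    open Bounded bd

    -- The width of a simple cycle divides D, and none is steeper than J / D.
    D J A SL : ℕ
    D  = (2 ℕ.* K) !
    J  = D ℕ.* (2 ℕ.* (K ℕ.* E))
    A  = suc J
    SL = K ℕ.* (D ℕ.* E ℕ.+ A)

    instance
      D≢0 : ℕ.NonZero D
      D≢0 = ℕP._!≢0 (2 ℕ.* K)

    h : ℕ → ℤ → ℤ → ℤ
    h j = ht (+ D) (+ j)

    Entry : Set
    Entry = Fin K × ℤ × ℤ

    node : Entry → Fin K
    node = proj₁

    cycle : ℕ → Entry → ℤ → ℤ → ℤ
    cycle j (_ , α₀ , β₀) α β = h j (α - α₀) (β - β₀)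

    -- In DT the play stops when Duplicator closes a cycle on the current path H, or reaches Prev; she wins
    -- if the cycle does not lose height over the line of slope j / D. The fuel f bounds the path length.
    module Tree (j : ℕ) (Prev : Fin K → Set) (Prev? : ∀ v → Dec (Prev v)) where

      DT : ℕ → Entry → List Entry → Set
      Closes : ℕ → Entry → List Entry → Dir → Resp K → Set
      DT zero    _ _ = ⊥
      DT (suc f) (v , α , β) H = ∀ mv → mv ∈ G v → ∃ λ r → r ∈ resps mv × Closes f (v , α , β) H (dir mv) r
      Closes f (v , α , β) H d r =
        let α' = α + shift d ; β' = β + effect r in
        Prev (tgt r) ⊎
        (∃ λ e → e ∈ (v , α , β) ∷ H × (node e ≡ tgt r × 0ℤ ≤ cycle j e α' β')) ⊎
        DT f (tgt r , α' , β') ((v , α , β) ∷ H)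

      DT? : ∀ f e H → Dec (DT f e H)
      Closes? : ∀ f e H d r → Dec (Closes f e H d r)
      DT? zero    _ _ = no λ ()
      DT? (suc f) (v , α , β) H = ∀∈? (λ mv → ∃∈? (Closes? f (v , α , β) H (dir mv)) (resps mv)) (G v)
      Closes? f (v , α , β) H d r =
        Prev? (tgt r) ⊎-dec
        (∃∈? (λ e → (node e FP.≟ tgt r) ×-dec (0ℤ ≤? cycle j e (α + shift d) (β + effect r))) ((v , α , β) ∷ H) ⊎-dec
        DT? f (tgt r , α + shift d , β + effect r) ((v , α , β) ∷ H))

      -- Closing a cycle rewinds the play to the earlier visit of the control state. Hence the
      -- invariant is kept for every suffix of the path, each with the fuel that was left at that
      -- time.
      Chain : (ℕ → Entry → List Entry → Set) → ℕ → List Entry → Set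
      Chain P f []      = ⊤
      Chain P f (e ∷ H) = P f e H × Chain P (suc f) H

      chain-at : ∀ {P} f H {e} → e ∈ H → Chain P f H →
        ∃ λ f' → ∃ λ H' → Chain P f' (e ∷ H') ×
          (Unique (map node H) → Unique (map node (e ∷ H'))) × f' ℕ.+ suc (length H') ≡ f ℕ.+ length H
      chain-at f (e ∷ H) (here refl) c = f , H , c , (λ u → u) , refl
      chain-at f (e ∷ H) (there e∈) (_ , c) with chain-at (suc f) H e∈ c
      ... | f' , H' , c' , u' , eq = f' , H' , c' , (λ { (_ AP.∷ u) → u' u }) ,
              trans eq (sym (ℕP.+-suc f (length H)))

    DW : ℕ → Fin K → Set
    DW? : ∀ j v → Dec (DW j v)
    DW zero    v = Tree.DT zero (λ _ → ⊥) (λ _ → no λ ()) K (v , 0ℤ , 0ℤ) []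
    DW (suc j) v = Tree.DT (suc j) (DW j) (DW? j) K (v , 0ℤ , 0ℤ) []
    DW? zero    v = Tree.DT? zero (λ _ → ⊥) (λ _ → no λ ()) K (v , 0ℤ , 0ℤ) []
    DW? (suc j) v = Tree.DT? (suc j) (DW j) (DW? j) K (v , 0ℤ , 0ℤ) []

    +D>0 : Positive (+ D)
    +D>0 = positive (+<+ (ℕ.>-nonZero⁻¹ D))

    cancel-D : ∀ {x y} → + D * x ≤ + D * y → x ≤ y
    cancel-D {x} {y} = ℤP.*-cancelˡ-≤-pos x y (+ D) {{+D>0}}

    stepSize : ℤ
    stepSize = + (D ℕ.* E ℕ.+ A)

    ∣α∣⇒≤ : ∀ {α B} → ∣ α ∣ ℕ.≤ B → α ≤ + B × - α ≤ + B
    ∣α∣⇒≤ {α} le = ℤP.≤-trans (i≤+∣i∣ α) (+≤+ le) , ℤP.≤-trans (-i≤+∣i∣ α) (+≤+ le)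

    -- One step changes the height by at most `stepSize`. Allowing any `b ≤ D` and `a ≤ A` lets one
    -- estimate serve all lines, including the vertical direction with `b = 0`.
    step-ht-≤ : ∀ {b a} → b ℕ.≤ D → a ℕ.≤ A → ∀ {x y k} → ∣ x ∣ ℕ.≤ k → ∣ y ∣ ℕ.≤ k ℕ.* E →
      ht (+ b) (+ a) x y ≤ + k * stepSize
    step-ht-≤ {b} {a} b≤ a≤ {x} {y} {k} x≤ y≤ = subst (ht (+ b) (+ a) x y ≤_) eq
      (ht-≤ (+ b) (+ a) {x} {y} {+ k} {+ (k ℕ.* E)} {+ D} {+ A} 0≤+ 0≤+ 0≤+ 0≤+ (+≤+ b≤) (+≤+ a≤)
        (proj₁ (∣α∣⇒≤ y≤)) (proj₂ (∣α∣⇒≤ x≤)))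
      where
      rearrange : ∀ d k e a → d * (k * e) + a * k ≡ k * (d * e + a)
      rearrange d k e a = solve (d ∷ k ∷ e ∷ a ∷ [])
      eq : + D * + (k ℕ.* E) + + A * + k ≡ + k * stepSize
      eq = trans (cong (λ z → + D * z + + A * + k) (ℤP.pos-* k E))
          (trans (rearrange (+ D) (+ k) (+ E) (+ A))
                 (cong (+ k *_) (trans (cong (_+ + A) (sym (ℤP.pos-* D E))) (sym (ℤP.pos-+ (D ℕ.* E) A)))))

    step-ht-≥ : ∀ {b a} → b ℕ.≤ D → a ℕ.≤ A → ∀ {x y k} → ∣ x ∣ ℕ.≤ k → ∣ y ∣ ℕ.≤ k ℕ.* E →
      - (+ k * stepSize) ≤ ht (+ b) (+ a) x y
    step-ht-≥ {b} {a} b≤ a≤ {x} {y} {k} x≤ y≤ =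
      linear-≤ (slack (step-ht-≤ b≤ a≤ {(- x)} {(- y)} {k} (subst (ℕ._≤ k) (sym (ℤP.∣-i∣≡∣i∣ x)) x≤)
                                                     (subst (ℕ._≤ k ℕ.* E) (sym (ℤP.∣-i∣≡∣i∣ y)) y≤)))
               (rearrange (+ b) (+ a) x y (+ k * stepSize))
      where
      rearrange : ∀ b a x y s → b * y - a * x - (- s) ≡ s - (b * - y - a * - x)
      rearrange b a x y s = solve (b ∷ a ∷ x ∷ y ∷ s ∷ [])

    single : ∀ i → ∣ i ∣ ℕ.≤ E → ∣ i ∣ ℕ.≤ 1 ℕ.* E
    single i = subst (∣ i ∣ ℕ.≤_) (sym (ℕP.*-identityˡ E))

    SL-step : + K * stepSize ≡ + SL
    SL-step = sym (ℤP.pos-* K (D ℕ.* E ℕ.+ A))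

    -- A path that starts at `cD (suc j)` may lose `SL` before it reaches a pair won for the next
    -- flatter line, where `cD j` must remain. The base value leaves `D * E` after such a loss,
    -- enough to pay for any response.
    cD : ℕ → ℕ
    cD zero    = D ℕ.* E ℕ.+ SL
    cD (suc j) = cD j ℕ.+ SL

    cD-≥ : ∀ j → D ℕ.* E ℕ.+ SL ℕ.≤ cD j
    cD-≥ zero    = ℕP.≤-refl
    cD-≥ (suc j) = ℕP.≤-trans (cD-≥ j) (ℕP.m≤m+n _ _)

    E≤n : ∀ j {m n} → + (D ℕ.* E) ≤ h j (+ m) (+ n) → E ℕ.≤ n
    E≤n j {m} {n} p = ℤP.drop‿+≤+ (cancel-D (lemma (+ D) (+ E) (+ j) (+ m) (+ n)
        (subst (_≤ h j (+ m) (+ n)) (ℤP.pos-* D E) p) (0≤* {+ j} {+ m} 0≤+ 0≤+)))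
      where
      lemma : ∀ d e j m n → d * e ≤ d * n - j * m → 0ℤ ≤ j * m → d * e ≤ d * n
      lemma d e j m n p q = linear-≤ (slack p ⊕ q) (solve (d ∷ e ∷ j ∷ m ∷ n ∷ []))

    module DuplicatorClaim (j : ℕ) (j≤J : j ℕ.≤ A) (Prev : Fin K → Set) (Prev? : ∀ v → Dec (Prev v))
      (prev : ∀ {v m n} → Prev v → + cD j - + SL ≤ h j (+ m) (+ n) → S∞ v m n) where
      open Tree j Prev Prev?

      -- The second conjunct is a budget: even `f` further steps of maximal descent keep the total
      -- loss along the path within `SL`.
      Good : ℕ → Entry → List Entry → Set
      Good f (v , α , β) H = DT f (v , α , β) H × + f * stepSize ≤ h j α β + + SL

      private
        arith-point : ∀ c s sl f o p → c ≤ p - o → s + f * s ≤ o + sl → 0ℤ ≤ f * s → c - sl ≤ p - s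
        arith-point c s sl f o p a b q = linear-≤ (slack a ⊕ slack b ⊕ q)
          (solve (c ∷ s ∷ sl ∷ f ∷ o ∷ p ∷ []))
        arith-move : ∀ c sl p s Δ → c - sl ≤ p - s → - s ≤ Δ → c - sl ≤ p + Δ
        arith-move c sl p s Δ a b = linear-≤ (slack a ⊕ slack b) (solve (c ∷ sl ∷ p ∷ s ∷ Δ ∷ []))
        arith-weaken : ∀ c sl p s d → c - sl ≤ p - s → 0ℤ ≤ s → d + sl ≤ c → d ≤ p
        arith-weaken c sl p s d a b q = linear-≤ (slack a ⊕ b ⊕ slack q) (solve (c ∷ sl ∷ p ∷ s ∷ d ∷ []))
        arith-cycle : ∀ c p o Δ o₀ → c ≤ p - o → 0ℤ ≤ o + Δ - o₀ → c ≤ p + Δ - o₀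
        arith-cycle c p o Δ o₀ a b = linear-≤ (slack a ⊕ b) (solve (c ∷ p ∷ o ∷ Δ ∷ o₀ ∷ []))
        arith-push : ∀ f s o sl Δ → s + f * s ≤ o + sl → - s ≤ Δ → f * s ≤ o + Δ + sl
        arith-push f s o sl Δ a b = linear-≤ (slack a ⊕ slack b) (solve (f ∷ s ∷ o ∷ sl ∷ Δ ∷ []))
        arith-push′ : ∀ p o Δ → p - o ≡ p + Δ - (o + Δ)
        arith-push′ p o Δ = solve (p ∷ o ∷ Δ ∷ [])

      -- `h j (+ m) (+ n) - h j α β` is the height at which the recorded path began. Extending the
      -- path preserves it, and closing a cycle that does not descend rewinds to the earlier entry
      -- without lowering it. Hence the actual height never falls below `cD j - SL`.
      run : ∀ k f v α β H m n → Chain Good f ((v , α , β) ∷ H) →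
        + cD j ≤ h j (+ m) (+ n) - h j α β → Win k v m n
      run zero    f v α β H m n chain above = tt
      run (suc k) (suc f) v α β H m n chain@((dt , room) , tail) above mv mv∈ m' eff
        with dt mv mv∈
      ... | r , r∈ , closes = inj₁ (r , r∈ , t≤n , respond closes)
        where
        Δ : ℤ
        Δ = h j (shift (dir mv)) (effect r)
        room' : stepSize + + f * stepSize ≤ h j α β + + SL
        room' = subst (_≤ h j α β + + SL) (ℤP.suc-* (+ f) stepSize) room
        Δ≥ : - stepSize ≤ Δ
        Δ≥ = subst (λ z → - z ≤ Δ) (ℤP.*-identityˡ stepSize)
          (step-ht-≥ ℕP.≤-refl j≤J (∣shift∣≤1 (dir mv))
            (single (effect r) (∣effect∣≤ r (proj₁ (resp-≤ mv∈ r∈)) (proj₂ (resp-≤ mv∈ r∈)))))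
        far : + cD j - + SL ≤ h j (+ m) (+ n) - stepSize
        far = arith-point (+ cD j) stepSize (+ SL) (+ f) (h j α β) (h j (+ m) (+ n)) above room'
                (0≤* {+ f} {stepSize} 0≤+ 0≤+)
        t≤n : need r ℕ.≤ n
        t≤n = ℕP.≤-trans (proj₁ (resp-≤ mv∈ r∈)) (E≤n j (arith-weaken (+ cD j) (+ SL) (h j (+ m) (+ n)) stepSize
                (+ (D ℕ.* E)) far 0≤+ (subst (_≤ + cD j) (ℤP.pos-+ (D ℕ.* E) SL) (+≤+ (cD-≥ j)))))
        point : h j (+ m') (+ after r n) ≡ h j (+ m) (+ n) + Δ
        point = trans (cong₂ (h j) (Eff-shift (dir mv) eff) (after-effect r t≤n))
                      (ht-+ (+ D) (+ j) (+ m) (+ n) (shift (dir mv)) (effect r))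
        respond : Closes f (v , α , β) H (dir mv) r → Win k (tgt r) m' (after r n)
        respond (inj₁ pr) = prev pr (subst (+ cD j - + SL ≤_) (sym point)
          (arith-move (+ cD j) (+ SL) (h j (+ m) (+ n)) stepSize Δ far Δ≥)) k
        respond (inj₂ (inj₁ (e@(_ , α₀ , β₀) , e∈ , refl , 0≤c))) with chain-at (suc f) _ e∈ chain
        ... | f' , H' , chain' , _ , _ = run k f' (tgt r) α₀ β₀ H' m' (after r n) chain'
          (subst (λ z → + cD j ≤ z - h j α₀ β₀) (sym point)
            (arith-cycle (+ cD j) (h j (+ m) (+ n)) (h j α β) Δ (h j α₀ β₀) above
              (subst (0ℤ ≤_) (ht-cycle (+ D) (+ j) α β (shift (dir mv)) (effect r) α₀ β₀) 0≤c)))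
        respond (inj₂ (inj₂ dt')) = run k f (tgt r) (α + shift (dir mv)) (β + effect r) ((v , α , β) ∷ H)
          m' (after r n)
          ((dt' , subst (λ z → + f * stepSize ≤ z + + SL) (sym off)
                    (arith-push (+ f) stepSize (h j α β) (+ SL) Δ room' Δ≥)) , chain)
          (subst₂ (λ p o → + cD j ≤ p - o) (sym point) (sym off)
            (subst (+ cD j ≤_) (arith-push′ (h j (+ m) (+ n)) (h j α β) Δ) above))
          where
          off : h j (α + shift (dir mv)) (β + effect r) ≡ h j α β + Δ
          off = ht-+ (+ D) (+ j) α β (shift (dir mv)) (effect r)

      claim : ∀ {v m n} → DT K (v , 0ℤ , 0ℤ) [] → + cD j ≤ h j (+ m) (+ n) → S∞ v m n
      claim {v} {m} {n} dt above k = run k K v 0ℤ 0ℤ [] m n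
        ((dt , ℤP.≤-reflexive (trans SL-step (trans (sym (ℤP.+-identityˡ _)) (cong (_+ + SL) (sym (zero-ht (+ D) (+ j))))))) , tt)
        (subst (+ cD j ≤_) (trans (sym (ℤP.+-identityʳ _)) (cong (λ z → h j (+ m) (+ n) - z) (sym (zero-ht (+ D) (+ j))))) above)
        where
        zero-ht : ∀ b a → b * 0ℤ - a * 0ℤ ≡ 0ℤ
        zero-ht b a = solve (b ∷ a ∷ [])

    -- Reaching a pair of `DW j` from the line for `suc j` leaves height `cD (suc j) - SL`, which is
    -- `cD j`. The flatter line lies no higher, so the induction hypothesis takes over.
    duplicator-wins : ∀ j → j ℕ.≤ J → ∀ {v m n} → DW j v → + cD j ≤ h j (+ m) (+ n) → S∞ v m n
    duplicator-wins zero    j≤J = DuplicatorClaim.claim zero z≤n (λ _ → ⊥) (λ _ → no λ ()) λ ()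
    duplicator-wins (suc j) j≤J =
      DuplicatorClaim.claim (suc j) (ℕP.m≤n⇒m≤1+n j≤J) (DW j) (DW? j) λ {v} {m} {n} dw above →
        duplicator-wins j (ℕP.<⇒≤ j≤J) dw (lower (+ D) (+ j) (+ m) (+ n) (+ cD j) (+ SL)
          (subst (λ z → z - + SL ≤ h (suc j) (+ m) (+ n)) (ℤP.pos-+ (cD j) SL) above) 0≤+)
      where
      lower : ∀ d j m n c s → c + s - s ≤ d * n - (1ℤ + j) * m → 0ℤ ≤ m → c ≤ d * n - j * m
      lower d j m n c s p q = linear-≤ (slack p ⊕ q) (solve (d ∷ j ∷ m ∷ n ∷ c ∷ s ∷ []))

  -- Spoiler's strategy: forcing the play below a line

  module SpoilerSide {K : ℕ} (G : Game K) (E L : ℕ) (bd : Bounded G E L) where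
    open Basics G
    open Bounded bd
    open Slopes G E L bd

    -- The offset of a path is at most `SL` high, so the remaining `A * suc L` forces Spoiler's
    -- counter above `L`, where all his moves are enabled and no bonus pays.
    cS : ℕ
    cS = SL ℕ.+ A ℕ.* suc L

    -- Two lines are watched at once. The height over the line `j / D` drops with every closed
    -- cycle, which measures progress. The height over the steeper line in direction `(b , suc a)`
    -- does not rise with a cycle and keeps Spoiler's counter large meanwhile.
    module SpoilerClaim (j : ℕ) (j≤A : j ℕ.≤ A) (Prev : Fin K → Set) (Prev? : ∀ v → Dec (Prev v))
      (b a : ℕ) (b≤D : b ℕ.≤ D) (a<A : suc a ℕ.≤ A)
      (farey : ∀ x y → ∣ x ∣ ℕ.≤ 2 ℕ.* K → ∣ y ∣ ℕ.≤ 2 ℕ.* (K ℕ.* E) →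
               h j x y < 0ℤ → ht (+ b) (+ suc a) x y ≤ 0ℤ)
      (prev : ∀ {v m n} → ¬ Prev v → h j (+ m) (+ n) ≤ - (+ cS) → ¬ S∞ v m n) where
      open Tree j Prev Prev?

      g : ℤ → ℤ → ℤ
      g = ht (+ b) (+ suc a)

      Bad : ℕ → Entry → List Entry → Set
      Bad f (v , α , β) H = ¬ DT f (v , α , β) H × (∣ α ∣ ℕ.+ f ℕ.≤ K × ∣ β ∣ ℕ.+ f ℕ.* E ℕ.≤ K ℕ.* E)

      off-≤ : ∀ {b a} → b ℕ.≤ D → a ℕ.≤ A → ∀ {f v α β H} → Bad f (v , α , β) H → ht (+ b) (+ a) α β ≤ + SL
      off-≤ {b} {a} b≤ a≤ {f} {α = α} {β} (_ , α≤ , β≤) = subst (ht (+ b) (+ a) α β ≤_) SL-step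
        (step-ht-≤ b≤ a≤ {α} {β} {K} (ℕP.m+n≤o⇒m≤o _ α≤) (ℕP.m+n≤o⇒m≤o _ β≤))

      private
        arith-far : ∀ b a n m c sl AL o aL → b * n - a * m - o ≤ - c → o ≤ sl → sl + AL ≤ c → aL ≤ AL →
          0ℤ ≤ b * n → aL ≤ a * m
        arith-far b a n m c sl AL o aL p q r s t = linear-≤ (slack p ⊕ slack q ⊕ slack r ⊕ slack s ⊕ t)
          (solve (b ∷ a ∷ n ∷ m ∷ c ∷ sl ∷ AL ∷ o ∷ aL ∷ []))
        arith-cycle : ∀ c p o Δ o₀ → p - o ≤ c → o + Δ - o₀ ≤ 0ℤ → p + Δ - o₀ ≤ c
        arith-cycle c p o Δ o₀ a b = linear-≤ (slack a ⊕ slack b) (solve (c ∷ p ∷ o ∷ Δ ∷ o₀ ∷ []))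
        arith-cycle-< : ∀ N c p o Δ o₀ → p - o ≤ (1ℤ + N) - c → 1ℤ + (o + Δ - o₀) ≤ 0ℤ → p + Δ - o₀ ≤ N - c
        arith-cycle-< N c p o Δ o₀ a b = linear-≤ (slack a ⊕ slack b) (solve (N ∷ c ∷ p ∷ o ∷ Δ ∷ o₀ ∷ []))
        arith-exit : ∀ c sl p o Δ o₀ → p - o ≤ 0ℤ - (c + sl) → o + Δ - o₀ ≤ 0ℤ → o₀ ≤ sl → p + Δ ≤ - c
        arith-exit c sl p o Δ o₀ a b q = linear-≤ (slack a ⊕ slack b ⊕ slack q) (solve (c ∷ sl ∷ p ∷ o ∷ Δ ∷ o₀ ∷ []))
        arith-push : ∀ p o Δ → p - o ≡ p + Δ - (o + Δ)
        arith-push p o Δ = solve (p ∷ o ∷ Δ ∷ [])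

      L<m : ∀ {f v α β H m n} → Bad f (v , α , β) H → g (+ m) (+ n) - g α β ≤ - (+ cS) → suc L ℕ.≤ m
      L<m {α = α} {β} {m = m} {n} bad below = ℤP.drop‿+≤+ (ℤP.*-cancelˡ-≤-pos (+ suc L) (+ m) (+ suc a)
        (arith-far (+ b) (+ suc a) (+ n) (+ m) (+ cS) (+ SL) (+ (A ℕ.* suc L)) (g α β) (+ suc a * + suc L)
          below (off-≤ b≤D a<A bad) (ℤP.≤-reflexive (sym (ℤP.pos-+ SL (A ℕ.* suc L))))
          (subst (_≤ + (A ℕ.* suc L)) (ℤP.pos-* (suc a) (suc L)) (+≤+ (ℕP.*-monoˡ-≤ (suc L) a<A)))
          (0≤* {+ b} {+ n} 0≤+ 0≤+)))

      -- The measure is lexicographic: `N` falls when a cycle closes, the fuel when the path grows.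
      -- If a cycle closes with `N` exhausted, the play is `cS` below the line `j / D` at a pair
      -- outside `Prev`, where `prev` refutes the assumed win.
      run : ∀ N f v α β H m n → Chain Bad f ((v , α , β) ∷ H) → Unique (map node ((v , α , β) ∷ H)) →
        f ℕ.+ suc (length H) ≡ suc K → g (+ m) (+ n) - g α β ≤ - (+ cS) →
        h j (+ m) (+ n) - h j α β ≤ + N - (+ cS + + SL) → ¬ S∞ v m n
      -- The path would consist of `K + 1` distinct control states; so a cycle always closes before
      -- the fuel runs out.
      run N zero v α β H m n chain uniq len below deep s =
        ℕP.1+n≰n (ℕP.≤-trans (ℕP.≤-reflexive (sym (trans (cong suc (length-map node H)) len))) (Unique-length uniq))
      run N (suc f) v α β H m n chain@(bad@(¬dt , α≤ , β≤) , _) uniq len below deep s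
        with ¬∀∈⇒∃∈¬ (λ mv → ∃∈? (Closes? f (v , α , β) H (dir mv)) (resps mv)) (G v) ¬dt
      ... | mv , mv∈ , ¬closes with Eff-enabled (dir mv) (ℕP.≤-trans (s≤s z≤n) (L<m bad below))
      ... | m' , eff , m≤ = S∞-step s mv mv∈ m' eff refute
        where
        refute : ¬ Answer S∞ n mv m'
        refute (inj₂ (_ , b∈ , _ , m'<)) =
          ℕP.<⇒≱ m'< (ℕP.≤-trans (proj₂ (bonus-≤ mv∈ b∈)) (ℕP.≤-pred (ℕP.≤-trans (L<m bad below) m≤)))
        refute (inj₁ (r , r∈ , t≤n , s')) = continue (any? (λ e → node e FP.≟ tgt r) ((v , α , β) ∷ H))
          where
          d α' β' : ℤ
          d = shift (dir mv)
          α' = α + d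
          β' = β + effect r
          α'≤ : ∣ α' ∣ ℕ.+ f ℕ.≤ K
          α'≤ = ℕP.≤-trans (ℕP.+-monoˡ-≤ f (ℕP.≤-trans (ℤP.∣i+j∣≤∣i∣+∣j∣ α d) (ℕP.+-monoʳ-≤ ∣ α ∣ (∣shift∣≤1 (dir mv)))))
                  (ℕP.≤-trans (ℕP.≤-reflexive (ℕP.+-assoc ∣ α ∣ 1 f)) α≤)
          β'≤ : ∣ β' ∣ ℕ.+ f ℕ.* E ℕ.≤ K ℕ.* E
          β'≤ = ℕP.≤-trans (ℕP.+-monoˡ-≤ (f ℕ.* E) (ℕP.≤-trans (ℤP.∣i+j∣≤∣i∣+∣j∣ β (effect r))
                    (ℕP.+-monoʳ-≤ ∣ β ∣ (∣effect∣≤ r (proj₁ (resp-≤ mv∈ r∈)) (proj₂ (resp-≤ mv∈ r∈))))))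
                  (ℕP.≤-trans (ℕP.≤-reflexive (ℕP.+-assoc ∣ β ∣ E (f ℕ.* E))) β≤)
          moved : ∀ b a → ht b a (+ m') (+ after r n) ≡ ht b a (+ m) (+ n) + ht b a d (effect r)
          moved b a = trans (cong₂ (ht b a) (Eff-shift (dir mv) eff) (after-effect r t≤n)) (ht-+ b a (+ m) (+ n) d (effect r))
          pushed : ∀ b a → ht b a (+ m) (+ n) - ht b a α β ≡ ht b a (+ m') (+ after r n) - ht b a α' β'
          pushed b a = trans (arith-push (ht b a (+ m) (+ n)) (ht b a α β) (ht b a d (effect r)))
            (sym (cong₂ _-_ (moved b a) (ht-+ b a α β d (effect r))))
          double : ∀ {x y z} → x ℕ.≤ z → y ℕ.≤ z → x ℕ.+ y ℕ.≤ 2 ℕ.* z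
          double {z = z} p q = ℕP.≤-trans (ℕP.+-mono-≤ p q) (ℕP.≤-reflexive (cong (z ℕ.+_) (sym (ℕP.+-identityʳ z))))
          continue : Dec (Any (λ e → node e ≡ tgt r) ((v , α , β) ∷ H)) → ⊥
          continue (no ∉) = run N f (tgt r) α' β' ((v , α , β) ∷ H) m' (after r n)
            (((λ dt → ¬closes (r , r∈ , inj₂ (inj₂ dt))) , α'≤ , β'≤) , chain)
            (AllP.map⁺ (All.map (λ ≢ eq → ≢ (sym eq)) (AllP.¬Any⇒All¬ _ ∉)) AP.∷ uniq)
            (trans (ℕP.+-suc f _) len)
            (subst (_≤ - (+ cS)) (pushed (+ b) (+ suc a)) below)
            (subst (_≤ + N - (+ cS + + SL)) (pushed (+ D) (+ j)) deep) s'
          continue (yes p) with find p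
          ... | e@(_ , α₀ , β₀) , e∈ , refl with chain-at (suc f) ((v , α , β) ∷ H) e∈ chain
          ... | f' , H' , chain'@(bad'@(_ , α₀≤ , β₀≤) , _) , u' , len' = finish N deep
            where
            h<0 : h j (α' - α₀) (β' - β₀) < 0ℤ
            h<0 = ℤP.≰⇒> λ 0≤ → ¬closes (r , r∈ , inj₂ (inj₁ (e , e∈ , refl , 0≤)))
            g≤0 : g (α' - α₀) (β' - β₀) ≤ 0ℤ
            g≤0 = farey (α' - α₀) (β' - β₀)
              (ℕP.≤-trans (ℤP.∣i-j∣≤∣i∣+∣j∣ α' α₀) (double (ℕP.m+n≤o⇒m≤o ∣ α' ∣ α'≤) (ℕP.m+n≤o⇒m≤o ∣ α₀ ∣ α₀≤)))
              (ℕP.≤-trans (ℤP.∣i-j∣≤∣i∣+∣j∣ β' β₀) (double (ℕP.m+n≤o⇒m≤o ∣ β' ∣ β'≤) (ℕP.m+n≤o⇒m≤o ∣ β₀ ∣ β₀≤)))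
              h<0
            cyc : ∀ b a → ht b a (α' - α₀) (β' - β₀) ≡ ht b a α β + ht b a d (effect r) - ht b a α₀ β₀
            cyc b a = ht-cycle b a α β d (effect r) α₀ β₀
            finish : ∀ N → h j (+ m) (+ n) - h j α β ≤ + N - (+ cS + + SL) → ⊥
            finish zero deep₀ = prev (λ pr → ¬closes (r , r∈ , inj₁ pr))
              (subst (_≤ - (+ cS)) (sym (moved (+ D) (+ j)))
                (arith-exit (+ cS) (+ SL) (h j (+ m) (+ n)) (h j α β) (h j d (effect r)) (h j α₀ β₀) deep₀
                  (subst (_≤ 0ℤ) (cyc (+ D) (+ j)) (ℤP.<⇒≤ h<0)) (off-≤ ℕP.≤-refl j≤A bad'))) s'
            finish (suc N') deep' = run N' f' (tgt r) α₀ β₀ H' m' (after r n) chain' (u' uniq) (trans len' len)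
              (subst (λ p → p - g α₀ β₀ ≤ - (+ cS)) (sym (moved (+ b) (+ suc a)))
                (arith-cycle (- (+ cS)) (g (+ m) (+ n)) (g α β) (g d (effect r)) (g α₀ β₀) below
                  (subst (_≤ 0ℤ) (cyc (+ b) (+ suc a)) g≤0)))
              (subst (λ p → p - h j α₀ β₀ ≤ + N' - (+ cS + + SL)) (sym (moved (+ D) (+ j)))
                (arith-cycle-< (+ N') (+ cS + + SL) (h j (+ m) (+ n)) (h j α β) (h j d (effect r)) (h j α₀ β₀) deep'
                  (subst (λ z → 1ℤ + z ≤ 0ℤ) (cyc (+ D) (+ j)) (ℤP.i<j⇒suc[i]≤j h<0)))) s'

      claim : ∀ {v m n} → ¬ DT K (v , 0ℤ , 0ℤ) [] → g (+ m) (+ n) ≤ - (+ cS) → ¬ S∞ v m n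
      claim {v} {m} {n} ¬dt below = run ∣ x ∣ K v 0ℤ 0ℤ [] m n ((¬dt , ℕP.≤-refl , ℕP.≤-refl) , tt)
        (All.[] AP.∷ AP.[]) (ℕP.+-comm K 1)
        (subst (_≤ - (+ cS)) (at-0 (+ b) (+ suc a) (g (+ m) (+ n))) below)
        (arith-start (+ D) (+ j) (h j (+ m) (+ n)) (+ cS + + SL) (+ ∣ x ∣) (i≤+∣i∣ x))
        where
        x : ℤ
        x = h j (+ m) (+ n) + (+ cS + + SL)
        at-0 : ∀ b a p → p ≡ p - (b * 0ℤ - a * 0ℤ)
        at-0 b a p = solve (b ∷ a ∷ p ∷ [])
        arith-start : ∀ b a p c N → p + c ≤ N → p - (b * 0ℤ - a * 0ℤ) ≤ N - c
        arith-start b a p c N q = linear-≤ (slack q) (solve (b ∷ a ∷ p ∷ c ∷ N ∷ []))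

    ≤2K⇒∣D : ∀ x → suc x ℕ.≤ 2 ℕ.* K → suc x ∣ D
    ≤2K⇒∣D x le = ∣-trans (m∣m*n (x !)) (m≤n⇒m!∣n! le)

    -- No cycle has slope strictly between j / D and (j + 1) / D, since its width divides D.
    farey : ∀ j x y → ∣ x ∣ ℕ.≤ 2 ℕ.* K → h j x y < 0ℤ → h (suc j) x y ≤ 0ℤ
    farey j (+ x) y _ p = lemma (+ D) (+ j) (+ x) y (ℤP.<⇒≤ p) 0≤+
      where
      lemma : ∀ d j x y → d * y - j * x ≤ 0ℤ → 0ℤ ≤ x → d * y - (1ℤ + j) * x ≤ 0ℤ
      lemma d j x y p q = linear-≤ (slack p ⊕ q) (solve (d ∷ j ∷ x ∷ y ∷ []))
    farey j -[1+ x ] y le p with ≤2K⇒∣D x le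
    ... | divides q D≡ = subst (_≤ 0ℤ) (sym (eq′ (+ suc j)))
          (neg* (ℤP.i<j⇒suc[i]≤j (ℤP.*-cancelˡ-<-nonNeg {+ q * y + + j} {0ℤ} (+ suc x)
            (subst₂ _<_ (eq′ (+ j)) (sym (ℤP.*-zeroʳ (+ suc x))) p))))
      where
      lemma : ∀ q s j y → q * s * y - j * (- s) ≡ s * (q * y + j)
      lemma q s j y = solve (q ∷ s ∷ j ∷ y ∷ [])
      eq′ : ∀ z → + D * y - z * -[1+ x ] ≡ + suc x * (+ q * y + z)
      eq′ z = trans (cong (λ D → D * y - z * -[1+ x ]) (trans (cong +_ D≡) (ℤP.pos-* q (suc x)))) (lemma (+ q) (+ suc x) z y)
      neg* : 1ℤ + (+ q * y + + j) ≤ 0ℤ → + suc x * (+ q * y + + suc j) ≤ 0ℤ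
      neg* le = finish (+ suc x) (+ q * y) (+ j) le 0≤+
        where
        finish : ∀ s z j → 1ℤ + (z + j) ≤ 0ℤ → 0ℤ ≤ s → s * (z + (1ℤ + j)) ≤ 0ℤ
        finish s z j p q = linear-≤ (0≤* q (slack p)) (solve (s ∷ z ∷ j ∷ []))

    -- A cycle of negative width would have to lose more than `2 * (K * E)` in `n` to lie below the
    -- line `J / D`. So the width is not negative, and the vertical direction can serve as the next
    -- steeper line.
    farey-top : ∀ x y → ∣ y ∣ ℕ.≤ 2 ℕ.* (K ℕ.* E) → h J x y < 0ℤ → ht 0ℤ 1ℤ x y ≤ 0ℤ
    farey-top (+ x) y _ _ = subst (_≤ 0ℤ) (lemma y (+ x)) (ℤP.neg-≤-pos {x} {0})
      where
      lemma : ∀ y x → - x ≡ 0ℤ * y - 1ℤ * x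
      lemma y x = solve (y ∷ x ∷ [])
    farey-top -[1+ x ] y le p = ⊥-elim (ℤP.<⇒≱ p
        (lemma (+ D) (+ (2 ℕ.* (K ℕ.* E))) (+ x) y (+ J) (ℤP.pos-* D _) 0≤+ (proj₂ (∣α∣⇒≤ le)) 0≤+ 0≤+))
      where
      lemma : ∀ d M x y J → J ≡ d * M → 0ℤ ≤ d → - y ≤ M → 0ℤ ≤ J → 0ℤ ≤ x → 0ℤ ≤ d * y - J * (- (1ℤ + x))
      lemma d M x y J refl 0≤d y≤ 0≤J 0≤x = linear-≤ (0≤* 0≤d (slack y≤) ⊕ 0≤* 0≤J 0≤x)
        (solve (d ∷ M ∷ x ∷ y ∷ []))

    cS>0 : 0ℤ < + cS
    cS>0 = +<+ (ℕP.≤-trans (s≤s z≤n) (ℕP.m≤n+m (A ℕ.* suc L) SL))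

    -- The exit of the claim for `suc j` is far below the line `suc j / D` at a pair outside `DW j`,
    -- which is what `spoiler-wins-next j` refutes. For `j = 0` there is no such exit, as heights
    -- over a horizontal line are not negative.
    spoiler-wins-next : ∀ j → j ℕ.≤ J → ∀ {v m n} → ¬ DW j v → h (suc j) (+ m) (+ n) ≤ - (+ cS) → ¬ S∞ v m n
    spoiler-wins-below : ∀ j → j ℕ.≤ J → ∀ b a → b ℕ.≤ D → suc a ℕ.≤ A →
      (∀ x y → ∣ x ∣ ℕ.≤ 2 ℕ.* K → ∣ y ∣ ℕ.≤ 2 ℕ.* (K ℕ.* E) → h j x y < 0ℤ → ht (+ b) (+ suc a) x y ≤ 0ℤ) →
      ∀ {v m n} → ¬ DW j v → ht (+ b) (+ suc a) (+ m) (+ n) ≤ - (+ cS) → ¬ S∞ v m n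
    spoiler-wins-below zero j≤J b a b≤D a<A far =
      SpoilerClaim.claim zero z≤n (λ _ → ⊥) (λ _ → no λ ()) b a b≤D a<A far
        λ {v} {m} {n} _ neg → ⊥-elim (ℤP.<⇒≱ cS>0 (lemma (+ D) (+ m) (+ n) (+ cS) neg (0≤* {+ D} {+ n} 0≤+ 0≤+)))
      where
      lemma : ∀ d m n c → d * n - 0ℤ * m ≤ - c → 0ℤ ≤ d * n → c ≤ 0ℤ
      lemma d m n c p q = linear-≤ (slack p ⊕ q) (solve (d ∷ m ∷ n ∷ c ∷ []))
    spoiler-wins-below (suc j) j≤J b a b≤D a<A far =
      SpoilerClaim.claim (suc j) (ℕP.m≤n⇒m≤1+n j≤J) (DW j) (DW? j) b a b≤D a<A far (spoiler-wins-next j (ℕP.<⇒≤ j≤J))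
    spoiler-wins-next j j≤J = spoiler-wins-below j j≤J D j ℕP.≤-refl (s≤s j≤J) λ x y x≤ _ → farey j x y x≤

    spoiler-wins-right : ∀ {v m n} → ¬ DW J v → cS ℕ.≤ m → ¬ S∞ v m n
    spoiler-wins-right {v} {m} {n} ¬dw le = spoiler-wins-below J ℕP.≤-refl 0 0 z≤n (s≤s z≤n) (λ x y _ → farey-top x y) ¬dw
        (lemma (+ m) (+ n) (+ cS) (+≤+ le))
      where
      lemma : ∀ m n c → c ≤ m → 0ℤ * n - 1ℤ * m ≤ - c
      lemma m n c p = linear-≤ (slack p) (solve (m ∷ n ∷ c ∷ []))

  -- Belts around the lines

  module Belts {K : ℕ} (G : Game K) (E L : ℕ) (bd : Bounded G E L) where
    open Basics G
    open Bounded bd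
    open Slopes G E L bd
    open SpoilerSide G E L bd

    c : ℕ
    c = cD J ℕ.+ cS

    cD-mono : ∀ {i j} → i ℕ.≤′ j → cD i ℕ.≤ cD j
    cD-mono ℕ.≤′-refl     = ℕP.≤-refl
    cD-mono (ℕ.≤′-step p) = ℕP.≤-trans (cD-mono p) (ℕP.m≤m+n _ _)

    Above Below : Fin K → ℕ → Set
    Above v j = ∀ {m n} → + c ≤ h j (+ m) (+ n) → S∞ v m n
    Below v j = ∀ {m n} → h j (+ m) (+ n) ≤ - (+ c) → ¬ S∞ v m n

    Right : Fin K → Set
    Right v = ∀ {m n} → c ℕ.≤ m → ¬ S∞ v m n

    above : ∀ {v j} → j ℕ.≤ J → DW j v → Above v j
    above {j = j} j≤J dw p = duplicator-wins j j≤J dw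
      (ℤP.≤-trans (+≤+ (ℕP.≤-trans (cD-mono (ℕP.≤⇒≤′ j≤J)) (ℕP.m≤m+n _ _))) p)

    cS≤c : cS ℕ.≤ c
    cS≤c = ℕP.m≤n+m cS (cD J)

    below : ∀ {v j} → j ℕ.≤ J → ¬ DW j v → Below v (suc j)
    below {j = j} j≤J ¬dw p = spoiler-wins-next j j≤J ¬dw (ℤP.≤-trans p (ℤP.neg-mono-≤ (+≤+ cS≤c)))

    c>0 : 0ℤ < + c
    c>0 = ℤP.<-≤-trans cS>0 (+≤+ cS≤c)

    below-0 : ∀ {v} → Below v 0
    below-0 {m = m} {n} p = ⊥-elim (ℤP.<⇒≱ c>0 (lemma (+ D) (+ m) (+ n) (+ c) p (0≤* {+ D} {+ n} 0≤+ 0≤+)))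
      where
      lemma : ∀ d m n c → d * n - 0ℤ * m ≤ - c → 0ℤ ≤ d * n → c ≤ 0ℤ
      lemma d m n c p q = linear-≤ (slack p ⊕ q) (solve (d ∷ m ∷ n ∷ c ∷ []))

    Class : Fin K → Set
    Class v = (∃ λ j → j ℕ.≤ J × Above v j × Below v j) ⊎ Right v

    -- The search stops at the first `j` with `DW j v`. The failure at `j - 1` supplies `Below v j`,
    -- and for `j = 0` nothing lies below the line.
    classify-up-to : ∀ v i → i ℕ.≤ J → (∃ λ j → j ℕ.≤ J × Above v j × Below v j) ⊎ ¬ DW i v
    classify-up-to v zero i≤J with DW? zero v
    ... | yes dw = inj₁ (0 , z≤n , (λ {m} {n} → above z≤n dw {m} {n}) , λ {m} {n} → below-0 {v} {m} {n})
    ... | no ¬dw = inj₂ ¬dw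
    classify-up-to v (suc i) i<J with classify-up-to v i (ℕP.<⇒≤ i<J)
    ... | inj₁ found = inj₁ found
    ... | inj₂ ¬dw with DW? (suc i) v
    ... | yes dw = inj₁ (suc i , i<J , (λ {m} {n} → above i<J dw {m} {n}) , λ {m} {n} → below (ℕP.<⇒≤ i<J) ¬dw {m} {n})
    ... | no ¬dw' = inj₂ ¬dw'

    classify : ∀ v → Class v
    classify v with classify-up-to v J ℕP.≤-refl
    ... | inj₁ found = inj₁ found
    ... | inj₂ ¬dw = inj₂ λ le → spoiler-wins-right ¬dw (ℕP.≤-trans cS≤c le)

    abstract
      slope : Fin K → Maybe ℕ
      slope v with classify v
      ... | inj₁ (j , _) = just j
      ... | inj₂ _       = nothing

      slope≤J : ∀ {v j} → slope v ≡ just j → j ℕ.≤ J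
      slope≤J {v} eq with classify v
      slope≤J refl | inj₁ (_ , j≤J , _) = j≤J

      slope-above : ∀ {v j} → slope v ≡ just j → Above v j
      slope-above {v} eq with classify v
      slope-above refl | inj₁ (_ , _ , ab , _) = ab

      slope-below : ∀ {v j} → slope v ≡ just j → Below v j
      slope-below {v} eq with classify v
      slope-below refl | inj₁ (_ , _ , _ , be) = be

      slope-right : ∀ {v} → slope v ≡ nothing → Right v
      slope-right {v} eq with classify v
      ... | inj₂ ri = ri

    -- `D * E + A` is one step of play; the additional `D` is one unit of `n`, by which the least
    -- winning value of a column may overshoot the belt.
    σ : ℕ
    σ = D ℕ.+ (D ℕ.* E ℕ.+ A)

    stepSize≤σ : stepSize ≤ + σ
    stepSize≤σ = +≤+ (ℕP.m≤n+m (D ℕ.* E ℕ.+ A) D)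

    -- From column m₀ on, the belts of different slopes are disjoint, even when widened by one step.
    m₀ : ℕ
    m₀ = suc (c ℕ.+ c ℕ.+ σ ℕ.+ D ℕ.* E ℕ.+ L)

    c+c+σ≤ : ∀ {m} → m₀ ℕ.≤ suc m → + c + + c + + σ ≤ + m
    c+c+σ≤ {m} le = +≤+ (ℕP.≤-trans (ℕP.m≤m+n _ (D ℕ.* E)) (ℕP.≤-trans (ℕP.m≤m+n _ L) (ℕP.≤-pred le)))

    c≤m : ∀ {m} → m₀ ℕ.≤ suc m → c ℕ.≤ m
    c≤m le = ℕP.≤-trans (ℕP.≤-trans (ℕP.m≤m+n c c) (ℕP.m≤m+n _ σ)) (ℤP.drop‿+≤+ (c+c+σ≤ le))

    L≤m : ∀ {m} → m₀ ℕ.≤ suc m → L ℕ.≤ m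
    L≤m le = ℕP.≤-trans (ℕP.m≤n+m L _) (ℕP.≤-pred le)

    -- In column `m` two different lines are at least `m` apart in scaled height, and `m` is at
    -- least `c + c + σ`. The premise `m₀ ≤ suc m` admits the column just left of `m₀`, which a
    -- `dec` may reach.
    steeper : ∀ {j j' v m n} → slope v ≡ just j' → j ℕ.< j' → m₀ ℕ.≤ suc m → h j (+ m) (+ n) ≤ + c + + σ → ¬ S∞ v m n
    steeper {j} {j'} {v} {m} {n} sl j<j' le p = slope-below sl
        (lemma (+ D) (+ j) (+ j') (+ m) (+ n) (+ c) (+ σ) p (c+c+σ≤ le) (+≤+ j<j') 0≤+)
      where
      lemma : ∀ d j j' m n c s → d * n - j * m ≤ c + s → c + c + s ≤ m → 1ℤ + j ≤ j' → 0ℤ ≤ m → d * n - j' * m ≤ - c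
      lemma d j j' m n c s p q r t = linear-≤ (slack p ⊕ slack q ⊕ 0≤* (slack r) t)
        (solve (d ∷ j ∷ j' ∷ m ∷ n ∷ c ∷ s ∷ []))

    flatter : ∀ {j j' v m n} → slope v ≡ just j' → j' ℕ.< j → m₀ ℕ.≤ suc m → - (+ c) - + σ ≤ h j (+ m) (+ n) → S∞ v m n
    flatter {j} {j'} {v} {m} {n} sl j'<j le p = slope-above sl
        (lemma (+ D) (+ j) (+ j') (+ m) (+ n) (+ c) (+ σ) p (c+c+σ≤ le) (+≤+ j'<j) 0≤+)
      where
      lemma : ∀ d j j' m n c s → - c - s ≤ d * n - j * m → c + c + s ≤ m → 1ℤ + j' ≤ j → 0ℤ ≤ m → c ≤ d * n - j' * m
      lemma d j j' m n c s p q r t = linear-≤ (slack p ⊕ slack q ⊕ 0≤* (slack r) t)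
        (solve (d ∷ j ∷ j' ∷ m ∷ n ∷ c ∷ s ∷ []))

    -- A belt of positive slope has risen above `n = E` by then, so every response is affordable in
    -- it. Slope zero is excluded because its belt touches `n = 0`.
    steep⇒E≤n : ∀ {j m n} → m₀ ℕ.≤ suc m → - (+ c) ≤ h (suc j) (+ m) (+ n) → E ℕ.≤ n
    steep⇒E≤n {j} {m} {n} le p = ℤP.drop‿+≤+ (cancel-D (lemma (+ D) (+ E) (+ j) (+ m) (+ n) (+ c) (+ (c ℕ.+ σ)) p
         (subst (λ z → + c + + (c ℕ.+ σ) + z ≤ + m) (ℤP.pos-* D E) bound) 0≤+ (0≤* {+ j} {+ m} 0≤+ 0≤+)))
      where
      bound : + (c ℕ.+ (c ℕ.+ σ) ℕ.+ D ℕ.* E) ≤ + m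
      bound = +≤+ (ℕP.≤-trans (ℕP.≤-reflexive (cong (ℕ._+ D ℕ.* E) (sym (ℕP.+-assoc c c σ))))
                (ℕP.≤-trans (ℕP.m≤m+n _ L) (ℕP.≤-pred le)))
      lemma : ∀ d e j m n c x → - c ≤ d * n - (1ℤ + j) * m → c + x + d * e ≤ m → 0ℤ ≤ x → 0ℤ ≤ j * m → d * e ≤ d * n
      lemma d e j m n c x p q r s = linear-≤ (slack p ⊕ slack q ⊕ r ⊕ s) (solve (d ∷ e ∷ j ∷ m ∷ n ∷ c ∷ x ∷ []))

    module _ {v : Fin K} {mv : Move K} (mv∈ : mv ∈ G v) {r : Resp K} (r∈ : r ∈ resps mv) where

      e≤E : ∣ effect r ∣ ℕ.≤ 1 ℕ.* E
      e≤E = single (effect r) (∣effect∣≤ r (proj₁ (resp-≤ mv∈ r∈)) (proj₂ (resp-≤ mv∈ r∈)))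

      step-≤ : ∀ {j} → j ℕ.≤ J → h j (shift (dir mv)) (effect r) ≤ stepSize
      step-≤ {j} j≤J = subst (h j (shift (dir mv)) (effect r) ≤_) (ℤP.*-identityˡ stepSize)
        (step-ht-≤ ℕP.≤-refl (ℕP.m≤n⇒m≤1+n j≤J) (∣shift∣≤1 (dir mv)) e≤E)

      step-≥ : ∀ {j} → j ℕ.≤ J → - stepSize ≤ h j (shift (dir mv)) (effect r)
      step-≥ {j} j≤J = subst (λ z → - z ≤ h j (shift (dir mv)) (effect r)) (ℤP.*-identityˡ stepSize)
        (step-ht-≥ ℕP.≤-refl (ℕP.m≤n⇒m≤1+n j≤J) (∣shift∣≤1 (dir mv)) e≤E)

      step-h : ∀ j {m m' n} → Eff (dir mv) m m' → need r ℕ.≤ n →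
        h j (+ m') (+ after r n) ≡ h j (+ m) (+ n) + h j (shift (dir mv)) (effect r)
      step-h j {m} {m'} {n} eff t≤n = trans (cong₂ (h j) (Eff-shift (dir mv) eff) (after-effect r t≤n))
        (ht-+ (+ D) (+ j) (+ m) (+ n) (shift (dir mv)) (effect r))

    -- Repeating columns and periodicity

    Pattern : ℕ → ℕ → Set
    Pattern a₁ a₂ = ∀ {v j n₁ n₂} → slope v ≡ just j → h j (+ a₁) (+ n₁) ≡ h j (+ a₂) (+ n₂) → S∞ v a₁ n₁ → S∞ v a₂ n₂

    Eff-both : ∀ d x {a₁ a₂ m'} → Eff d (suc x ℕ.+ a₂) m' →
      ∃ λ x' → m' ≡ x' ℕ.+ a₂ × Eff d (suc x ℕ.+ a₁) (x' ℕ.+ a₁)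
    Eff-both dec  x refl = x , refl , refl
    Eff-both stay x refl = suc x , refl , refl
    Eff-both inc  x refl = suc (suc x) , refl , refl

    -- Inside a belt the game only depends on the height, so agreement of two columns
    -- propagates to everything on their right.
    pattern-extends : ∀ {a₁ a₂} → m₀ ℕ.≤ a₁ → m₀ ℕ.≤ a₂ → Pattern a₁ a₂ →
      ∀ k x {v j n₁ n₂} → slope v ≡ just j → h j (+ (x ℕ.+ a₁)) (+ n₁) ≡ h j (+ (x ℕ.+ a₂)) (+ n₂) →
      S∞ v (x ℕ.+ a₁) n₁ → Win k v (x ℕ.+ a₂) n₂
    pattern-extends le₁ le₂ pat zero    x sl eq s = tt
    pattern-extends le₁ le₂ pat (suc k) zero sl eq s = pat sl eq s (suc k)
    pattern-extends {a₁} {a₂} le₁ le₂ pat (suc k) (suc x) {v} {j} {n₁} {n₂} sl eq s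
      with + c ≤? h j (+ (suc x ℕ.+ a₂)) (+ n₂)
    ... | yes hi = slope-above sl hi (suc k)
    ... | no ¬hi = answer
      where
      m₂ : ℕ
      m₂ = suc x ℕ.+ a₂
      answer : Win (suc k) v m₂ n₂
      answer mv mv∈ m' eff with Eff-both (dir mv) x {a₁} eff
      ... | x' , refl , eff₁ = decidable-stable (Answer? k n₂ mv (x' ℕ.+ a₂)) λ ¬a →
          S∞-step s mv mv∈ (x' ℕ.+ a₁) eff₁ λ ans → ¬a (transfer ans)
        where
        in₁ : m₀ ℕ.≤ suc (x' ℕ.+ a₁)
        in₁ = ℕP.m≤n⇒m≤1+n (ℕP.≤-trans le₁ (ℕP.m≤n+m a₁ x'))
        in₂ : m₀ ℕ.≤ suc (x' ℕ.+ a₂)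
        in₂ = ℕP.m≤n⇒m≤1+n (ℕP.≤-trans le₂ (ℕP.m≤n+m a₂ x'))
        lo : - (+ c) ≤ h j (+ (suc x ℕ.+ a₂)) (+ n₂)
        lo = ℤP.≮⇒≥ λ lt → slope-below sl (subst (_≤ - (+ c)) (sym eq) (ℤP.<⇒≤ lt)) s
        hi : h j (+ (suc x ℕ.+ a₂)) (+ n₂) ≤ + c
        hi = ℤP.<⇒≤ (ℤP.≰⇒> ¬hi)
        n₁≡n₂ : h 0 (+ (suc x ℕ.+ a₁)) (+ n₁) ≡ h 0 (+ (suc x ℕ.+ a₂)) (+ n₂) → n₁ ≡ n₂
        n₁≡n₂ e = ℤP.+-injective (ℤP.≤-antisym (cancel-D (ℤP.≤-reflexive e')) (cancel-D (ℤP.≤-reflexive (sym e'))))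
          where
          drop : ∀ d m n → d * n - 0ℤ * m ≡ d * n
          drop d m n = solve (d ∷ m ∷ n ∷ [])
          e' : + D * + n₁ ≡ + D * + n₂
          e' = trans (sym (drop (+ D) (+ (suc x ℕ.+ a₁)) (+ n₁))) (trans e (drop (+ D) (+ (suc x ℕ.+ a₂)) (+ n₂)))
        -- For slope zero equal heights mean equal `n`; for a positive slope any `n` in the belt is
        -- at least `E`.
        affordable : ∀ j {t} → h j (+ (suc x ℕ.+ a₁)) (+ n₁) ≡ h j (+ (suc x ℕ.+ a₂)) (+ n₂) →
          - (+ c) ≤ h j (+ (suc x ℕ.+ a₂)) (+ n₂) → t ℕ.≤ E → t ℕ.≤ n₁ → t ℕ.≤ n₂
        affordable zero    e _  _   t≤n₁ = subst (_ ℕ.≤_) (n₁≡n₂ e) t≤n₁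
        affordable (suc j) _ lo t≤E _    = ℕP.≤-trans t≤E
          (steep⇒E≤n {j} (ℕP.m≤n⇒m≤1+n (ℕP.≤-trans le₂ (ℕP.m≤n+m a₂ (suc x)))) lo)
        transfer : Answer S∞ n₁ mv (x' ℕ.+ a₁) → Answer (Win k) n₂ mv (x' ℕ.+ a₂)
        transfer (inj₂ (_ , b∈ , _ , m<)) =
          contradiction (ℕP.≤-trans (proj₂ (bonus-≤ mv∈ b∈)) (L≤m in₁)) (ℕP.<⇒≱ m<)
        transfer (inj₁ (r , r∈ , t≤n₁ , s')) = inj₁ (r , r∈ , t≤n₂ , go (slope (tgt r)) refl)
          where
          t≤n₂ : need r ℕ.≤ n₂
          t≤n₂ = affordable j eq lo (proj₁ (resp-≤ mv∈ r∈)) t≤n₁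
          Δ : ℤ
          Δ = h j (shift (dir mv)) (effect r)
          p₁ : h j (+ (x' ℕ.+ a₁)) (+ after r n₁) ≡ h j (+ (suc x ℕ.+ a₂)) (+ n₂) + Δ
          p₁ = trans (step-h mv∈ r∈ j eff₁ t≤n₁) (cong (_+ Δ) eq)
          p₂ : h j (+ (x' ℕ.+ a₂)) (+ after r n₂) ≡ h j (+ (suc x ℕ.+ a₂)) (+ n₂) + Δ
          p₂ = step-h mv∈ r∈ j eff t≤n₂
          -- A steeper target would already be lost and a flatter one is won outright, so only a
          -- target of the same slope needs the induction.
          go : ∀ sl' → slope (tgt r) ≡ sl' → Win k (tgt r) (x' ℕ.+ a₂) (after r n₂)
          go nothing sl' = contradiction s' (slope-right sl' (c≤m in₁))
          go (just j') sl' with ℕP.<-cmp j j'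
          ... | tri< j<j' _ _ = contradiction s' (steeper sl' j<j' in₁
                  (subst (_≤ + c + + σ) (sym p₁) (ℤP.+-mono-≤ hi (ℤP.≤-trans (step-≤ mv∈ r∈ (slope≤J sl)) stepSize≤σ))))
          ... | tri≈ _ refl _ = pattern-extends le₁ le₂ pat k x' sl' (trans p₁ (sym p₂)) s'
          ... | tri> _ _ j'<j = flatter sl' j'<j in₂
                  (subst (- (+ c) - + σ ≤_) (sym p₂) (ℤP.+-mono-≤ lo (ℤP.≤-trans (ℤP.neg-mono-≤ stepSize≤σ) (step-≥ mv∈ r∈ (slope≤J sl))))) k

    -- Columns are sampled at multiples of `D`, where every line passes through an integer point, so
    -- that the belt of a pair contains at most `W` values of `n`. Thus `K * W` bits describe a
    -- column, and among `T + 1` columns two agree. Their distance is not known, but it divides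
    -- `T !`.
    W T A₀ Per : ℕ
    W   = suc (c ℕ.+ c)
    T   = 2 ^ (K ℕ.* W)
    A₀  = D ℕ.* (m₀ ℕ.+ T)
    Per = D ℕ.* T !

    column : ℕ → ℕ
    column i = D ℕ.* (m₀ ℕ.+ i)

    m₀≤column : ∀ i → m₀ ℕ.≤ column i
    m₀≤column i = ℕP.≤-trans (ℕP.m≤m+n m₀ i) (ℕP.m≤n*m (m₀ ℕ.+ i) D)

    -- The bit `(v , o)` refers to the point at signed distance `o - c` from the line; adding `c`
    -- avoids subtraction on natural numbers.
    FrontierAt : ℕ → Fin K × Fin W → Set
    FrontierAt i (v , o) =
      ∃ λ j → slope v ≡ just j × (∃ λ n → n ℕ.+ c ≡ j ℕ.* (m₀ ℕ.+ i) ℕ.+ toℕ o × S∞ v (column i) n)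

    OnFrontier : ℕ → Fin (K ℕ.* W) → Set
    OnFrontier i b = FrontierAt i (remQuot W b)

    near : ∀ z → - (+ c) ≤ + D * z → + D * z ≤ + c → - (+ c) ≤ z × z ≤ + c
    near z lo hi = low z lo , high z hi
      where
      pos : ∀ x → + c < x → ¬ + D * x ≤ + c
      pos x c<x le = ℤP.<⇒≱ c<x (ℤP.≤-trans (lemma (+ D) x (+≤+ (ℕ.>-nonZero⁻¹ D)) (ℤP.≤-trans 0≤+ (ℤP.<⇒≤ c<x))) le)
        where
        lemma : ∀ d x → 1ℤ ≤ d → 0ℤ ≤ x → x ≤ d * x
        lemma d x p q = linear-≤ (0≤* (slack p) q) (solve (d ∷ x ∷ []))
      high : ∀ z → + D * z ≤ + c → z ≤ + c
      high z le = ℤP.≮⇒≥ λ lt → pos z lt le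
      low : ∀ z → - (+ c) ≤ + D * z → - (+ c) ≤ z
      low z le = subst (- (+ c) ≤_) (ℤP.neg-involutive z) (ℤP.neg-mono-≤ (high (- z)
        (subst₂ _≤_ (ℤP.neg-distribʳ-* (+ D) z) (ℤP.neg-involutive (+ c)) (ℤP.neg-mono-≤ le))))

    h-column : ∀ j i n → h j (+ column i) (+ n) ≡ + D * (+ n - + (j ℕ.* (m₀ ℕ.+ i)))
    h-column j i n = trans (cong (λ z → + D * + n - + j * z) (ℤP.pos-* D (m₀ ℕ.+ i)))
      (trans (lemma (+ D) (+ j) (+ n) (+ (m₀ ℕ.+ i))) (cong (λ z → + D * (+ n - z)) (sym (ℤP.pos-* j (m₀ ℕ.+ i)))))
      where
      lemma : ∀ d j n t → d * n - j * (d * t) ≡ d * (n - j * t)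
      lemma d j n t = solve (d ∷ j ∷ n ∷ t ∷ [])

    -- A point above the belt is won by the slope alone. Any other won point lies inside the belt,
    -- so its status is one of the recorded bits.
    rows⇒Pattern : ∀ i i' → (∀ b → OnFrontier i b → OnFrontier i' b) → Pattern (column i) (column i')
    rows⇒Pattern i i' rows {v} {j} {n₁} {n₂} sl eq s with + c ≤? h j (+ column i') (+ n₂)
    ... | yes hi = slope-above sl hi
    ... | no ¬hi = read-off (rows (combine v o) mark)
      where
      t₁ t₂ : ℕ
      t₁ = j ℕ.* (m₀ ℕ.+ i)
      t₂ = j ℕ.* (m₀ ℕ.+ i')
      z : ℤ
      z = + n₁ - + t₁
      close : - (+ c) ≤ z × z ≤ + c
      close = near z
        (subst (- (+ c) ≤_) (h-column j i n₁) (ℤP.≮⇒≥ λ lt → slope-below sl (ℤP.<⇒≤ lt) s))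
        (subst (_≤ + c) (trans (sym eq) (h-column j i n₁)) (ℤP.<⇒≤ (ℤP.≰⇒> ¬hi)))
      z≡ : z ≡ + n₂ - + t₂
      z≡ = ℤP.≤-antisym (cancel-D (ℤP.≤-reflexive e)) (cancel-D (ℤP.≤-reflexive (sym e)))
        where
        e : + D * z ≡ + D * (+ n₂ - + t₂)
        e = trans (sym (h-column j i n₁)) (trans eq (h-column j i' n₂))
      0≤z+c : 0ℤ ≤ z + + c
      0≤z+c = subst (_≤ z + + c) (ℤP.+-inverseˡ (+ c)) (ℤP.+-monoˡ-≤ (+ c) (proj₁ close))
      +o : + ∣ z + + c ∣ ≡ z + + c
      +o = ℤP.0≤i⇒+∣i∣≡i 0≤z+c
      o<W : ∣ z + + c ∣ ℕ.< W
      o<W = s≤s (ℤP.drop‿+≤+ (subst (_≤ + c + + c) (sym +o) (ℤP.+-monoˡ-≤ (+ c) (proj₂ close))))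
      o : Fin W
      o = fromℕ< o<W
      position : ∀ {n t} → z ≡ + n - + t → n ℕ.+ c ≡ t ℕ.+ toℕ o
      position {n} {t} ez = ℤP.+-injective (trans (ℤP.pos-+ n c) (trans (lemma (+ n) (+ t) (+ c))
        (sym (trans (cong (λ x → + (t ℕ.+ x)) (FP.toℕ-fromℕ< o<W)) (trans (ℤP.pos-+ t ∣ z + + c ∣) (cong (λ z → + t + z) (trans +o (cong (_+ + c) ez))))))))
        where
        lemma : ∀ n t c → n + c ≡ t + (n - t + c)
        lemma n t c = solve (n ∷ t ∷ c ∷ [])
      mark : OnFrontier i (combine v o)
      mark = subst (FrontierAt i) (sym (FP.remQuot-combine v o)) (j , sl , n₁ , position refl , s)
      unique : ∀ {j' n} → slope v ≡ just j' → n ℕ.+ c ≡ j' ℕ.* (m₀ ℕ.+ i') ℕ.+ toℕ o → n ≡ n₂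
      unique {j'} {n} sl' at = ℕP.+-cancelʳ-≡ c n n₂ (trans at
        (trans (cong (λ j → j ℕ.* (m₀ ℕ.+ i') ℕ.+ toℕ o) (MaybeP.just-injective (trans (sym sl') sl))) (sym (position z≡))))
      read-off : OnFrontier i' (combine v o) → S∞ v (column i') n₂
      read-off row = let (_ , sl' , _ , at , s') = subst (FrontierAt i') (FP.remQuot-combine v o) row in
        subst (S∞ v (column i')) (unique sl' at) s'

    Periodic : ℕ → ℕ → ℕ → Set
    Periodic a w q = ∀ {v j} → slope v ≡ just j → ∀ {m n} → a ℕ.≤ m →
      (S∞ v m n → S∞ v (m ℕ.+ D ℕ.* (q ℕ.* w)) (n ℕ.+ j ℕ.* (q ℕ.* w))) ×
      (S∞ v (m ℕ.+ D ℕ.* (q ℕ.* w)) (n ℕ.+ j ℕ.* (q ℕ.* w)) → S∞ v m n)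

    one-period : ∀ i w → Pattern (column i) (column (i ℕ.+ w)) → Pattern (column (i ℕ.+ w)) (column i) →
      Periodic (column i) w 1
    one-period i w forth back {v} {j} sl {m} {n} le =
        (λ s k → subst (λ z → Win k v z (n ℕ.+ j ℕ.* (1 ℕ.* w))) x+a₂
          (pattern-extends (m₀≤column i) (m₀≤column (i ℕ.+ w)) forth k x sl height (subst (λ z → S∞ v z n) (sym x+a₁) s))) ,
        (λ s k → subst (λ z → Win k v z n) x+a₁
          (pattern-extends (m₀≤column (i ℕ.+ w)) (m₀≤column i) back k x sl (sym height)
            (subst (λ z → S∞ v z (n ℕ.+ j ℕ.* (1 ℕ.* w))) (sym x+a₂) s)))
      where
      x : ℕ
      x = m ℕ.∸ column i
      x+a₁ : x ℕ.+ column i ≡ m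
      x+a₁ = ℕP.m∸n+n≡m le
      x+a₂ : x ℕ.+ column (i ℕ.+ w) ≡ m ℕ.+ D ℕ.* (1 ℕ.* w)
      x+a₂ = trans (cong (x ℕ.+_) (trans (cong (D ℕ.*_) (sym (ℕP.+-assoc m₀ i w))) (ℕP.*-distribˡ-+ D (m₀ ℕ.+ i) w)))
        (trans (sym (ℕP.+-assoc x (column i) (D ℕ.* w))) (cong₂ ℕ._+_ x+a₁ (cong (D ℕ.*_) (sym (ℕP.*-identityˡ w)))))
      height : h j (+ (x ℕ.+ column i)) (+ n) ≡ h j (+ (x ℕ.+ column (i ℕ.+ w))) (+ (n ℕ.+ j ℕ.* (1 ℕ.* w)))
      height = trans (cong (λ z → h j (+ z) (+ n)) x+a₁)
        (trans (lemma (+ D) (+ j) (+ m) (+ n) (+ (1 ℕ.* w)))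
          (cong₂ (h j) (trans (cong (λ z → + m + z) (sym (ℤP.pos-* D _))) (trans (sym (ℤP.pos-+ m _)) (cong +_ (sym x+a₂))))
                       (trans (cong (λ z → + n + z) (sym (ℤP.pos-* j _))) (sym (ℤP.pos-+ n _)))))
        where
        lemma : ∀ d j m n w → d * n - j * m ≡ d * (n + j * w) - j * (m + d * w)
        lemma d j m n w = solve (d ∷ j ∷ m ∷ n ∷ w ∷ [])

    many-periods : ∀ {a w} → Periodic a w 1 → ∀ q → Periodic a w q
    many-periods {a} {w} per zero {v} {j} sl {m} {n} le =
        subst₂ (S∞ v) (sym (eq D m)) (sym (eq j n)) , subst₂ (S∞ v) (eq D m) (eq j n)
      where
      eq : ∀ d x → x ℕ.+ d ℕ.* 0 ≡ x
      eq d x = trans (cong (x ℕ.+_) (ℕP.*-zeroʳ d)) (ℕP.+-identityʳ x)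
    many-periods {a} {w} per (suc q) {v} {j} sl {m} {n} le =
        (λ s → subst₂ (S∞ v) (eq D m) (eq j n) (proj₁ next (proj₁ now s))) ,
        (λ s → proj₂ now (proj₂ next (subst₂ (S∞ v) (sym (eq D m)) (sym (eq j n)) s)))
      where
      now = many-periods per q sl {m} {n} le
      next = per sl {m ℕ.+ D ℕ.* (q ℕ.* w)} {n ℕ.+ j ℕ.* (q ℕ.* w)} (ℕP.≤-trans le (ℕP.m≤m+n m _))
      eq : ∀ d x → x ℕ.+ d ℕ.* (q ℕ.* w) ℕ.+ d ℕ.* (1 ℕ.* w) ≡ x ℕ.+ d ℕ.* (suc q ℕ.* w)
      eq d x = trans (ℕP.+-assoc x _ _) (cong (x ℕ.+_) (trans (sym (ℕP.*-distribˡ-+ d (q ℕ.* w) (1 ℕ.* w)))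
        (cong (d ℕ.*_) (trans (ℕP.+-comm (q ℕ.* w) (1 ℕ.* w)) (cong (ℕ._+ q ℕ.* w) (ℕP.*-identityˡ w))))))

    -- Which columns agree is not known, but the first one lies at or before `A₀`, and their
    -- distance `w` divides `T !`. Repeating `w` gives one fixed period from one fixed column,
    -- whatever rows were found.
    periodic : ¬ ¬ (Periodic A₀ (T !) 1)
    periodic ¬per = ¬¬-repeated-row (K ℕ.* W) OnFrontier λ (i , i' , i<i' , i'≤ , rows , rows') →
      ¬per (lemma i i' i<i' i'≤ rows rows')
      where
      lemma : ∀ i i' → i ℕ.< i' → i' ℕ.≤ T → (∀ b → OnFrontier i b → OnFrontier i' b) →
        (∀ b → OnFrontier i' b → OnFrontier i b) → Periodic A₀ (T !) 1
      lemma i i' i<i' i'≤ rows rows' {v} {j} sl {m} {n} le = subst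
          (λ z → (S∞ v m n → S∞ v (m ℕ.+ D ℕ.* z) (n ℕ.+ j ℕ.* z)) × (S∞ v (m ℕ.+ D ℕ.* z) (n ℕ.+ j ℕ.* z) → S∞ v m n))
          (trans (sym T!≡) (sym (ℕP.*-identityˡ (T !))))
          (many-periods (one-period i w
            (subst (λ z → Pattern (column i) (column z)) (sym i+w) (rows⇒Pattern i i' rows))
            (subst (λ z → Pattern (column z) (column i)) (sym i+w) (rows⇒Pattern i' i rows'))) q sl
            (ℕP.≤-trans (ℕP.*-monoʳ-≤ D (ℕP.+-monoʳ-≤ m₀ (ℕP.≤-trans (ℕP.<⇒≤ i<i') i'≤))) le))
        where
        w : ℕ
        w = i' ℕ.∸ i
        i+w : i ℕ.+ w ≡ i'
        i+w = ℕP.m+[n∸m]≡n (ℕP.<⇒≤ i<i')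
        ∣! : ∀ w → 0 ℕ.< w → w ℕ.≤ T → w ∣ T !
        ∣! (suc w) _ le = ∣-trans (m∣m*n (w !)) (m≤n⇒m!∣n! le)
        w∣ : w ∣ T !
        w∣ = ∣! w (ℕP.m<n⇒0<n∸m i<i') (ℕP.≤-trans (ℕP.m∸n≤m i' i) i'≤)
        q : ℕ
        q = _∣_.quotient w∣
        T!≡ : T ! ≡ q ℕ.* w
        T!≡ = _∣_.equality w∣

  -- Bounds on the finite frontier values

  module Bounds {K : ℕ} (G : Game K) (E L : ℕ) (bd : Bounded G E L) where
    open Basics G
    open Bounded bd
    open Slopes G E L bd
    open Belts G E L bd

    -- Tables record the columns below Cc, where all finite frontier values turn out to be at most Mx.
    Cc X Θ Mx : ℕ
    Cc = A₀ ℕ.+ Per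
    X  = J ℕ.* c ℕ.+ c ℕ.+ E
    Θ  = X ℕ.+ 2 ^ (K ℕ.* c) ℕ.* E
    Mx = Θ ℕ.+ (J ℕ.* Cc ℕ.+ c)

    -- Since `D ≥ 1` and `j ≤ J`, this point is at least `c` above the line of any slope that
    -- occurs.
    linear-above : ∀ {v j} m → slope v ≡ just j → S∞ v m (J ℕ.* m ℕ.+ c)
    linear-above {v} {j} m sl = slope-above sl
        (lemma (+ D) (+ j) (+ J) (+ m) (+ c) (+ (J ℕ.* m ℕ.+ c)) eq (+≤+ (ℕ.>-nonZero⁻¹ D)) (+≤+ (slope≤J sl)) 0≤+ 0≤+)
      where
      eq : + (J ℕ.* m ℕ.+ c) ≡ + J * + m + + c
      eq = trans (ℤP.pos-+ (J ℕ.* m) c) (cong (_+ + c) (ℤP.pos-* J m))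
      lemma : ∀ d j J m c n → n ≡ J * m + c → 1ℤ ≤ d → j ≤ J → 0ℤ ≤ m → 0ℤ ≤ n → c ≤ d * n - j * m
      lemma d j J m c n refl p q r s = linear-≤ (0≤* (slack p) s ⊕ 0≤* (slack q) r)
        (solve (d ∷ j ∷ J ∷ m ∷ c ∷ []))

    θ : ℕ → ℕ
    θ i = X ℕ.+ i ℕ.* E

    SmallAt : ℕ → Fin K × Fin c → Set
    SmallAt i (v , m) = S∞ v (toℕ m) (θ i)

    Eff-≤suc : ∀ d {m m'} → Eff d m m' → m' ℕ.≤ suc m
    Eff-≤suc dec  refl = ℕP.m≤n⇒m≤1+n (ℕP.n≤1+n _)
    Eff-≤suc stay refl = ℕP.n≤1+n _
    Eff-≤suc inc  refl = ℕP.≤-refl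

    -- If no frontier value in the first c columns lies in (θ i , θ (i + 1)], then no finite one lies
    -- above θ (i + 1): those that do could all be lowered by one.
    module Gap (i : ℕ) (gap : ∀ {v m} → m ℕ.< c → S∞ v m (θ (suc i)) → S∞ v m (θ i)) where

      E≤θ : ∀ {n} → θ (suc i) ℕ.≤ n → E ℕ.≤ n
      E≤θ = ℕP.≤-trans (ℕP.≤-trans (ℕP.m≤n+m E _) (ℕP.m≤m+n X _))

      θ-room : ∀ {n t} → t ℕ.≤ E → θ (suc i) ℕ.≤ n → θ i ℕ.≤ n ℕ.∸ t
      θ-room {n} {t} t≤E le = ℕP.≤-trans (ℕP.≤-reflexive (sym (ℕP.m+n∸n≡m (θ i) t)))
        (ℕP.∸-monoˡ-≤ t (ℕP.≤-trans (ℕP.+-monoʳ-≤ (θ i) t≤E) (ℕP.≤-trans (ℕP.≤-reflexive eq) le)))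
        where
        eq : θ i ℕ.+ E ≡ θ (suc i)
        eq = trans (ℕP.+-assoc X (i ℕ.* E) E) (cong (X ℕ.+_) (ℕP.+-comm (i ℕ.* E) E))

      X≤θ : ∀ {m} → m ℕ.≤ c → J ℕ.* m ℕ.+ c ℕ.≤ θ i
      X≤θ m≤c = ℕP.≤-trans (ℕP.+-monoˡ-≤ c (ℕP.*-monoʳ-≤ J m≤c)) (ℕP.≤-trans (ℕP.m≤m+n _ E) (ℕP.m≤m+n X _))

      lower : ∀ k {v m n} → m ℕ.< c → θ (suc i) ℕ.≤ n → S∞ v m (suc n) → Win k v m n
      lower zero    m<c θ≤n s = tt
      lower (suc k) {v} {m} {n} m<c θ≤n s mv mv∈ m' eff = decidable-stable (Answer? k n mv m') λ ¬a →
        S∞-step s mv mv∈ m' eff λ ans → ¬a (transfer ans)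
        where
        m'≤c : m' ℕ.≤ c
        m'≤c = ℕP.≤-trans (Eff-≤suc (dir mv) eff) m<c
        transfer : Answer S∞ (suc n) mv m' → Answer (Win k) n mv m'
        transfer (inj₂ (b , b∈ , _ , m<)) = inj₂ (b , b∈ , ℕP.≤-trans (proj₁ (bonus-≤ mv∈ b∈)) (E≤θ θ≤n) , m<)
        transfer (inj₁ (r , r∈ , _ , s')) = inj₁ (r , r∈ , t≤n , go)
          where
          t≤E : need r ℕ.≤ E
          t≤E = proj₁ (resp-≤ mv∈ r∈)
          t≤n : need r ℕ.≤ n
          t≤n = ℕP.≤-trans t≤E (E≤θ θ≤n)
          θ≤n' : θ i ℕ.≤ after r n
          θ≤n' = ℕP.≤-trans (θ-room t≤E θ≤n) (ℕP.m≤m+n _ (gain r))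
          s'' : S∞ (tgt r) m' (suc (after r n))
          s'' = subst (S∞ (tgt r) m') (cong (ℕ._+ gain r) (ℕP.+-∸-assoc 1 t≤n)) s'
          go : Win k (tgt r) m' (after r n)
          -- Above the window the value is lowered again. Inside it, `gap` shows that every value
          -- from `θ i` on wins. In column `c` the linear bound decides, which `X` was chosen to
          -- exceed.
          go with m' ℕP.<? c | θ (suc i) ℕP.≤? after r n
          ... | yes m'<c | yes le = lower k m'<c le s''
          ... | yes m'<c | no ¬le = S∞-mono ℕP.≤-refl θ≤n' (gap m'<c (S∞-mono ℕP.≤-refl (ℕP.≰⇒> ¬le) s'')) k
          ... | no ¬m'<c | _ = byslope (slope (tgt r)) refl
            where
            byslope : ∀ sl → slope (tgt r) ≡ sl → Win k (tgt r) m' (after r n)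
            byslope nothing  sl = contradiction s'' (slope-right sl (ℕP.≮⇒≥ ¬m'<c))
            byslope (just j) sl = S∞-mono ℕP.≤-refl (ℕP.≤-trans (X≤θ m'≤c) θ≤n') (linear-above m' sl) k

      lower-by : ∀ x {v m} → m ℕ.< c → S∞ v m (x ℕ.+ θ (suc i)) → S∞ v m (θ (suc i))
      lower-by zero    m<c s = s
      lower-by (suc x) m<c s = lower-by x m<c (λ k → lower k m<c (ℕP.m≤n+m _ x) s)

    -- Each level `θ i` marks which of `K * c` points are won there. Among `2 ^ (K * c) + 1` levels
    -- two have equal marks, and by monotonicity nothing changes in the window directly above the
    -- lower one; this is the gap required.
    small-bound : ¬ ¬ (∀ {v m n} → m ℕ.< c → S∞ v m n → S∞ v m Θ)
    small-bound ¬g = ¬¬-repeated-row (K ℕ.* c) (λ i b → SmallAt i (remQuot c b)) λ (i , i' , i<i' , i'≤ , _ , rows) →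
        ¬g (λ {v} {m} {n} → lemma i i' i<i' i'≤ rows {v} {m} {n})
      where
      lemma : ∀ i i' → i ℕ.< i' → i' ℕ.≤ 2 ^ (K ℕ.* c) →
        (∀ b → SmallAt i' (remQuot c b) → SmallAt i (remQuot c b)) → ∀ {v m n} → m ℕ.< c → S∞ v m n → S∞ v m Θ
      lemma i i' i<i' i'≤ rows {v} {m} {n} m<c s =
          S∞-mono ℕP.≤-refl (ℕP.+-monoʳ-≤ X (ℕP.*-monoˡ-≤ E (ℕP.≤-trans i<i' i'≤)))
            (Gap.lower-by i gap n m<c (S∞-mono ℕP.≤-refl (ℕP.m≤m+n n _) s))
        where
        gap : ∀ {v m} → m ℕ.< c → S∞ v m (θ (suc i)) → S∞ v m (θ i)
        gap {v} {m} m<c s = subst (λ z → S∞ v z (θ i)) (FP.toℕ-fromℕ< m<c)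
          (subst (SmallAt i) (FP.remQuot-combine v b) (rows (combine v b)
            (subst (SmallAt i') (sym (FP.remQuot-combine v b)) (subst (λ z → S∞ v z (θ i')) (sym (FP.toℕ-fromℕ< m<c))
              (S∞-mono ℕP.≤-refl (ℕP.+-monoʳ-≤ X (ℕP.*-monoˡ-≤ E i<i')) s)))))
          where
          b : Fin c
          b = fromℕ< m<c

    bounded : ¬ ¬ (∀ {v m n} → m ℕ.< Cc → S∞ v m n → S∞ v m Mx)
    bounded ¬g = small-bound λ sb → ¬g λ {v} {m} {n} → lemma sb {v} {m} {n}
      where
      lemma : (∀ {v m n} → m ℕ.< c → S∞ v m n → S∞ v m Θ) → ∀ {v m n} → m ℕ.< Cc → S∞ v m n → S∞ v m Mx
      lemma sb {v} {m} {n} m<C s with m ℕP.<? c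
      ... | yes m<c = S∞-mono ℕP.≤-refl (ℕP.m≤m+n Θ _) (sb m<c s)
      ... | no ¬m<c = byslope (slope v) refl
        where
        byslope : ∀ sl → slope v ≡ sl → S∞ v m Mx
        byslope nothing  sl = contradiction s (slope-right sl (ℕP.≮⇒≥ ¬m<c))
        byslope (just j) sl = S∞-mono ℕP.≤-refl
          (ℕP.≤-trans (ℕP.+-monoˡ-≤ c (ℕP.*-monoʳ-≤ J (ℕP.<⇒≤ m<C))) (ℕP.m≤n+m _ Θ)) (linear-above m sl)

  -- Periodic tables as candidates for the winning region

  least : ∀ {n} {P : Fin n → Set} → (∀ x → Dec (P x)) →
    (∃ λ x → P x × (∀ y → P y → toℕ x ℕ.≤ toℕ y)) ⊎ (∀ x → ¬ P x)
  least {zero} P? = inj₂ λ ()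
  least {suc n} P? with P? zero | least (λ x → P? (suc x))
  ... | yes p | _ = inj₁ (zero , p , λ _ _ → z≤n)
  ... | no ¬p | inj₁ (x , p , min) = inj₁ (suc x , p , λ { zero q → contradiction q ¬p ; (suc y) q → s≤s (min y q) })
  ... | no ¬p | inj₂ none = inj₂ λ { zero → ¬p ; (suc x) → none x }

  FlatM : Maybe ℕ → Maybe ℕ → Set
  FlatM (just j') (just j) = j' ℕ.≤ j
  FlatM _         _        = ⊥

  FlatM? : ∀ x y → Dec (FlatM x y)
  FlatM? (just j') (just j) = j' ℕ.≤? j
  FlatM? (just _)  nothing  = no λ ()
  FlatM? nothing   _        = no λ ()

  module Tables {K : ℕ} (G : Game K) (E L : ℕ) (bd : Bounded G E L) where
    open Basics G
    open Bounded bd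
    open Slopes G E L bd
    open Belts G E L bd
    open Bounds G E L bd

    Table : Set
    Table = Fin K → ℕ → Maybe ℕ

    -- The region above a table f, continued with period Per beyond column Cc.
    data In (f : Table) (v : Fin K) : ℕ → ℕ → Set where
      start : ∀ {m o n} → m ℕ.< Cc → f v m ≡ just o → o ℕ.≤ n → In f v m n
      next : ∀ {j m n} → slope v ≡ just j → A₀ ℕ.≤ m → In f v m n → In f v (m ℕ.+ Per) (n ℕ.+ j ℕ.* T !)

    In-small : ∀ {f v m n} → In f v m n → m ℕ.< Cc → ∃ λ o → f v m ≡ just o × o ℕ.≤ n
    In-small (start _ eq le) _ = _ , eq , le
    In-small (next {m = m} _ A≤ _) lt = contradiction (ℕP.+-monoˡ-≤ Per A≤) (ℕP.<⇒≱ lt)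

    In-large : ∀ {f v m n} → In f v m n → Cc ℕ.≤ m →
      ∃ λ j → slope v ≡ just j × (j ℕ.* T ! ℕ.≤ n × In f v (m ℕ.∸ Per) (n ℕ.∸ j ℕ.* T !))
    In-large (start lt _ _) le = contradiction le (ℕP.<⇒≱ lt)
    In-large {f} {v} (next {j} {m} {n} sl _ i) _ = j , sl , ℕP.m≤n+m _ n ,
      subst₂ (In f v) (sym (ℕP.m+n∸n≡m m Per)) (sym (ℕP.m+n∸n≡m n (j ℕ.* T !))) i

    In-up : ∀ {f v m n n'} → In f v m n → n ℕ.≤ n' → In f v m n'
    In-up (start lt eq le) n≤ = start lt eq (ℕP.≤-trans le n≤)
    In-up {f} {v} {n' = n'} (next {j} {m} {n} sl A≤ i) n≤ = subst (In f v (m ℕ.+ Per)) (ℕP.m∸n+n≡m (ℕP.m+n≤o⇒n≤o n n≤))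
      (next sl A≤ (In-up i (ℕP.m+n≤o⇒m≤o∸n n n≤)))

    Per>0 : 0 ℕ.< Per
    Per>0 = ℕP.≤-trans (ℕ.>-nonZero⁻¹ (T !) {{ℕP._!≢0 T}}) (ℕP.m≤n*m (T !) D)

    A₀<Cc : A₀ ℕ.< Cc
    A₀<Cc = ℕP.m<m+n A₀ Per>0

    ∸Per : ∀ {m k} → Cc ℕ.≤ m → m ℕ.≤ suc k → m ℕ.∸ Per ℕ.≤ k
    ∸Per {m} {k} Cc≤m m≤ = ℕP.≤-pred (ℕP.≤-trans (ℕP.≤-trans (ℕP.≤-reflexive (ℕP.+-comm 1 (m ℕ.∸ Per)))
      (ℕP.+-monoʳ-≤ (m ℕ.∸ Per) Per>0)) (ℕP.≤-trans (ℕP.≤-reflexive (ℕP.m∸n+n≡m (ℕP.≤-trans (ℕP.m≤n+m Per A₀) Cc≤m))) m≤))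

    A₀≤∸Per : ∀ {m} → Cc ℕ.≤ m → A₀ ℕ.≤ m ℕ.∸ Per
    A₀≤∸Per = ℕP.m+n≤o⇒m≤o∸n A₀

    Per≤ : ∀ {m} → Cc ℕ.≤ m → Per ℕ.≤ m
    Per≤ = ℕP.≤-trans (ℕP.m≤n+m Per A₀)

    In?′ : ∀ f v k m n → m ℕ.≤ k → Dec (In f v m n)
    In?′ f v k m n m≤k with m ℕP.<? Cc
    In?′ f v k m n m≤k | yes lt = small (f v m) refl
      where
      small : ∀ x → f v m ≡ x → Dec (In f v m n)
      small nothing  eq = no λ i → contradiction (trans (sym eq) (proj₁ (proj₂ (In-small i lt)))) λ ()
      small (just o) eq with o ℕ.≤? n
      ... | yes le = yes (start lt eq le)
      ... | no ¬le = no λ i → let (_ , eq' , le) = In-small i lt in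
              ¬le (subst (ℕ._≤ n) (MaybeP.just-injective (trans (sym eq') eq)) le)
    In?′ f v zero m n m≤k | no ¬lt = contradiction (ℕP.≤-<-trans m≤k (ℕP.≤-<-trans z≤n A₀<Cc)) ¬lt
    In?′ f v (suc k) m n m≤k | no ¬lt = large (slope v) refl
      where
      Cc≤m : Cc ℕ.≤ m
      Cc≤m = ℕP.≮⇒≥ ¬lt
      large : ∀ x → slope v ≡ x → Dec (In f v m n)
      large nothing  sl = no λ i → contradiction (trans (sym sl) (proj₁ (proj₂ (In-large i Cc≤m)))) λ ()
      large (just j) sl = map′
        (λ (le , i) → subst₂ (In f v) (ℕP.m∸n+n≡m (Per≤ Cc≤m)) (ℕP.m∸n+n≡m le) (next sl (A₀≤∸Per Cc≤m) i))
        (λ i → let (j' , sl' , rest) = In-large i Cc≤m in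
          subst (λ j → j ℕ.* T ! ℕ.≤ n × In f v (m ℕ.∸ Per) (n ℕ.∸ j ℕ.* T !)) (MaybeP.just-injective (trans (sym sl') sl)) rest)
        ((j ℕ.* T ! ℕ.≤? n) ×-dec In?′ f v k (m ℕ.∸ Per) (n ℕ.∸ j ℕ.* T !) (∸Per Cc≤m m≤k))

    In? : ∀ f v m n → Dec (In f v m n)
    In? f v m n = In?′ f v m m n ℕP.≤-refl

    -- Beyond A₀ the responses must not lead to steeper belts; only then can they be translated by a period.
    Ans : Table → Fin K → ℕ → ℕ → Move K → ℕ → Set
    Ans f v m n mv m' =
      (∃ λ r → r ∈ resps mv × (need r ℕ.≤ n × (In f (tgt r) m' (after r n) × (A₀ ℕ.< m → FlatM (slope (tgt r)) (slope v))))) ⊎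
      (∃ λ b → b ∈ bonus mv × (proj₁ b ℕ.≤ n × m' ℕ.< proj₂ b))

    Ans? : ∀ f v m n mv m' → Dec (Ans f v m n mv m')
    Ans? f v m n mv m' =
      ∃∈? (λ r → (need r ℕ.≤? n) ×-dec (In? f (tgt r) m' (after r n) ×-dec
        ((A₀ ℕP.<? m) →-dec FlatM? (slope (tgt r)) (slope v)))) (resps mv) ⊎-dec
      ∃∈? (λ b → (proj₁ b ℕ.≤? n) ×-dec (m' ℕP.<? proj₂ b)) (bonus mv)

    Ans-up : ∀ {f v m n n' mv m'} → n ℕ.≤ n' → Ans f v m n mv m' → Ans f v m n' mv m'
    Ans-up n≤ (inj₁ (r , r∈ , t≤n , i , fl)) = inj₁ (r , r∈ , ℕP.≤-trans t≤n n≤ ,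
      In-up i (ℕP.+-monoˡ-≤ (gain r) (ℕP.∸-monoˡ-≤ (need r) n≤)) , fl)
    Ans-up n≤ (inj₂ (b , b∈ , t≤n , m<)) = inj₂ (b , b∈ , ℕP.≤-trans t≤n n≤ , m<)

    CheckAt : Table → Fin K → ℕ → Maybe ℕ → Set
    CheckAt f v m nothing  = ⊤
    CheckAt f v m (just o) = ∀ mv → mv ∈ G v → ∀ m' → Eff (dir mv) m m' → Ans f v m o mv m'

    CheckAt? : ∀ f v m x → Dec (CheckAt f v m x)
    CheckAt? f v m nothing  = yes tt
    CheckAt? f v m (just o) = ∀∈? (λ mv → ∀Eff? (Ans? f v m o mv) (dir mv) m) (G v)

    lifted : Maybe ℕ → Maybe ℕ → Maybe ℕ
    lifted (just o) (just j) = just (o ℕ.+ j ℕ.* T !)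
    lifted _        _        = nothing

    -- Finitely many columns suffice. A column `m + Per` with `A₀ < m` inherits the answers of
    -- column `m` by translation. Column `Cc` is checked separately, since a `dec` from its
    -- translate `A₀` leaves the periodic part.
    Check : Table → Set
    Check f = (∀ v (i : Fin Cc) → CheckAt f v (toℕ i) (f v (toℕ i))) × (∀ v → CheckAt f v Cc (lifted (f v A₀) (slope v)))

    Check? : ∀ f → Dec (Check f)
    Check? f = FP.all? (λ v → FP.all? λ i → CheckAt? f v (toℕ i) (f v (toℕ i))) ×-dec
               FP.all? (λ v → CheckAt? f v Cc (lifted (f v A₀) (slope v)))

    m₀≤A₀ : m₀ ℕ.≤ A₀
    m₀≤A₀ = m₀≤column T

    Eff-∸ : ∀ d {a m p m'} → a ℕ.< m → Eff d (m ℕ.+ p) m' → ∃ λ m₁ → m' ≡ m₁ ℕ.+ p × Eff d m m₁ × a ℕ.≤ m₁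
    Eff-∸ dec  {m = suc m} (s≤s a≤) refl = m , refl , refl , a≤
    Eff-∸ stay {m = m} a< refl = m , refl , refl , ℕP.<⇒≤ a<
    Eff-∸ inc  {m = m} a< refl = suc m , refl , refl , ℕP.m≤n⇒m≤1+n (ℕP.<⇒≤ a<)

    FlatM-just : ∀ {x y j} → y ≡ just j → FlatM x y → ∃ λ j' → x ≡ just j' × j' ℕ.≤ j
    FlatM-just {just j'} refl le = j' , refl , le

    module Sound {f : Table} (check : Check f) where

      atCc : ∀ {v o j} → f v A₀ ≡ just o → slope v ≡ just j → CheckAt f v Cc (just (o ℕ.+ j ℕ.* T !))
      atCc {v} e sl = subst (CheckAt f v Cc) (cong₂ lifted e sl) (proj₂ check v)

      atSmall : ∀ {v m o} → m ℕ.< Cc → f v m ≡ just o → CheckAt f v m (just o)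
      atSmall {v} {m} lt eq = subst (CheckAt f v m) eq
        (subst (λ z → CheckAt f v z (f v z)) (FP.toℕ-fromℕ< lt) (proj₁ check v (fromℕ< lt)))

      answers : ∀ {v m n} → In f v m n → ∀ mv → mv ∈ G v → ∀ m' → Eff (dir mv) m m' → Ans f v m n mv m'
      answers (start lt eq le) mv mv∈ m' eff = Ans-up {mv = mv} le (atSmall lt eq mv mv∈ m' eff)
      answers {v} (next {j} {m} {n} sl A≤m i) mv mv∈ m' eff with ℕP.m≤n⇒m<n∨m≡n A≤m
      ... | inj₂ refl = let (_ , eq , le) = In-small i A₀<Cc in
            Ans-up {mv = mv} (ℕP.+-monoˡ-≤ (j ℕ.* T !) le) (atCc eq sl mv mv∈ m' eff)
      ... | inj₁ A<m with Eff-∸ (dir mv) A<m eff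
      ... | m₁ , refl , eff₁ , A≤m₁ = translate (answers i mv mv∈ m₁ eff₁)
        where
        translate : Ans f v m n mv m₁ → Ans f v (m ℕ.+ Per) (n ℕ.+ j ℕ.* T !) mv (m₁ ℕ.+ Per)
        translate (inj₂ (_ , b∈ , _ , m<)) = contradiction
          (ℕP.≤-trans (proj₂ (bonus-≤ mv∈ b∈)) (ℕP.≤-trans (L≤m (ℕP.m≤n⇒m≤1+n m₀≤A₀)) A≤m₁)) (ℕP.<⇒≱ m<)
        translate (inj₁ (r , r∈ , t≤n , i' , fl)) with FlatM-just sl (fl A<m)
        ... | j' , sl' , j'≤j = inj₁ (r , r∈ , ℕP.≤-trans t≤n (ℕP.m≤m+n n _) ,
              In-up (next sl' A≤m₁ i') room , λ _ → fl A<m)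
          where
          -- A target that is no steeper is shifted up by at most as much as the source, so the
          -- translated answer still suffices.
          room : after r n ℕ.+ j' ℕ.* T ! ℕ.≤ after r (n ℕ.+ j ℕ.* T !)
          room = ℕP.≤-trans (ℕP.+-monoʳ-≤ (after r n) (ℕP.*-monoˡ-≤ (T !) j'≤j)) (ℕP.≤-reflexive
            (trans (ℕP.+-assoc (n ℕ.∸ need r) (gain r) _) (trans (cong (n ℕ.∸ need r ℕ.+_) (ℕP.+-comm (gain r) _))
              (trans (sym (ℕP.+-assoc (n ℕ.∸ need r) _ (gain r)))
                (cong (ℕ._+ gain r) (sym (ℕP.+-∸-comm (j ℕ.* T !) t≤n)))))))

      In-sim : IsSim (In f)
      In-sim v m n i mv mv∈ m' eff with answers i mv mv∈ m' eff
      ... | inj₁ (r , r∈ , t≤n , i' , _) = inj₁ (r , r∈ , t≤n , i')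
      ... | inj₂ b = inj₂ b

    record Exact (f : Table) : Set where
      field
        frontier : ∀ {v m o} → m ℕ.< Cc → f v m ≡ just o → S∞ v m o
        minimal  : ∀ {v m n} → m ℕ.< Cc → S∞ v m n → ∃ λ o → f v m ≡ just o × o ℕ.≤ n

    module Complete {f : Table} (exact : Exact f) (per : Periodic A₀ (T !) 1) where
      open Exact exact

      period : ∀ {v j m n} → slope v ≡ just j → A₀ ℕ.≤ m →
        (S∞ v m n → S∞ v (m ℕ.+ Per) (n ℕ.+ j ℕ.* T !)) × (S∞ v (m ℕ.+ Per) (n ℕ.+ j ℕ.* T !) → S∞ v m n)
      period {v} {j} {m} {n} sl le = subst
        (λ z → (S∞ v m n → S∞ v (m ℕ.+ D ℕ.* z) (n ℕ.+ j ℕ.* z)) × (S∞ v (m ℕ.+ D ℕ.* z) (n ℕ.+ j ℕ.* z) → S∞ v m n))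
        (ℕP.*-identityˡ (T !)) (per sl le)

      -- A won point is at most `c` below its line in scaled height. For positive slope, `c ≤ m`
      -- makes up for this deficit, so one period can be subtracted from `n`.
      period-≤ : ∀ {v j m n} → slope v ≡ just j → A₀ ℕ.≤ m → S∞ v (m ℕ.+ Per) n → j ℕ.* T ! ℕ.≤ n
      period-≤ {j = zero} _ _ _ = z≤n
      period-≤ {v} {suc j} {m} {n} sl le s = ℤP.drop‿+≤+ (subst (_≤ + n) (sym (ℤP.pos-* (suc j) (T !)))
          (cancel-D (lemma (+ D) (+ j) (+ m) (+ (T !)) (+ c) (+ n)
          (subst (λ z → - (+ c) ≤ + D * + n - + suc j * z) (trans (ℤP.pos-+ m Per) (cong (λ z → + m + z) (ℤP.pos-* D (T !))))
            (ℤP.≮⇒≥ λ lt → slope-below sl (ℤP.<⇒≤ lt) s))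
          (+≤+ (ℕP.≤-trans (c≤m (ℕP.m≤n⇒m≤1+n m₀≤A₀)) le)) (0≤* {+ j} {+ m} 0≤+ 0≤+))))
        where
        lemma : ∀ d j m t c n → - c ≤ d * n - (1ℤ + j) * (m + d * t) → c ≤ m → 0ℤ ≤ j * m → d * ((1ℤ + j) * t) ≤ d * n
        lemma d j m t c n p q r = linear-≤ (slack p ⊕ slack q ⊕ r) (solve (d ∷ j ∷ m ∷ t ∷ c ∷ n ∷ []))

      S∞⊆In′ : ∀ k {v m n} → m ℕ.≤ k → S∞ v m n → In f v m n
      S∞⊆In′ k {v} {m} {n} m≤k s with m ℕP.<? Cc
      S∞⊆In′ k m≤k s | yes lt = let (_ , eq , le) = minimal lt s in start lt eq le
      S∞⊆In′ zero m≤k s | no ¬lt = contradiction (ℕP.≤-<-trans m≤k (ℕP.≤-<-trans z≤n A₀<Cc)) ¬lt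
      S∞⊆In′ (suc k) {v} {m} {n} m≤k s | no ¬lt = large (slope v) refl
        where
        Cc≤m : Cc ℕ.≤ m
        Cc≤m = ℕP.≮⇒≥ ¬lt
        m≡ : m ℕ.∸ Per ℕ.+ Per ≡ m
        m≡ = ℕP.m∸n+n≡m (Per≤ Cc≤m)
        large : ∀ x → slope v ≡ x → In f v m n
        large nothing  sl = contradiction s (slope-right sl
          (ℕP.≤-trans (c≤m (ℕP.m≤n⇒m≤1+n m₀≤A₀)) (ℕP.≤-trans (ℕP.m≤m+n A₀ Per) Cc≤m)))
        large (just j) sl = subst₂ (In f v) m≡ n≡ (next sl (A₀≤∸Per Cc≤m) (S∞⊆In′ k (∸Per Cc≤m m≤k)
            (proj₂ (period sl (A₀≤∸Per Cc≤m)) (subst₂ (S∞ v) (sym m≡) (sym n≡) s))))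
          where
          n≡ : n ℕ.∸ j ℕ.* T ! ℕ.+ j ℕ.* T ! ≡ n
          n≡ = ℕP.m∸n+n≡m (period-≤ sl (A₀≤∸Per Cc≤m) (subst (λ z → S∞ v z n) (sym m≡) s))

      S∞⊆In : ∀ {v m n} → S∞ v m n → In f v m n
      S∞⊆In = S∞⊆In′ _ ℕP.≤-refl

      -- The height premise keeps the point within one unit of `n` of the belt. From there one step
      -- cannot reach a won point of a steeper slope, which yields the flatness demanded by `Ans`;
      -- decidability of `Ans` removes the double negation.
      answer : ∀ {v m n} → S∞ v m n → (∀ {j} → slope v ≡ just j → h j (+ m) (+ n) ≤ + c + + D) →
        ∀ mv → mv ∈ G v → ∀ m' → Eff (dir mv) m m' → Ans f v m n mv m'
      answer {v} {m} {n} s low mv mv∈ m' eff = decidable-stable (Ans? f v m n mv m') λ ¬a →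
        S∞-step s mv mv∈ m' eff λ ans → ¬a (convert ans)
        where
        convert : Answer S∞ n mv m' → Ans f v m n mv m'
        convert (inj₂ b) = inj₂ b
        convert (inj₁ (r , r∈ , t≤n , s')) = inj₁ (r , r∈ , t≤n , S∞⊆In s' , flat (slope (tgt r)) (slope v) refl refl)
          where
          flat : ∀ x y → slope (tgt r) ≡ x → slope v ≡ y → A₀ ℕ.< m → FlatM x y
          flat x y sl' sl A<m = go x y sl' sl
            where
            in' : m₀ ℕ.≤ suc m'
            in' = ℕP.≤-trans m₀≤A₀ (ℕP.≤-trans (ℕP.<⇒≤ A<m) (back (dir mv) eff))
              where
              back : ∀ d {m m'} → Eff d m m' → m ℕ.≤ suc m'
              back dec  refl = ℕP.≤-refl
              back stay refl = ℕP.n≤1+n _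
              back inc  refl = ℕP.m≤n⇒m≤1+n (ℕP.n≤1+n _)
            go : ∀ x y → slope (tgt r) ≡ x → slope v ≡ y → FlatM x y
            go nothing   _        sl' _  = contradiction s' (slope-right sl' (c≤m in'))
            go (just j') nothing  _   sl = contradiction s (slope-right sl
              (ℕP.≤-trans (c≤m (ℕP.m≤n⇒m≤1+n m₀≤A₀)) (ℕP.<⇒≤ A<m)))
            go (just j') (just j) sl' sl = ℕP.≮⇒≥ λ j<j' → steeper sl' j<j' in'
              (subst (_≤ + c + + σ) (sym (step-h mv∈ r∈ j eff t≤n))
                (subst (h j (+ m) (+ n) + h j (shift (dir mv)) (effect r) ≤_) (ℤP.+-assoc (+ c) (+ D) stepSize)
                  (ℤP.+-mono-≤ (low sl) (step-≤ mv∈ r∈ (slope≤J sl))))) s'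

      -- A least value higher than `c + D` could be lowered by one, which costs `D`, and would still
      -- be at least `c` above the line, hence won.
      frontier-low : ∀ {v m o j} → m ℕ.< Cc → f v m ≡ just o → slope v ≡ just j → h j (+ m) (+ o) ≤ + c + + D
      frontier-low {m = m} {zero} {j} lt eq sl =
        lemma (+ D) (+ j) (+ m) (+ c) 0≤+ 0≤+ (0≤* {+ j} {+ m} 0≤+ 0≤+)
        where
        lemma : ∀ d j m c → 0ℤ ≤ d → 0ℤ ≤ c → 0ℤ ≤ j * m → d * 0ℤ - j * m ≤ c + d
        lemma d j m c p q r = linear-≤ (p ⊕ q ⊕ r) (solve (d ∷ j ∷ m ∷ c ∷ []))
      frontier-low {v} {m} {suc o} {j} lt eq sl = ℤP.≮⇒≥ λ hi →
        let (o' , eq' , le) = minimal lt (slope-above sl (lemma (+ D) (+ j) (+ m) (+ c) (+ o) (ℤP.<⇒≤ hi))) in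
        ℕP.1+n≰n (subst (ℕ._≤ o) (MaybeP.just-injective (trans (sym eq') eq)) le)
        where
        lemma : ∀ d j m c o → c + d ≤ d * (1ℤ + o) - j * m → c ≤ d * o - j * m
        lemma d j m c o p = linear-≤ (slack p) (solve (d ∷ j ∷ m ∷ c ∷ o ∷ []))

      check : Check f
      check = (λ v i → small v (FP.toℕ<n i) (f v (toℕ i)) refl) , λ v → atCc v (f v A₀) (slope v) refl refl
        where
        small : ∀ v {m} → m ℕ.< Cc → ∀ x → f v m ≡ x → CheckAt f v m x
        small v lt nothing  eq = tt
        small v lt (just o) eq = answer (frontier lt eq) (frontier-low lt eq)
        height : ∀ d j m n t → d * n - j * m ≡ d * (n + j * t) - j * (m + d * t)
        height d j m n t = solve (d ∷ j ∷ m ∷ n ∷ t ∷ [])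
        atCc : ∀ v x y → f v A₀ ≡ x → slope v ≡ y → CheckAt f v Cc (lifted x y)
        atCc v nothing  _        eq sl = tt
        atCc v (just o) nothing  eq sl = tt
        atCc v (just o) (just j) eq sl = answer (proj₁ (period sl ℕP.≤-refl) (frontier A₀<Cc eq)) λ {j'} sl' →
          subst (λ j' → h j' (+ Cc) (+ (o ℕ.+ j ℕ.* T !)) ≤ + c + + D) (MaybeP.just-injective (trans (sym sl) sl'))
            (subst (_≤ + c + + D) same (frontier-low A₀<Cc eq sl))
          where
          same : h j (+ A₀) (+ o) ≡ h j (+ Cc) (+ (o ℕ.+ j ℕ.* T !))
          same = trans (height (+ D) (+ j) (+ A₀) (+ o) (+ (T !)))
            (cong₂ (h j) (trans (cong (λ z → + A₀ + z) (sym (ℤP.pos-* D (T !)))) (sym (ℤP.pos-+ A₀ Per)))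
                         (trans (cong (λ z → + o + z) (sym (ℤP.pos-* j (T !)))) (sym (ℤP.pos-+ o _))))

  -- Semilinear representation of the winning region

  record Solution {K : ℕ} (G : Game K) : Set where
    open Basics G
    field
      rep          : Fin K → Semilinear
      rep-sound    : ∀ {v m n} → InSemilinear (rep v) m n → S∞ v m n
      rep-complete : ∀ {v m n} → S∞ v m n → InSemilinear (rep v) m n
      sim          : IsSim S∞
      columns      : ∀ v → (∀ m → ∃ λ n → S∞ v m n) ⊎
                       (∃ λ M → (∀ {m} → m ℕ.< M → ∃ λ n → S∞ v m n) × (∀ {m n} → S∞ v m n → m ℕ.< M))

  ∃-concatMap : ∀ {A B : Set} {P : B → Set} {f : A → List B} {xs x} → x ∈ xs → Any P (f x) → Any P (concatMap f xs)
  ∃-concatMap {f = f} x∈ p = AnyP.concatMap⁺ f (lose x∈ p)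

  concatMap-∃ : ∀ {A B : Set} {P : B → Set} (f : A → List B) xs → Any P (concatMap f xs) → ∃ λ x → x ∈ xs × Any P (f x)
  concatMap-∃ f xs p = find (AnyP.concatMap⁻ f p)

  threshold : ∀ {P : ℕ → Set} → (∀ m → Dec (P m)) → (∀ {m m'} → m ℕ.≤ m' → P m' → P m) → ∀ b → ¬ P b →
    ∃ λ M → M ℕ.≤ b × (∀ {m} → m ℕ.< M → P m) × ¬ P M
  threshold P? down zero ¬p = 0 , z≤n , (λ ()) , ¬p
  threshold P? down (suc b) ¬p with P? b
  ... | yes p = suc b , ℕP.≤-refl , (λ lt → down (ℕP.≤-pred lt) p) , ¬p
  ... | no ¬q = let (M , M≤ , lt , ¬M) = threshold P? down b ¬q in M , ℕP.m≤n⇒m≤1+n M≤ , lt , ¬M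

  module Solve {K : ℕ} (G : Game K) (E L : ℕ) (bd : Bounded G E L) where
    open Basics G
    open Slopes G E L bd
    open Belts G E L bd
    open Bounds G E L bd
    open Tables G E L bd

    N : ℕ
    N = suc (suc Mx) ^ (K ℕ.* Cc)

    value : Fin (suc (suc Mx)) → Maybe ℕ
    value zero    = nothing
    value (suc x) = just (toℕ x)

    entry : Fin N → Fin K → ∀ {m} → Dec (m ℕ.< Cc) → Maybe ℕ
    entry code v (yes lt) = value (finToFun code (combine v (fromℕ< lt)))
    entry code v (no _)   = nothing

    table : Fin N → Table
    table code v m = entry code v (m ℕP.<? Cc)

    module _ (S? : ∀ v (i : Fin Cc) (x : Fin (suc Mx)) → Dec (S∞ v (toℕ i) (toℕ x)))
             (bnd : ∀ {v m n} → m ℕ.< Cc → S∞ v m n → S∞ v m Mx) where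

      Least : Fin K → Fin Cc → Set
      Least v i = (∃ λ (x : Fin (suc Mx)) → S∞ v (toℕ i) (toℕ x) × (∀ (y : Fin (suc Mx)) → S∞ v (toℕ i) (toℕ y) → toℕ x ℕ.≤ toℕ y)) ⊎
                  (∀ (x : Fin (suc Mx)) → ¬ S∞ v (toℕ i) (toℕ x))

      pick : ∀ v i → Least v i → Fin (suc (suc Mx))
      pick v i (inj₁ (x , _)) = suc x
      pick v i (inj₂ _)       = zero

      leastAt : ∀ v i → Least v i
      leastAt v i = least (S? v i)

      cell : Fin K × Fin Cc → Fin (suc (suc Mx))
      cell (v , i) = pick v i (leastAt v i)

      exactCode : Fin N
      exactCode = funToFin λ b → cell (remQuot Cc b)

      table-cell : ∀ {v m} (lt : m ℕ.< Cc) → table exactCode v m ≡ value (cell (v , fromℕ< lt))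
      table-cell {v} {m} lt = byDec (m ℕP.<? Cc)
        where
        byDec : ∀ (d : Dec (m ℕ.< Cc)) → entry exactCode v d ≡ value (cell (v , fromℕ< lt))
        byDec (no ¬lt)  = contradiction lt ¬lt
        byDec (yes lt') = trans
          (cong value (FP.finToFun-funToFin (λ b → cell (remQuot Cc b)) (combine v (fromℕ< lt'))))
          (cong (λ p → value (cell p)) (trans (FP.remQuot-combine v (fromℕ< lt'))
            (cong (v ,_) (FP.toℕ-injective (trans (FP.toℕ-fromℕ< lt') (sym (FP.toℕ-fromℕ< lt)))))))

      pick-frontier : ∀ v i (x : Least v i) {o} → value (pick v i x) ≡ just o → S∞ v (toℕ i) o
      pick-frontier v i (inj₁ (x , s , _)) refl = s

      pick-minimal : ∀ v i (x : Least v i) {n} → S∞ v (toℕ i) n → ∃ λ o → value (pick v i x) ≡ just o × o ℕ.≤ n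
      pick-minimal v i (inj₁ (x , _ , min)) {n} s = toℕ x , refl , bound (n ℕP.≤? Mx)
        where
        bound : Dec (n ℕ.≤ Mx) → toℕ x ℕ.≤ n
        bound (yes n≤) = ℕP.≤-trans (min (fromℕ< (s≤s n≤)) (subst (S∞ v (toℕ i)) (sym (FP.toℕ-fromℕ< (s≤s n≤))) s))
                           (ℕP.≤-reflexive (FP.toℕ-fromℕ< (s≤s n≤)))
        bound (no ¬n≤) = ℕP.≤-trans (ℕP.≤-pred (FP.toℕ<n x)) (ℕP.<⇒≤ (ℕP.≰⇒> ¬n≤))
      pick-minimal v i (inj₂ none) s = contradiction
        (subst (S∞ v (toℕ i)) (sym (FP.toℕ-fromℕ< (ℕP.n<1+n Mx))) (bnd (FP.toℕ<n i) s)) (none (fromℕ< (ℕP.n<1+n Mx)))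

      exact : Exact (table exactCode)
      exact = record
        { frontier = λ {v} {m} {o} lt eq → subst (λ m → S∞ v m o) (FP.toℕ-fromℕ< lt)
            (pick-frontier v (fromℕ< lt) (leastAt v (fromℕ< lt)) (trans (sym (table-cell lt)) eq))
        ; minimal = λ {v} {m} {n} lt s → let
            (o , eq , le) = pick-minimal v (fromℕ< lt) (leastAt v (fromℕ< lt))
                              (subst (λ m → S∞ v m n) (sym (FP.toℕ-fromℕ< lt)) s)
            in o , trans (table-cell lt) eq , le
        }

    Cov : Fin K → ℕ → ℕ → Set
    Cov v m n = ∃ λ code → Check (table code) × In (table code) v m n

    Cov? : ∀ v m n → Dec (Cov v m n)
    Cov? v m n = FP.any? λ code → Check? (table code) ×-dec In? (table code) v m n

    Cov⊆S∞ : ∀ {v m n} → Cov v m n → S∞ v m n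
    Cov⊆S∞ (code , check , i) = sim⊆S∞ (Sound.In-sim check) i

    -- `Cov` is decidable, so the argument may be classical: assume periodicity, the bounds, and a
    -- decision for every cell of the table. Then the exact table has a code, passes the check and
    -- contains the point.
    S∞⊆Cov : ∀ {v m n} → S∞ v m n → Cov v m n
    S∞⊆Cov {v} {m} {n} s = decidable-stable (Cov? v m n) λ ¬w →
      periodic λ per → bounded λ bnd →
      ¬¬-∀Fin (λ v → ¬¬-∀Fin λ i → ¬¬-∀Fin λ x → ¬¬-excluded-middle) λ S? →
      ¬w (exactCode S? bnd , Complete.check (exact S? bnd) per , Complete.S∞⊆In (exact S? bnd) per s)

    S∞? : ∀ v m n → Dec (S∞ v m n)
    S∞? v m n = map′ Cov⊆S∞ S∞⊆Cov (Cov? v m n)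

    -- The answer is read off a checked table that covers the point; `S∞-step` alone would give it
    -- only under a double negation.
    S∞-sim : IsSim S∞
    S∞-sim v m n s mv mv∈ m' eff = go (S∞⊆Cov s)
      where
      into-S∞ : ∀ {code} → Check (table code) → Answer (In (table code)) n mv m' → Answer S∞ n mv m'
      into-S∞ {code} check (inj₁ (r , r∈ , t≤n , i)) = inj₁ (r , r∈ , t≤n , Cov⊆S∞ (code , check , i))
      into-S∞ check (inj₂ b) = inj₂ b
      go : Cov v m n → Answer S∞ n mv m'
      go (code , check , i) = into-S∞ check (Sound.In-sim check v m n i mv mv∈ m' eff)

    -- `(0 , 1)` generates the upward closure; the other vector repeats a base column of the
    -- periodic part.
    steps : ∀ {m} → Dec (A₀ ℕ.≤ m) → Maybe ℕ → List (ℕ × ℕ)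
    steps (yes _) (just j) = (Per , j ℕ.* T !) ∷ (0 , 1) ∷ []
    steps _       _        = (0 , 1) ∷ []

    stepsAt : Fin K → ℕ → List (ℕ × ℕ)
    stepsAt v m = steps (A₀ ℕP.≤? m) (slope v)

    unit∈ : ∀ {m} (d : Dec (A₀ ℕ.≤ m)) x → (0 , 1) ∈ steps d x
    unit∈ (yes _) (just _) = there (here refl)
    unit∈ (yes _) nothing  = here refl
    unit∈ (no _)  (just _) = here refl
    unit∈ (no _)  nothing  = here refl

    period∈ : ∀ {m j} (d : Dec (A₀ ℕ.≤ m)) → A₀ ℕ.≤ m → (Per , j ℕ.* T !) ∈ steps d (just j)
    period∈ (yes _) _  = here refl
    period∈ (no ¬p) le = contradiction le ¬p

    steps-∈ : ∀ {m px py} (d : Dec (A₀ ℕ.≤ m)) x → (px , py) ∈ steps d x →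
      (px ≡ 0 × py ≡ 1) ⊎ (∃ λ j → x ≡ just j × A₀ ℕ.≤ m × px ≡ Per × py ≡ j ℕ.* T !)
    steps-∈ (yes le) (just j) (here refl)         = inj₂ (j , refl , le , refl , refl)
    steps-∈ (yes _)  (just _) (there (here refl)) = inj₁ (refl , refl)
    steps-∈ (yes _)  nothing  (here refl)         = inj₁ (refl , refl)
    steps-∈ (no _)   (just _) (here refl)         = inj₁ (refl , refl)
    steps-∈ (no _)   nothing  (here refl)         = inj₁ (refl , refl)

    piece : Fin K → ℕ → Maybe ℕ → Semilinear
    piece v m nothing  = []
    piece v m (just o) = linear (m , o) (stepsAt v m) ∷ []

    tableRep : Table → Fin K → Semilinear
    tableRep f v = concatMap (λ i → piece v (toℕ i) (f v (toℕ i))) (allFin Cc)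

    span⇒In : ∀ {f v m o x y} → m ℕ.< Cc → f v m ≡ just o → InSpan (stepsAt v m) x y → In f v (m ℕ.+ x) (o ℕ.+ y)
    span⇒In {f} {v} {m} {o} lt eq span-zero =
      subst₂ (In f v) (sym (ℕP.+-identityʳ m)) (sym (ℕP.+-identityʳ o)) (start lt eq ℕP.≤-refl)
    span⇒In {f} {v} {m} {o} lt eq (span-add {px} {py} {x} {y} p∈ sp) with steps-∈ (A₀ ℕP.≤? m) (slope v) p∈
    ... | inj₁ (refl , refl) = In-up (span⇒In lt eq sp) (ℕP.+-monoʳ-≤ o (ℕP.n≤1+n y))
    ... | inj₂ (j , sl , A≤ , refl , refl) =
          subst₂ (In f v) (swap m Per x) (swap o (j ℕ.* T !) y)
            (next sl (ℕP.≤-trans A≤ (ℕP.m≤m+n m x)) (span⇒In lt eq sp))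
      where
      swap : ∀ a p x → a ℕ.+ x ℕ.+ p ≡ a ℕ.+ (p ℕ.+ x)
      swap a p x = trans (ℕP.+-assoc a x p) (cong (a ℕ.+_) (ℕP.+-comm x p))

    -- Stripping the periods leads back to a base column. The clause on `A₀` ensures that this
    -- column does not slip below `A₀`, so that the period vector is available there.
    In⇒span : ∀ {f v m n} → In f v m n → ∃ λ i → ∃ λ o → i ℕ.< Cc × f v i ≡ just o × (A₀ ℕ.≤ m → A₀ ℕ.≤ i) ×
      (∃ λ x → ∃ λ y → InSpan (stepsAt v i) x y × m ≡ i ℕ.+ x × n ≡ o ℕ.+ y)
    In⇒span {f} {v} (start {m} {o} {n} lt eq le) = m , o , lt , eq , (λ A≤ → A≤) , 0 , n ℕ.∸ o ,
        units (n ℕ.∸ o) , sym (ℕP.+-identityʳ m) , sym (ℕP.m+[n∸m]≡n le)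
      where
      units : ∀ y → InSpan (stepsAt v m) 0 y
      units zero    = span-zero
      units (suc y) = span-add (unit∈ (A₀ ℕP.≤? m) (slope v)) (units y)
    In⇒span {f} {v} (next {j} sl A≤m i) with In⇒span i
    ... | i₀ , o , lt , eq , A≤ , x , y , sp , refl , refl = i₀ , o , lt , eq , (λ _ → A≤ A≤m) ,
          Per ℕ.+ x , j ℕ.* T ! ℕ.+ y ,
          span-add (subst (λ z → (Per , j ℕ.* T !) ∈ steps (A₀ ℕP.≤? i₀) z) (sym sl) (period∈ (A₀ ℕP.≤? i₀) (A≤ A≤m))) sp ,
          swap i₀ x Per , swap o y (j ℕ.* T !)
      where
      swap : ∀ a x p → a ℕ.+ x ℕ.+ p ≡ a ℕ.+ (p ℕ.+ x)
      swap a x p = trans (ℕP.+-assoc a x p) (cong (a ℕ.+_) (ℕP.+-comm x p))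

    tableRep⇒In : ∀ {f v m n} → InSemilinear (tableRep f v) m n → In f v m n
    tableRep⇒In {f} {v} {m} {n} p with concatMap-∃ (λ i → piece v (toℕ i) (f v (toℕ i))) (allFin Cc) p
    ... | i , _ , q = go (f v (toℕ i)) refl q
      where
      go : ∀ x → f v (toℕ i) ≡ x → InSemilinear (piece v (toℕ i) x) m n → In f v m n
      go (just o) eq (here (x , y , sp , refl , refl)) = span⇒In (FP.toℕ<n i) eq sp

    In⇒tableRep : ∀ {f v m n} → In f v m n → InSemilinear (tableRep f v) m n
    In⇒tableRep {f} {v} {m} {n} p with In⇒span p
    ... | i , o , lt , eq , _ , span = ∃-concatMap (∈-allFin (fromℕ< lt))
          (subst (λ z → InSemilinear (piece v z (f v z)) m n) (sym (FP.toℕ-fromℕ< lt))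
            (subst (λ z → InSemilinear (piece v i z) m n) (sym eq) (here span)))

    codeRep : ∀ code → Dec (Check (table code)) → Fin K → Semilinear
    codeRep code (yes _) v = tableRep (table code) v
    codeRep code (no _)  v = []

    solution : Solution G
    solution = record
      { rep          = λ v → concatMap (codes v) (allFin N)
      ; rep-sound    = λ {v} p → let (code , _ , q) = concatMap-∃ (codes v) (allFin N) p in
                         sound (Check? (table code)) q
      ; rep-complete = λ {v} s → let (code , check , i) = S∞⊆Cov s in
                         ∃-concatMap {f = codes v} (∈-allFin code) (complete (Check? (table code)) check i)
      ; sim          = S∞-sim
      ; columns      = λ v → byslope v (slope v) refl
      }
      where
      codes : Fin K → Fin N → Semilinear
      codes v code = codeRep code (Check? (table code)) v
      sound : ∀ {code v m n} (d : Dec (Check (table code))) → InSemilinear (codeRep code d v) m n → S∞ v m n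
      sound {code} (yes check) q = Cov⊆S∞ (code , check , tableRep⇒In q)
      complete : ∀ {code v m n} (d : Dec (Check (table code))) → Check (table code) → In (table code) v m n →
        InSemilinear (codeRep code d v) m n
      complete (yes _)     _     i = In⇒tableRep i
      complete (no ¬check) check i = contradiction check ¬check
      byslope : ∀ v x → slope v ≡ x → (∀ m → ∃ λ n → S∞ v m n) ⊎
        (∃ λ M → (∀ {m} → m ℕ.< M → ∃ λ n → S∞ v m n) × (∀ {m n} → S∞ v m n → m ℕ.< M))
      byslope v (just j) sl = inj₁ λ m → J ℕ.* m ℕ.+ c , linear-above m sl
      byslope v nothing  sl = let
        -- By `bounded`, a column up to `c` has a winning value only if `Mx` wins there, and this is
        -- decidable; column `c` already fails.
        (M , M≤c , lt , ¬M) = threshold (λ m → S∞? v m Mx) (λ le → S∞-mono le ℕP.≤-refl) c (slope-right sl ℕP.≤-refl)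
        in inj₂ (M , (λ m<M → Mx , lt m<M) , λ {m} {n} s → ℕP.≰⇒> λ M≤m →
            bounded λ bnd → ¬M (bnd (ℕP.≤-<-trans (ℕP.≤-trans M≤c (c≤m (ℕP.m≤n⇒m≤1+n m₀≤A₀))) A₀<Cc)
              (S∞-mono M≤m ℕP.≤-refl s)))

-- Weak steps and ω-moves

open GameSolution using (Bounded; Solution; module Solve)
open import Data.Nat using (_+_; _*_; _∸_; _≤_; _<_; _⊔_; _≤?_; _<?_)

∈-concatMap : ∀ {A B : Set} (f : A → List B) {xs x y} → x ∈ xs → y ∈ f x → y ∈ concatMap f xs
∈-concatMap f x∈ y∈ = AnyP.concatMap⁺ f (lose x∈ y∈)

concatMap-∈ : ∀ {A B : Set} (f : A → List B) {xs y} → y ∈ concatMap f xs → ∃ λ x → x ∈ xs × y ∈ f x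
concatMap-∈ f y∈ = find (AnyP.concatMap⁻ f y∈)

-- (t , just u) leads from n ≥ t to n - t + u, and (t , nothing) from n ≥ t to arbitrarily large values.
Entry : Set
Entry = ℕ × Maybe ℕ

Sound : Entry → (ℕ → ℕ → Set) → Set
Sound (t , just u)  R = ∀ x → R (t + x) (u + x)
Sound (t , nothing) R = ∀ {n} → t ≤ n → ∀ B → ∃ λ n' → B ≤ n' × R n n'

-- The target is bounded from above only: Duplicator profits from a larger counter, so an entry that
-- reaches at least `n'` replaces the step.
Covers : Entry → ℕ → ℕ → Set
Covers (t , just u)  n n' = ∃ λ x → n ≡ t + x × n' ≤ u + x
Covers (t , nothing) n n' = t ≤ n

-- After an ω-move any later need can be met by pumping further, so only the need of the first entry
-- remains.
comp : Entry → Entry → Entry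
comp (t , nothing) _            = t , nothing
comp (t , just u) (t' , just u') = t + (t' ∸ u) , just (u' + (u ∸ t'))
comp (t , just u) (t' , nothing) = t + (t' ∸ u) , nothing

Sound-map : ∀ e {R R' : ℕ → ℕ → Set} → (∀ {n n'} → R n n' → R' n n') → Sound e R → Sound e R'
Sound-map (t , just u)  f s x = f (s x)
Sound-map (t , nothing) f s le B = let (n' , B≤ , r) = s le B in n' , B≤ , f r

infixr 5 _⨟_
_⨟_ : (ℕ → ℕ → Set) → (ℕ → ℕ → Set) → ℕ → ℕ → Set
(R ⨟ R') n n'' = ∃ λ n' → R n n' × R' n' n''

∸-exchange : ∀ u t → u + (t ∸ u) ≡ t + (u ∸ t)
∸-exchange zero    zero    = refl
∸-exchange zero    (suc t) = sym (ℕP.+-identityʳ (suc t))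
∸-exchange (suc u) zero    = ℕP.+-identityʳ (suc u)
∸-exchange (suc u) (suc t) = cong suc (∸-exchange u t)

balance : ∀ u t z → u + ((t ∸ u) + z) ≡ t + ((u ∸ t) + z)
balance u t z = trans (sym (ℕP.+-assoc u _ z)) (trans (cong (_+ z) (∸-exchange u t)) (ℕP.+-assoc t _ z))

comp-sound : ∀ e e' {R R'} → Sound e R → Sound e' R' → Sound (comp e e') (R ⨟ R')
comp-sound (t , nothing) (t' , just u') {R} {R'} s s' le B =
  let (n , B≤ , r) = s le (t' + B)
      n≡ = ℕP.m+[n∸m]≡n (ℕP.m+n≤o⇒m≤o t' B≤)
  in u' + (n ∸ t') , ℕP.≤-trans (ℕP.m+n≤o⇒m≤o∸n B (subst (_≤ n) (ℕP.+-comm t' B) B≤)) (ℕP.m≤n+m _ u') ,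
     n , r , subst (λ z → R' z (u' + (n ∸ t'))) n≡ (s' (n ∸ t'))
comp-sound (t , nothing) (t' , nothing) s s' le B =
  let (n , B≤ , r) = s le t' ; (n' , B≤' , r') = s' B≤ B in n' , B≤' , n , r , r'
comp-sound (t , just u) (t' , just u') {R} {R'} s s' x = u + ((t' ∸ u) + x) ,
  subst (λ z → R z (u + ((t' ∸ u) + x))) (sym (ℕP.+-assoc t (t' ∸ u) x)) (s ((t' ∸ u) + x)) ,
  subst₂ R' (sym (balance u t' x)) (sym (ℕP.+-assoc u' (u ∸ t') x)) (s' ((u ∸ t') + x))
comp-sound (t , just u) (t' , nothing) {R} {R'} s s' {n} le B =
  let x = n ∸ (t + (t' ∸ u))
      (n' , B≤ , r') = s' (subst (t' ≤_) (sym (balance u t' x)) (ℕP.m≤m+n t' _)) B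
  in n' , B≤ , u + ((t' ∸ u) + x) ,
     subst (λ z → R z (u + ((t' ∸ u) + x))) (trans (sym (ℕP.+-assoc t (t' ∸ u) x)) (ℕP.m+[n∸m]≡n le)) (s ((t' ∸ u) + x)) , r'

comp-covers : ∀ e e' {n n' n''} → Covers e n n' → Covers e' n' n'' → Covers (comp e e') n n''
comp-covers (t , nothing) _ cv _ = cv
comp-covers (t , just u) (t' , just u') {n'' = n''} (x , refl , le) (y , refl , le') with ℕP.≤-total t' u
... | inj₁ t'≤u = x ,
      sym (trans (cong (λ z → t + z + x) (ℕP.m≤n⇒m∸n≡0 t'≤u)) (cong (_+ x) (ℕP.+-identityʳ t))) ,
      ℕP.≤-trans le' (subst (u' + y ≤_) (sym (ℕP.+-assoc u' (u ∸ t') x)) (ℕP.+-monoʳ-≤ u'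
        (ℕP.+-cancelˡ-≤ t' y _ (ℕP.≤-trans le (ℕP.≤-reflexive
          (trans (cong (_+ x) (sym (ℕP.m+[n∸m]≡n t'≤u))) (ℕP.+-assoc t' (u ∸ t') x)))))))
... | inj₂ u≤t' = x ∸ (t' ∸ u) ,
      sym (trans (ℕP.+-assoc t (t' ∸ u) _) (cong (t +_) (ℕP.m+[n∸m]≡n (ℕP.m+n≤o⇒m≤o (t' ∸ u) y-room)))) ,
      ℕP.≤-trans le' (subst (λ z → u' + y ≤ u' + z + (x ∸ (t' ∸ u))) (sym (ℕP.m≤n⇒m∸n≡0 u≤t'))
        (subst (λ z → u' + y ≤ z + (x ∸ (t' ∸ u))) (sym (ℕP.+-identityʳ u'))
          (ℕP.+-monoʳ-≤ u' (ℕP.m+n≤o⇒m≤o∸n y (subst (_≤ x) (ℕP.+-comm (t' ∸ u) y) y-room)))))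
  where
  y-room : (t' ∸ u) + y ≤ x
  y-room = ℕP.+-cancelˡ-≤ u _ x (ℕP.≤-trans (ℕP.≤-reflexive
    (trans (sym (ℕP.+-assoc u (t' ∸ u) y)) (cong (_+ y) (ℕP.m+[n∸m]≡n u≤t')))) le)
comp-covers (t , just u) (t' , nothing) (x , refl , le) t'≤ =
  ℕP.+-monoʳ-≤ t (ℕP.m≤n+o⇒m∸n≤o t' u (ℕP.≤-trans t'≤ le))

covers-down : ∀ e {n n' n''} → n'' ≤ n' → Covers e n n' → Covers e n n''
covers-down (t , just u)  le (x , eq , le') = x , eq , ℕP.≤-trans le le'
covers-down (t , nothing) le cv = cv

stepEntry : Dir → Entry
stepEntry dec  = 1 , just 0
stepEntry stay = 0 , just 0
stepEntry inc  = 0 , just 1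

step-sound : ∀ d → Sound (stepEntry d) (Eff d)
step-sound dec  x = refl
step-sound stay x = refl
step-sound inc  x = refl

step-covers : ∀ d {n n'} → Eff d n n' → Covers (stepEntry d) n n'
step-covers dec  {n' = n'} refl = n' , refl , ℕP.≤-refl
step-covers stay {n} refl = n , refl , ℕP.≤-refl
step-covers inc  {n} refl = n , refl , ℕP.≤-refl

-- Finite descriptions of the weak steps of a net

module Weak {k : ℕ} (N : OCN k) where

  Q : Set
  Q = Fin (nQ N)

  select : Q → Act k → Q × Act k × Dir × Q → List (Dir × Q)
  select q a (p , b , d , q') with (p FP.≟ q) ×-dec MaybeP.≡-dec FP._≟_ b a
  ... | yes _ = (d , q') ∷ []
  ... | no _  = []

  out : Q → Act k → List (Dir × Q)
  out q a = concatMap (select q a) (δ N)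

  out-sound : ∀ {q a d q'} → (d , q') ∈ out q a → (q , a , d , q') ∈ δ N
  out-sound {q} {a} {d} {q'} p with concatMap-∈ (select q a) p
  ... | (p' , b , d' , q'') , tr∈ , r with (p' FP.≟ q) ×-dec MaybeP.≡-dec FP._≟_ b a
  ... | yes (refl , refl) with r
  ... | here refl = tr∈

  out-complete : ∀ {q a d q'} → (q , a , d , q') ∈ δ N → (d , q') ∈ out q a
  out-complete {q} {a} {d} {q'} tr∈ = ∈-concatMap (select q a) tr∈ chosen
    where
    chosen : (d , q') ∈ select q a (q , a , d , q')
    chosen with (q FP.≟ q) ×-dec MaybeP.≡-dec FP._≟_ a a
    ... | yes _ = here refl
    ... | no ¬p = contradiction (refl , refl) ¬p

  Tau : Q → Q → ℕ → ℕ → Set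
  Tau q q' n n' = TauStar N (q , n) (q' , n')

  tau-trans : ∀ {c d e} → TauStar N c d → TauStar N d e → TauStar N c e
  tau-trans τ-refl        ys = ys
  tau-trans (τ-step x xs) ys = τ-step x (tau-trans xs ys)

  extend : (Dir × Q → List (Entry × Q)) → Dir × Q → List (Entry × Q)
  extend next (d , q₁) = map (λ (e , q') → comp (stepEntry d) e , q') (next (d , q₁))

  paths : ℕ → Q → List (Entry × Q)
  paths zero    q = ((0 , just 0) , q) ∷ []
  paths (suc l) q = concatMap (extend λ (d , q₁) → paths l q₁) (out q τ)

  paths-sound : ∀ l {q e q'} → (e , q') ∈ paths l q → Sound e (Tau q q')
  paths-sound zero (here refl) x = τ-refl
  paths-sound (suc l) {q} p with concatMap-∈ (extend λ (d , q₁) → paths l q₁) {out q τ} p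
  ... | (d , q₁) , o∈ , r with ∈-map⁻ (λ (e , q') → comp (stepEntry d) e , q') r
  ... | (e , q') , e∈ , refl =
        Sound-map (comp (stepEntry d) e) (λ (_ , eff , ts) → τ-step (step (out-sound o∈) eff) ts)
          (comp-sound (stepEntry d) e {Eff d} {Tau q₁ q'} (step-sound d) (paths-sound l e∈))

  data TauN : ℕ → Conf N → Conf N → Set where
    []  : ∀ {c} → TauN 0 c c
    _∷_ : ∀ {l c d e} → Step N c τ d → TauN l d e → TauN (suc l) c e

  toTauN : ∀ {c d} → TauStar N c d → ∃ λ l → TauN l c d
  toTauN τ-refl        = 0 , []
  toTauN (τ-step s ss) = let (l , p) = toTauN ss in suc l , s ∷ p

  paths-complete : ∀ {l q n q' n'} → TauN l (q , n) (q' , n') → ∃ λ e → (e , q') ∈ paths l q × Covers e n n'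
  paths-complete {n = n} [] = (0 , just 0) , here refl , n , refl , ℕP.≤-refl
  paths-complete {suc l} {q} (step {d = d} {q = q₁} tr∈ eff ∷ p) =
    let (e , e∈ , cv) = paths-complete p in
    comp (stepEntry d) e ,
    ∈-concatMap (extend λ (d , q₁) → paths l q₁) (out-complete tr∈) (∈-map⁺ _ e∈) ,
    comp-covers (stepEntry d) e (step-covers d eff) cv

  short : Q → List (Entry × Q)
  short q = concatMap (λ l → paths l q) (upTo (suc (nQ N)))

  short-sound : ∀ {q e q'} → (e , q') ∈ short q → Sound e (Tau q q')
  short-sound {q} p = let (l , _ , p') = concatMap-∈ (λ l → paths l q) {upTo (suc (nQ N))} p in paths-sound l p'

  short-complete : ∀ {l q n q' n'} → l ≤ nQ N → TauN l (q , n) (q' , n') → ∃ λ e → (e , q') ∈ short q × Covers e n n'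
  short-complete {q = q} l≤ p = let (e , e∈ , cv) = paths-complete p in
    e , ∈-concatMap (λ l → paths l q) (∈-upTo⁺ (s≤s l≤)) e∈ , cv

  conf : ∀ {l c d} → TauN l c d → ℕ → Conf N
  conf {c = c} _       zero    = c
  conf {c = c} []      (suc i) = c
  conf         (_ ∷ p) (suc i) = conf p i

  take : ∀ {l c d} (p : TauN l c d) i → i ≤ l → TauN i c (conf p i)
  take p       zero    _        = []
  take (s ∷ p) (suc i) (s≤s i≤) = s ∷ take p i i≤

  drop : ∀ {l c d} (p : TauN l c d) i → TauN (l ∸ i) (conf p i) d
  drop p       zero    = p
  drop []      (suc i) = []
  drop (s ∷ p) (suc i) = drop p i

  conf-drop : ∀ {l c d} (p : TauN l c d) i j → conf (drop p i) j ≡ conf p (i + j)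
  conf-drop p       zero    j       = refl
  conf-drop []      (suc i) zero    = refl
  conf-drop []      (suc i) (suc j) = refl
  conf-drop (s ∷ p) (suc i) j       = conf-drop p i j

  _++N_ : ∀ {l l' c d e} → TauN l c d → TauN l' d e → TauN (l + l') c e
  []      ++N qs = qs
  (s ∷ p) ++N qs = s ∷ (p ++N qs)

  Eff-lift : ∀ d {m n} y → Eff d m n → Eff d (m + y) (n + y)
  Eff-lift dec  y refl = refl
  Eff-lift stay y refl = refl
  Eff-lift inc  y refl = refl

  lift : ∀ {l q n q' n'} y → TauN l (q , n) (q' , n') → TauN l (q , n + y) (q' , n' + y)
  lift y []               = []
  lift y (step {d = d} tr∈ eff ∷ p) = step tr∈ (Eff-lift d y eff) ∷ lift y p

  record Cycle (l : ℕ) (q : Q) (n : ℕ) (q' : Q) (n' : ℕ) : Set where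
    field
      {a b r} : ℕ
      s       : Q
      n₁ n₂   : ℕ
      prefix  : TauN a (q , n) (s , n₁)
      loop    : TauN b (s , n₁) (s , n₂)
      suffix  : TauN r (s , n₂) (q' , n')
      a≤      : a ≤ nQ N
      b≤      : b ≤ nQ N
      shorter : a + r < l

  -- The pigeonhole principle is applied to the first `nQ N + 1` configurations only, which makes
  -- both the prefix and the loop short.
  find-cycle : ∀ {l q n q' n'} → nQ N < l → TauN l (q , n) (q' , n') → Cycle l q n q' n'
  find-cycle {l} Q<l p with FP.pigeonhole (ℕP.n<1+n (nQ N)) (λ i → proj₁ (conf p (toℕ i)))
  ... | i , j , i<j , eq = record
    { s = proj₁ cᵢ ; n₁ = proj₂ cᵢ ; n₂ = proj₂ cⱼ
    ; prefix  = take p (toℕ i) i≤l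
    ; loop    = subst (TauN (toℕ j ∸ toℕ i) cᵢ) end (take (drop p (toℕ i)) (toℕ j ∸ toℕ i) (ℕP.∸-monoˡ-≤ (toℕ i) j≤l))
    ; suffix  = subst (λ s → TauN (l ∸ toℕ j) (s , proj₂ cⱼ) _) (sym eq) (drop p (toℕ j))
    ; a≤      = ℕP.≤-trans (ℕP.<⇒≤ i<j) j≤Q
    ; b≤      = ℕP.≤-trans (ℕP.m∸n≤m (toℕ j) (toℕ i)) j≤Q
    ; shorter = ℕP.<-≤-trans (ℕP.+-monoˡ-< (l ∸ toℕ j) i<j) (ℕP.≤-reflexive (ℕP.m+[n∸m]≡n j≤l))
    }
    where
    cᵢ cⱼ : Conf N
    cᵢ = conf p (toℕ i)
    cⱼ = conf p (toℕ j)
    j≤Q : toℕ j ≤ nQ N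
    j≤Q = ℕP.≤-pred (FP.toℕ<n j)
    j≤l : toℕ j ≤ l
    j≤l = ℕP.≤-trans j≤Q (ℕP.<⇒≤ Q<l)
    i≤l : toℕ i ≤ l
    i≤l = ℕP.≤-trans (ℕP.<⇒≤ i<j) j≤l
    end : conf (drop p (toℕ i)) (toℕ j ∸ toℕ i) ≡ (proj₁ cᵢ , proj₂ cⱼ)
    end = trans (conf-drop p (toℕ i) (toℕ j ∸ toℕ i))
      (trans (cong (conf p) (ℕP.m+[n∸m]≡n (ℕP.<⇒≤ i<j))) (cong (_, proj₂ cⱼ) (sym eq)))

  -- Only the control state matters here. Lifting the prefix by `n₂` and the suffix by `n₁` makes
  -- both meet at `n₁ + n₂`, so the loop can be cut out whatever its effect.
  short-reach : ∀ fuel {l q n q' n'} → l ≤ fuel → TauN l (q , n) (q' , n') → ∃ λ e → (e , q') ∈ short q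
  short-reach fuel {l} {q} {n} {q'} {n'} l≤ p with nQ N <? l
  short-reach fuel l≤ p | no ¬lt = let (e , e∈ , _) = short-complete (ℕP.≮⇒≥ ¬lt) p in e , e∈
  short-reach zero l≤ p | yes lt = contradiction (ℕP.<-≤-trans lt l≤) λ ()
  short-reach (suc fuel) {q' = q'} {n'} l≤ p | yes lt = short-reach fuel (ℕP.≤-pred (ℕP.≤-trans shorter l≤))
      (lift n₂ prefix ++N subst (λ z → TauN r (s , z) (q' , n' + n₁)) (ℕP.+-comm n₂ n₁) (lift n₁ suffix))
    where open Cycle (find-cycle lt p)

  Grows : Entry → Set
  Grows (t , just u)  = t < u
  Grows (t , nothing) = ⊤

  Grows? : ∀ e → Dec (Grows e)
  Grows? (t , just u)  = t <? u
  Grows? (t , nothing) = yes tt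

  pump : Q → Entry × Q → List Entry
  pump q (e , q') with (q' FP.≟ q) ×-dec Grows? e
  ... | yes _ = (proj₁ e , nothing) ∷ []
  ... | no _  = []

  loops : Q → List Entry
  loops q = concatMap (pump q) (short q)

  iterate : ∀ {q t u} → t < u → Sound (t , just u) (Tau q q) → Sound (t , nothing) (Tau q q)
  iterate t<u s {n} t≤n zero = n , z≤n , τ-refl
  iterate {q} {t} {u} t<u s {n} t≤n (suc B) =
    let (n' , B≤ , ts) = iterate t<u s t≤n B in
    go n' (ℕP.m≤n⇒m<n∨m≡n B≤) ts (t ≤? n')
    where
    go : ∀ n' → B < n' ⊎ B ≡ n' → Tau q q n n' → Dec (t ≤ n') → ∃ λ n'' → suc B ≤ n'' × Tau q q n n''
    go n' (inj₁ lt) ts _ = n' , lt , ts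
    go n' (inj₂ refl) ts (yes t≤) = u + (n' ∸ t) ,
      ℕP.≤-trans (ℕP.≤-reflexive (cong suc (sym (ℕP.m+[n∸m]≡n t≤)))) (ℕP.+-monoˡ-≤ (n' ∸ t) t<u) ,
      tau-trans ts (subst (λ z → Tau q q z (u + (n' ∸ t))) (ℕP.m+[n∸m]≡n t≤) (s (n' ∸ t)))
    -- The value reached is below `t`, hence below the initial `n`, so the empty path already
    -- exceeds it.
    go n' (inj₂ refl) ts (no ¬t≤) = n , ℕP.≤-trans (ℕP.≰⇒> ¬t≤) t≤n , τ-refl

  grow : ∀ {q} e → Grows e → Sound e (Tau q q) → Sound (proj₁ e , nothing) (Tau q q)
  grow (t , just u)  t<u s = iterate t<u s
  grow (t , nothing) _   s = s

  loops-sound : ∀ {q e} → e ∈ loops q → Sound e (Tau q q)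
  loops-sound {q} p with concatMap-∈ (pump q) {short q} p
  ... | (e , q') , s∈ , r with (q' FP.≟ q) ×-dec Grows? e
  ... | yes (refl , g) with r
  ... | here refl = grow e g (short-sound s∈)

  loops-complete : ∀ {q e} → (e , q) ∈ short q → Grows e → (proj₁ e , nothing) ∈ loops q
  loops-complete {q} {e} s∈ g = ∈-concatMap (pump q) s∈ chosen
    where
    chosen : (proj₁ e , nothing) ∈ pump q (e , q)
    chosen with (q FP.≟ q) ×-dec Grows? e
    ... | yes _ = here refl
    ... | no ¬p = contradiction (refl , g) ¬p

  covers-grows : ∀ e {n n'} → n < n' → Covers e n n' → Grows e × proj₁ e ≤ n
  covers-grows (t , just u) {n' = n'} lt (x , eq , le) =
    ℕP.+-cancelʳ-< x t u (ℕP.<-≤-trans (subst (_< n') eq lt) le) , subst (t ≤_) (sym eq) (ℕP.m≤m+n t x)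
  covers-grows (t , nothing) _ t≤ = tt , t≤

  pumped : Entry × Q → List (Entry × Q)
  pumped (e₁ , q₁) = concatMap (λ l → map (λ (e₃ , q') → comp e₁ (comp l e₃) , q') (short q₁)) (loops q₁)

  τ-entries : Q → List (Entry × Q)
  τ-entries q = short q ++ concatMap pumped (short q)

  τ-sound : ∀ {q e q'} → (e , q') ∈ τ-entries q → Sound e (Tau q q')
  τ-sound {q} p with ∈-++⁻ (short q) p
  ... | inj₁ p' = short-sound p'
  ... | inj₂ p' with concatMap-∈ pumped {short q} p'
  ... | (e₁ , q₁) , e₁∈ , r with concatMap-∈ (λ l → map (λ (e₃ , q') → comp e₁ (comp l e₃) , q') (short q₁)) {loops q₁} r
  ... | l , l∈ , r' with ∈-map⁻ (λ (e₃ , q') → comp e₁ (comp l e₃) , q') r'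
  ... | (e₃ , q') , e₃∈ , refl = Sound-map (comp e₁ (comp l e₃))
        (λ (_ , ts , _ , ts' , ts'') → tau-trans ts (tau-trans ts' ts''))
        (comp-sound e₁ (comp l e₃) (short-sound e₁∈) (comp-sound l e₃ (loops-sound l∈) (short-sound e₃∈)))

  -- Long paths contain a cycle: a cycle that does not increase the counter can be cut out,
  -- one that does can be pumped.
  τ-complete′ : ∀ fuel {l q n q' n'} → l ≤ fuel → TauN l (q , n) (q' , n') → ∃ λ e → (e , q') ∈ τ-entries q × Covers e n n'
  τ-complete′ fuel {l} l≤ p with nQ N <? l
  τ-complete′ fuel {l} {q} l≤ p | no ¬lt = let (e , e∈ , cv) = short-complete (ℕP.≮⇒≥ ¬lt) p in
    e , ∈-++⁺ˡ e∈ , cv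
  τ-complete′ zero l≤ p | yes lt = contradiction (ℕP.<-≤-trans lt l≤) λ ()
  τ-complete′ (suc fuel) {l} {q} {n} {q'} {n'} l≤ p | yes lt = go (n₁ <? n₂)
    where
    open Cycle (find-cycle lt p)
    go : Dec (n₁ < n₂) → ∃ λ e → (e , q') ∈ τ-entries q × Covers e n n'
    go (no ¬up) = let
      (e , e∈ , cv) = τ-complete′ fuel (ℕP.≤-pred (ℕP.≤-trans shorter l≤))
        (prefix ++N subst (λ z → TauN r (s , z) (q' , n' + (n₁ ∸ n₂))) (ℕP.m+[n∸m]≡n (ℕP.≮⇒≥ ¬up)) (lift (n₁ ∸ n₂) suffix))
      in e , e∈ , covers-down e (ℕP.m≤m+n n' _) cv
    go (yes up) = pumpable (short-complete a≤ prefix) (short-complete b≤ loop) (short-reach _ ℕP.≤-refl suffix)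
      where
      pumpable : (∃ λ e → (e , s) ∈ short q × Covers e n n₁) → (∃ λ e → (e , s) ∈ short s × Covers e n₁ n₂) →
        (∃ λ e → (e , q') ∈ short s) → ∃ λ e → (e , q') ∈ τ-entries q × Covers e n n'
      pumpable (e₁ , e₁∈ , cv₁) (e₂ , e₂∈ , cv₂) (e₃ , e₃∈) = let (g , t≤) = covers-grows e₂ up cv₂ in
        comp e₁ (comp (proj₁ e₂ , nothing) e₃) ,
        ∈-++⁺ʳ (short q) (∈-concatMap pumped e₁∈
          (∈-concatMap (λ l → map (λ (e₃ , q') → comp e₁ (comp l e₃) , q') (short s)) (loops-complete e₂∈ g) (∈-map⁺ _ e₃∈))) ,
        comp-covers e₁ (comp (proj₁ e₂ , nothing) e₃) cv₁ t≤

  τ-complete : ∀ {q n q' n'} → TauStar N (q , n) (q' , n') → ∃ λ e → (e , q') ∈ τ-entries q × Covers e n n'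
  τ-complete ts = let (l , p) = toTauN ts in τ-complete′ l ℕP.≤-refl p

  visible₂ : Entry → Dir × Q → List (Entry × Q)
  visible₂ e₁ (d , q₂) = map (λ (e₂ , q') → comp e₁ (comp (stepEntry d) e₂) , q') (τ-entries q₂)

  visible₁ : Fin k → Entry × Q → List (Entry × Q)
  visible₁ a (e₁ , q₁) = concatMap (visible₂ e₁) (out q₁ (just a))

  entries : Q → Act k → List (Entry × Q)
  entries q nothing  = τ-entries q
  entries q (just a) = concatMap (visible₁ a) (τ-entries q)

  entries-sound : ∀ {q} a {e q'} → (e , q') ∈ entries q a → Sound e (λ n n' → WeakStep N (q , n) a (q' , n'))
  entries-sound nothing  p = τ-sound p
  entries-sound {q} (just a) p with concatMap-∈ (visible₁ a) {τ-entries q} p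
  ... | (e₁ , q₁) , e₁∈ , r with concatMap-∈ (visible₂ e₁) {out q₁ (just a)} r
  ... | (d , q₂) , o∈ , r' with ∈-map⁻ (λ (e₂ , q') → comp e₁ (comp (stepEntry d) e₂) , q') r'
  ... | (e₂ , q') , e₂∈ , refl = Sound-map (comp e₁ (comp (stepEntry d) e₂))
        (λ (_ , ts , _ , eff , ts') → _ , _ , ts , step (out-sound o∈) eff , ts')
        (comp-sound e₁ (comp (stepEntry d) e₂) (τ-sound e₁∈)
          (comp-sound (stepEntry d) e₂ {Eff d} {Tau q₂ q'} (step-sound d) (τ-sound e₂∈)))

  entries-complete : ∀ {q n} a {q' n'} → WeakStep N (q , n) a (q' , n') → ∃ λ e → (e , q') ∈ entries q a × Covers e n n'
  entries-complete nothing  ts = τ-complete ts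
  entries-complete (just a) (_ , _ , ts , step {d = d} tr∈ eff , ts') = let
    (e₁ , e₁∈ , cv₁) = τ-complete ts
    (e₂ , e₂∈ , cv₂) = τ-complete ts'
    in comp e₁ (comp (stepEntry d) e₂) ,
       ∈-concatMap (visible₁ a) e₁∈ (∈-concatMap (visible₂ e₁) (out-complete tr∈) (∈-map⁺ _ e₂∈)) ,
       comp-covers e₁ (comp (stepEntry d) e₂) cv₁ (comp-covers (stepEntry d) e₂ (step-covers d eff) cv₂)

-- Uniform bounds for the moves of a game

bound-list : ∀ {A : Set} {P : ℕ → A → Set} → (∀ {m n x} → m ≤ n → P m x → P n x) → (∀ x → ∃ λ n → P n x) →
  ∀ xs → ∃ λ n → ∀ {x} → x ∈ xs → P n x
bound-list mono f [] = 0 , λ ()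
bound-list mono f (x ∷ xs) = let (m , p) = f x ; (n , ps) = bound-list mono f xs in
  m ⊔ n , λ { (here refl) → mono (ℕP.m≤m⊔n m n) p ; (there x∈) → mono (ℕP.m≤n⊔m m n) (ps x∈) }

bound-Fin : ∀ {k} {P : ℕ → Fin k → Set} → (∀ {m n x} → m ≤ n → P m x → P n x) → (∀ x → ∃ λ n → P n x) →
  ∃ λ n → ∀ x → P n x
bound-Fin {zero} mono f = 0 , λ ()
bound-Fin {suc k} {P} mono f = let (m , p) = f zero ; (n , ps) = bound-Fin {P = λ n x → P n (suc x)} (λ {m} {n} {x} → mono {m} {n} {suc x}) (λ x → f (suc x)) in
  m ⊔ n , λ { zero → mono {x = zero} (ℕP.m≤m⊔n m n) p ; (suc x) → mono {x = suc x} (ℕP.m≤n⊔m m n) (ps x) }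

≤-both : ∀ {m n x y} → m ≤ n → x ≤ m × y ≤ m → x ≤ n × y ≤ n
≤-both m≤n (p , q) = ℕP.≤-trans p m≤n , ℕP.≤-trans q m≤n

bounds : ∀ {K} (G : Game K) → ∃ λ E → Bounded G E E
bounds {K} G = let (E , f) = bound-Fin {P = λ n v → ∀ {mv} → mv ∈ G v → MoveBound n mv}
                               (λ le g {mv} mv∈ → mono {mv = mv} le (g mv∈)) (λ v → bound-list {P = MoveBound} (λ {_} {_} {mv} → mono {mv = mv}) moveBound (G v)) in
  E , record { resp-≤ = λ {v} mv∈ → proj₁ (f v mv∈) ; bonus-≤ = λ {v} mv∈ → proj₂ (f v mv∈) }
  where
  MoveBound : ℕ → Move K → Set
  MoveBound n mv = (∀ {r} → r ∈ resps mv → need r ≤ n × gain r ≤ n) × (∀ {b} → b ∈ bonus mv → proj₁ b ≤ n × proj₂ b ≤ n)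
  mono : ∀ {m n mv} → m ≤ n → MoveBound m mv → MoveBound n mv
  mono le (f , g) = (λ r∈ → ≤-both le (f r∈)) , (λ b∈ → ≤-both le (g b∈))
  moveBound : ∀ mv → ∃ λ n → MoveBound n mv
  moveBound mv =
    let (m , f) = bound-list (≤-both) (λ r → need r ⊔ gain r , ℕP.m≤m⊔n _ _ , ℕP.m≤n⊔m _ _) (resps mv)
        (n , g) = bound-list (≤-both) (λ b → proj₁ b ⊔ proj₂ b , ℕP.m≤m⊔n _ _ , ℕP.m≤n⊔m _ _) (bonus mv)
    in m ⊔ n , (λ r∈ → ≤-both (ℕP.m≤m⊔n m n) (f r∈)) , (λ b∈ → ≤-both (ℕP.m≤n⊔m m n) (g b∈))

abstract
  solve-game : ∀ {K} (G : Game K) → Solution G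
  solve-game G = let (E , bd) = bounds G in Solve.solution G E E bd

-- A measure for the guessed columns

ΣFin : ∀ {n} → (Fin n → ℕ) → ℕ
ΣFin {zero}  f = 0
ΣFin {suc n} f = f zero + ΣFin (λ i → f (suc i))

ΣFin-≤ : ∀ {n} {f g : Fin n → ℕ} → (∀ i → f i ≤ g i) → ΣFin f ≤ ΣFin g
ΣFin-≤ {zero}  le = z≤n
ΣFin-≤ {suc n} le = ℕP.+-mono-≤ (le zero) (ΣFin-≤ λ i → le (suc i))

ΣFin-< : ∀ {n} {f g : Fin n → ℕ} → (∀ i → f i ≤ g i) → ∀ i → f i < g i → ΣFin f < ΣFin g
ΣFin-< le zero    lt = ℕP.+-mono-<-≤ lt (ΣFin-≤ λ i → le (suc i))
ΣFin-< le (suc i) lt = ℕP.+-mono-≤-< (le zero) (ΣFin-< (λ i → le (suc i)) i lt)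

-- nothing plays the role of ∞
Fits : Maybe ℕ → ℕ → Set
Fits nothing  m = ⊤
Fits (just x) m = m < x

infinite finite : Maybe ℕ → ℕ
infinite nothing  = 1
infinite (just _) = 0
finite nothing  = 0
finite (just x) = x

-- The cases are separated by their effect on the lexicographic measure: `cut` removes an infinite
-- guess, `lower` reduces the sum of the finite ones.
data _≼_ : Maybe ℕ → Maybe ℕ → Set where
  same  : ∀ {x} → x ≼ x
  cut   : ∀ {x} → just x ≼ nothing
  lower : ∀ {x y} → x < y → just x ≼ just y

≼-infinite : ∀ {x y} → x ≼ y → infinite x ≤ infinite y
≼-infinite same      = ℕP.≤-refl
≼-infinite cut       = z≤n
≼-infinite (lower _) = z≤n

-- Reduction of weak simulation to games with guesses for the ω-moves

module Omega {k : ℕ} (N N' : OCN k) where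
  open Weak N' using (entries; entries-sound; entries-complete)

  P : ℕ
  P = nQ N * nQ N'

  pair : Fin (nQ N) → Fin (nQ N') → Fin P
  pair = combine

  outgoing : Fin (nQ N) → Fin (nQ N) × Act k × Dir × Fin (nQ N) → List (Act k × Dir × Fin (nQ N))
  outgoing p (p₀ , tr) with p₀ FP.≟ p
  ... | yes _ = tr ∷ []
  ... | no _  = []

  -- Under the guess ∞ an ω-move leads to the position that Duplicator has won; a finite guess is
  -- handled by `ωBonus` instead.
  ωResp : ℕ → Maybe ℕ → List (Resp (suc P))
  ωResp t nothing  = resp t 0 zero ∷ []
  ωResp t (just _) = []

  ωBonus : ℕ → Maybe ℕ → List (ℕ × ℕ)
  ωBonus t nothing  = []
  ωBonus t (just x) = (t , x) ∷ []

  module _ (M : Fin P → Maybe ℕ) where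

    toResp : Fin (nQ N) → Entry × Fin (nQ N') → List (Resp (suc P))
    toResp p' ((t , just u)  , q') = resp t u (suc (pair p' q')) ∷ []
    toResp p' ((t , nothing) , q') = ωResp t (M (pair p' q'))

    toBonus : Fin (nQ N) → Entry × Fin (nQ N') → List (ℕ × ℕ)
    toBonus p' ((t , just u)  , q') = []
    toBonus p' ((t , nothing) , q') = ωBonus t (M (pair p' q'))

    toMove : Fin (nQ N') → Act k × Dir × Fin (nQ N) → Move (suc P)
    toMove q (a , d , p') = move d (concatMap (toResp p') (entries q a)) (concatMap (toBonus p') (entries q a))

    movesFrom : Fin (nQ N) × Fin (nQ N') → List (Move (suc P))
    movesFrom (p , q) = map (toMove q) (concatMap (outgoing p) (δ N))

    -- Position zero is won by Duplicator; position suc (pair p q) stands for the pair (p , q).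
    -- An ω-move to (p' , q') is taken to win as long as Spoiler's counter is below M (p' , q').
    game : Game (suc P)
    game zero    = []
    game (suc v) = movesFrom (remQuot (nQ N') v)

    sol : Solution game
    sol = solve-game game

    open Basics game
    open Solution sol

    move∈ : ∀ {p q a d p'} → (p , a , d , p') ∈ δ N → toMove q (a , d , p') ∈ game (suc (pair p q))
    move∈ {p} {q} {a} {d} {p'} tr∈ = subst (λ pq → toMove q (a , d , p') ∈ movesFrom pq) (sym (FP.remQuot-combine p q))
        (∈-map⁺ (toMove q) (∈-concatMap (outgoing p) tr∈ chosen))
      where
      chosen : (a , d , p') ∈ outgoing p (p , a , d , p')
      chosen with p FP.≟ p
      ... | yes _ = here refl
      ... | no ¬p = contradiction refl ¬p

    ∈move : ∀ {p q mv} → mv ∈ movesFrom (p , q) → ∃ λ a → ∃ λ d → ∃ λ p' → (p , a , d , p') ∈ δ N × mv ≡ toMove q (a , d , p')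
    ∈move {p} {q} mv∈ with ∈-map⁻ (toMove q) mv∈
    ... | (a , d , p') , o∈ , refl with concatMap-∈ (outgoing p) {δ N} o∈
    ... | (p₀ , tr) , tr∈ , o∈' with p₀ FP.≟ p
    ... | yes refl with o∈'
    ... | here refl = a , d , p' , tr∈ , refl

    -- Guesses may err only upwards; then every ω-move that a weak simulation uses is accepted by
    -- the game.
    Invariant : Set₁
    Invariant = ∀ {R} → IsWeakSim N N' R → ∀ {p q m n} → R (p , m) (q , n) → Fits (M (pair p q)) m

    module _ (inv : Invariant) {R : Conf N → Conf N' → Set} (sim-R : IsWeakSim N N' R) where

      -- Entries cover weak steps only from above, so Duplicator may hold more in the game than in
      -- the simulation; the upward closure absorbs the surplus.
      Up : Fin (nQ N) × Fin (nQ N') → ℕ → ℕ → Set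
      Up (p , q) m n = ∃ λ n₀ → n₀ ≤ n × R (p , m) (q , n₀)

      R↑ : Fin (suc P) → ℕ → ℕ → Set
      R↑ zero    m n = ⊤
      R↑ (suc v) m n = Up (remQuot (nQ N') v) m n

      R↑-sim : IsSim R↑
      R↑-sim (suc v) m n = go (remQuot (nQ N') v)
        where
        go : ∀ pq → Up pq m n → ∀ mv → mv ∈ movesFrom pq → ∀ m' → Eff (dir mv) m m' → Answer R↑ n mv m'
        go (p , q) (n₀ , n₀≤n , r) mv mv∈ m' eff with ∈move {p} {q} mv∈
        ... | a , d , p' , tr∈ , refl with sim-R (p , m) (q , n₀) a (p' , m') r (step tr∈ eff)
        ... | (q' , n₁) , ws , r' with entries-complete a ws
        ... | e , e∈ , cv = respond e e∈ cv
          where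
          up : ∀ {n} → n₁ ≤ n → R↑ (suc (pair p' q')) m' n
          up le = subst (λ pq → Up pq m' _) (sym (FP.remQuot-combine p' q')) (n₁ , le , r')
          ω-answer : ∀ {t} x → x ≡ M (pair p' q') → ((t , nothing) , q') ∈ entries q a → t ≤ n₀ →
            Answer R↑ n (toMove q (a , d , p')) m'
          ω-answer {t} nothing eq e∈ t≤ = inj₁ (resp t 0 zero ,
            ∈-concatMap (toResp p') e∈ (subst (λ x → resp t 0 zero ∈ ωResp t x) eq (here refl)) ,
            ℕP.≤-trans t≤ n₀≤n , tt)
          ω-answer {t} (just x) eq e∈ t≤ = inj₂ ((t , x) ,
            ∈-concatMap (toBonus p') e∈ (subst (λ x' → (t , x) ∈ ωBonus t x') eq (here refl)) ,
            ℕP.≤-trans t≤ n₀≤n , subst (λ x → Fits x m') (sym eq) (inv sim-R r'))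
          respond : ∀ e → (e , q') ∈ entries q a → Covers e n₀ n₁ → Answer R↑ n (toMove q (a , d , p')) m'
          respond (t , just u) e∈ (x , refl , n₁≤) = inj₁ (resp t u (suc (pair p' q')) ,
            ∈-concatMap (toResp p') e∈ (here refl) , ℕP.m+n≤o⇒m≤o t n₀≤n ,
            up (ℕP.≤-trans n₁≤ (ℕP.≤-trans (ℕP.≤-reflexive (ℕP.+-comm u x))
              (ℕP.+-monoˡ-≤ u (ℕP.m+n≤o⇒m≤o∸n x (subst (_≤ n) (ℕP.+-comm t x) n₀≤n))))))
          respond (t , nothing) e∈ t≤ = ω-answer (M (pair p' q')) refl e∈ t≤

      R⊆S∞ : ∀ {p q m n} → R (p , m) (q , n) → S∞ (suc (pair p q)) m n
      R⊆S∞ {p} {q} {m} {n} r = sim⊆S∞ R↑-sim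
        (subst (λ pq → Up pq m n) (sym (FP.remQuot-combine p q)) (n , ℕP.≤-refl , r))

    Stable : Set
    Stable = ∀ {v m} → Fits (M v) m → ∃ λ n → S∞ (suc v) m n

    Won : Conf N → Conf N' → Set
    Won (p , m) (q , n) = S∞ (suc (pair p q)) m n

    -- An ω-move of the game is realised by pumping beyond a value `n₁` that wins in column `m'`.
    -- Such a value exists by `Stable`, since the guess admits this column.
    Won-sim : Stable → IsWeakSim N N' Won
    Won-sim stable (p , m) (q , n) a (p' , m') w (step {d = d} tr∈ eff) = respond (sim _ m n w _ (move∈ tr∈) m' eff)
      where
      ω-move : ∀ {t q'} → ((t , nothing) , q') ∈ entries q a → t ≤ n → Fits (M (pair p' q')) m' →
        Σ (Conf N') λ d' → WeakStep N' (q , n) a d' × Won (p' , m') d'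
      ω-move {q' = q'} e∈ t≤n fits = let
        (n₁ , s) = stable fits
        (n' , n₁≤ , ws) = entries-sound a e∈ t≤n n₁
        in (q' , n') , ws , S∞-mono ℕP.≤-refl n₁≤ s
      byResp : ∀ {r} x → x ∈ entries q a → r ∈ toResp p' x → need r ≤ n → S∞ (tgt r) m' (after r n) →
        Σ (Conf N') λ d' → WeakStep N' (q , n) a d' × Won (p' , m') d'
      byResp ((t , just u) , q') e∈ (here refl) t≤n s = (q' , u + (n ∸ t)) ,
        subst (λ z → WeakStep N' (q , z) a (q' , u + (n ∸ t))) (ℕP.m+[n∸m]≡n t≤n) (entries-sound a e∈ (n ∸ t)) ,
        subst (S∞ (suc (pair p' q')) m') (ℕP.+-comm (n ∸ t) u) s
      byResp ((t , nothing) , q') e∈ r∈ t≤n s = go (M (pair p' q')) refl r∈ t≤n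
        where
        go : ∀ {r} x → x ≡ M (pair p' q') → r ∈ ωResp t x → need r ≤ n →
          Σ (Conf N') λ d' → WeakStep N' (q , n) a d' × Won (p' , m') d'
        go nothing eq (here refl) t≤n = ω-move e∈ t≤n (subst (λ x → Fits x m') eq tt)
      byBonus : ∀ {b} x → x ∈ entries q a → b ∈ toBonus p' x → proj₁ b ≤ n → m' < proj₂ b →
        Σ (Conf N') λ d' → WeakStep N' (q , n) a d' × Won (p' , m') d'
      byBonus ((t , nothing) , q') e∈ b∈ t≤n m'< = go (M (pair p' q')) refl b∈ t≤n m'<
        where
        go : ∀ {b} x → x ≡ M (pair p' q') → b ∈ ωBonus t x → proj₁ b ≤ n → m' < proj₂ b →
          Σ (Conf N') λ d' → WeakStep N' (q , n) a d' × Won (p' , m') d'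
        go (just x) eq (here refl) t≤n m'< = ω-move e∈ t≤n (subst (λ x → Fits x m') eq m'<)
      respond : Answer S∞ n (toMove q (a , d , p')) m' → Σ (Conf N') λ d' → WeakStep N' (q , n) a d' × Won (p' , m') d'
      respond (inj₁ (r , r∈ , t≤n , s)) = let (x , x∈ , r∈') = concatMap-∈ (toResp p') {entries q a} r∈ in
        byResp x x∈ r∈' t≤n s
      respond (inj₂ (b , b∈ , t≤n , m'<)) = let (x , x∈ , b∈') = concatMap-∈ (toBonus p') {entries q a} b∈ in
        byBonus x x∈ b∈' t≤n m'<

    conclude : Invariant → Stable → ∀ p q m n →
      LargestWeakSim N N' (p , m) (q , n) ⇔ InSemilinear (rep (suc (pair p q))) m n
    conclude inv stable p q m n = mk⇔
      (λ (R , sim-R , r) → rep-complete (R⊆S∞ inv sim-R r))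
      (λ i → Won , Won-sim stable , rep-sound i)

    Columns : Fin (suc P) → Set
    Columns v = (∀ m → ∃ λ n → S∞ v m n) ⊎
      (∃ λ M → (∀ {m} → m < M → ∃ λ n → S∞ v m n) × (∀ {m n} → S∞ v m n → m < M))

    shrink : ∀ {v} → Columns v → Maybe ℕ → Maybe ℕ
    shrink (inj₁ _)       x        = x
    shrink (inj₂ (y , _)) nothing  = just y
    shrink (inj₂ (y , _)) (just x) with y <? x
    ... | yes _ = just y
    ... | no _  = just x

    shrink-≼ : ∀ {v} (cs : Columns v) x → shrink cs x ≼ x
    shrink-≼ (inj₁ _)       x        = same
    shrink-≼ (inj₂ (y , _)) nothing  = cut
    shrink-≼ (inj₂ (y , _)) (just x) with y <? x
    ... | yes y<x = lower y<x
    ... | no _    = same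

    shrink-fits : ∀ {v m n} (cs : Columns v) x → Fits x m → S∞ v m n → Fits (shrink cs x) m
    shrink-fits (inj₁ _)            x        fits s = fits
    shrink-fits (inj₂ (_ , _ , lt)) nothing  fits s = lt s
    shrink-fits (inj₂ (y , _ , lt)) (just x) fits s with y <? x
    ... | yes _ = lt s
    ... | no _  = fits

    shrink-stable : ∀ {v m} (cs : Columns v) x → shrink cs x ≡ x → Fits x m → ∃ λ n → S∞ v m n
    shrink-stable {m = m} (inj₁ all) x _ _ = all m
    shrink-stable (inj₂ (y , has , _)) nothing () _
    shrink-stable (inj₂ (y , has , _)) (just x) eq fits with y <? x
    shrink-stable (inj₂ (y , has , _)) (just x) refl fits | yes y<x = contradiction y<x (ℕP.<-irrefl refl)
    ... | no y≮x = has (ℕP.<-≤-trans fits (ℕP.≮⇒≥ y≮x))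

    shrunk : Fin P → Maybe ℕ
    shrunk v = shrink (columns (suc v)) (M v)

  -- Every weak simulation lies in the winning region for the old guesses, so it also respects the
  -- columns at which that region ends.
  shrunk-invariant : ∀ M → Invariant M → Invariant (shrunk M)
  shrunk-invariant M inv sim-R {p} {q} r =
    shrink-fits M (Solution.columns (sol M) (suc (pair p q))) (M (pair p q)) (inv sim-R r) (R⊆S∞ M inv sim-R r)

  Answered : Set₁
  Answered = Σ (Fin P → Maybe ℕ) λ M → Invariant M × Stable M

  ≼-finite : ∀ {x y} → x ≼ y → infinite x ≡ infinite y → finite x ≤ finite y
  ≼-finite same       _ = ℕP.≤-refl
  ≼-finite (lower lt) _ = ℕP.<⇒≤ lt

  ≼-changed : ∀ {x y} → x ≼ y → infinite x ≡ infinite y → ¬ finite x < finite y → x ≡ y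
  ≼-changed same       _ _   = refl
  ≼-changed (lower lt) _ ¬lt = contradiction lt ¬lt

  -- The number of infinite guesses never grows, and while it is constant the sum of the finite ones
  -- falls unless no guess changes. Unchanged guesses are stable.
  iterate-shrink : ∀ a b M → ΣFin (λ v → infinite (M v)) ≤ a → ΣFin (λ v → finite (M v)) ≤ b → Invariant M → Answered
  iterate-shrink a b M inf≤ fin≤ inv = decide (FP.any? λ v → infinite (M′ v) <? infinite (M v)) (FP.any? λ v → finite (M′ v) <? finite (M v))
    where
    M′ : Fin P → Maybe ℕ
    M′ = shrunk M
    M′≼M : ∀ v → M′ v ≼ M v
    M′≼M v = shrink-≼ M (Solution.columns (sol M) (suc v)) (M v)
    fewer : ∀ a → ΣFin (λ v → infinite (M v)) ≤ a → ∀ v → infinite (M′ v) < infinite (M v) → Answered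
    smaller : ∀ b → ΣFin (λ v → finite (M v)) ≤ b → (∀ v → infinite (M′ v) ≡ infinite (M v)) →
      ∀ v → finite (M′ v) < finite (M v) → Answered
    decide : Dec (∃ λ v → infinite (M′ v) < infinite (M v)) → Dec (∃ λ v → finite (M′ v) < finite (M v)) → Answered
    decide (yes (v , lt)) _ = fewer a inf≤ v lt
    decide (no ¬fewer) (yes (v , lt)) = smaller b fin≤ inf≡ v lt
      where
      inf≡ : ∀ v → infinite (M′ v) ≡ infinite (M v)
      inf≡ v = ℕP.≤-antisym (≼-infinite (M′≼M v)) (ℕP.≮⇒≥ λ lt → ¬fewer (v , lt))
    decide (no ¬fewer) (no ¬smaller) = M , inv , λ {v} fits →
      shrink-stable M (Solution.columns (sol M) (suc v)) (M v)
        (≼-changed (M′≼M v) (ℕP.≤-antisym (≼-infinite (M′≼M v)) (ℕP.≮⇒≥ λ lt → ¬fewer (v , lt))) (λ lt → ¬smaller (v , lt))) fits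
    fewer zero    le v lt = contradiction (ℕP.≤-trans (ΣFin-< (λ v → ≼-infinite (M′≼M v)) v lt) le) λ ()
    -- A guess that becomes finite may enlarge the sum, so the second bound is chosen afresh.
    fewer (suc a) le v lt = iterate-shrink a _ M′
      (ℕP.≤-pred (ℕP.≤-trans (ΣFin-< (λ v → ≼-infinite (M′≼M v)) v lt) le)) ℕP.≤-refl (shrunk-invariant M inv)
    smaller zero    le inf≡ v lt = contradiction (ℕP.≤-trans (ΣFin-< (λ v → ≼-finite (M′≼M v) (inf≡ v)) v lt) le) λ ()
    smaller (suc b) le inf≡ v lt = iterate-shrink a b M′
      (ℕP.≤-trans (ΣFin-≤ λ v → ℕP.≤-reflexive (inf≡ v)) inf≤)
      (ℕP.≤-pred (ℕP.≤-trans (ΣFin-< (λ v → ≼-finite (M′≼M v) (inf≡ v)) v lt) le)) (shrunk-invariant M inv)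

  answered : Answered
  answered = iterate-shrink _ _ (λ _ → nothing) ℕP.≤-refl ℕP.≤-refl λ _ _ → tt

theorem5p23 : {k : ℕ} (N N' : OCN k) →
    Σ (Fin (nQ N) → Fin (nQ N') → Semilinear) λ rep →
    ∀ p q m n → LargestWeakSim N N' (p , m) (q , n) ⇔ InSemilinear (rep p q) m n
theorem5p23 N N' = let (M , inv , stable) = Omega.answered N N' in
  (λ p q → Solution.rep (Omega.sol N N' M) (suc (combine p q))) , Omega.conclude N N' M inv stable
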